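{- Let $R$ be a commutative ring and let $G$ be an edge-labeled graph over $R$ that is locally regular $1$-mono. Then $R_G$ is a projective $R$-module. If $R$ is a PID, or $R$ is of the form $A[x_1,\dots,x_n]$ with $A$ a PID or a field, then $R_G$ is also free.
   Context: An edge-labeled graph $G$ over $R$ is a finite graph $(V,E)$ with a map $\alpha$ from $E$ to the set of ideals of $R$. A spline is a function $s:V\to R$ with $s(u)-s(v)\in\alpha(e_{uv})$ for every edge $e_{uv}$ joining $u$ and $v$; the splines form a ring $R_G$ under pointwise operations, which is an $R$-module via constant splines. Standing assumption: $R_G$ is a finitely generated $R$-module. For $f\in R$, $U_f=D(f)\subseteq\operatorname{Spec}(R)$, and $G_f$ is the edge-labeled graph over $R_f$ with the same underlying graph and each edge ideal $I$ replaced by $IR_f$; for a prime $\mathfrak{p}$, $G_{\mathfrak{p}}$ is defined likewise over $R_{\mathfrak{p}}$. An edge of an edge-labeled graph over a ring $B$ is trivial if its label is the unit ideal $B$. The determining subgraphs of an edge-labeled graph are the connected components having at least one edge of the graph obtained by deleting all trivial edges. An edge-labeled graph over $B$ is regular $1$-mono if for each determining subgraph $H_i$ all edges of $H_i$ are labeled by the same ideal $I_i$, and $I_i$ is generated by a single regular element (non-zero-divisor) of $B$; a graph with all edges trivial is vacuously regular $1$-mono. $G$ is locally regular $1$-mono if either there is a standard open cover $\{U_f\}$ of $\operatorname{Spec}(R)$ such that each $G_f$ is regular $1$-mono, or $G_{\mathfrak{p}}$ is regular $1$-mono for every prime ideal $\mathfrak{p}$ of $R$. -}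

module Defs where

open import Level using (Level; _⊔_; suc)
open import Algebra.Bundles using (CommutativeRing)
open import Algebra.Module.Bundles using (Module)
open import Algebra.Module.Morphism.Structures using (IsModuleHomomorphism)
open import Algebra.Module.Structures.Biased using (IsModuleFromLeft)
open import Algebra.Morphism.Bundles using (RingHomomorphism)
open import Algebra.Morphism.Structures using (IsRingIsomorphism)
import Algebra.Definitions.RawMonoid as RawMonoidDefinitions
import Algebra.Properties.AbelianGroup as AbelianGroupProperties
import Algebra.Properties.Ring as RingProperties
import Algebra.Properties.Semiring.Exp as SemiringExp
import Algebra.Solver.Ring.NaturalCoefficients.Default as SemiringSolver
open import Data.Fin.Base using (Fin)
open import Data.List.Base using (List; []; _∷_)
open import Data.Nat.Base as ℕ using (ℕ; zero)
open import Data.Product.Base using (∃; ∃₂; _×_; _,_)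
open import Data.Sum.Base using (_⊎_; [_,_])
open import Function.Base using (_∘_)
open import Function.Definitions using (Injective; Surjective)
open import Relation.Binary.Bundles using (Poset)
open import Relation.Binary.Construct.Closure.Equivalence using (EqClosure)
open import Relation.Binary.PropositionalEquality.Core using (_≡_)
import Relation.Binary.Reasoning.Setoid as SetoidReasoning
open import Relation.Nullary.Negation.Core using (¬_)
open import Relation.Unary using (Pred; _∈_; _≐_)

private
  variable
    a b c m ℓ ℓa ℓb ℓm p s : Level

-- The chain C may be empty, so the hypothesis makes X inhabited.

ZornsLemma : ∀ a ℓ₁ ℓ₂ b → Set (suc (a ⊔ ℓ₁ ⊔ ℓ₂ ⊔ b))
ZornsLemma a ℓ₁ ℓ₂ b = (X : Poset a ℓ₁ ℓ₂) → let open Poset X in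
  ((C : Pred Carrier b) →
     (∀ {x y} → x ∈ C → y ∈ C → x ≤ y ⊎ y ≤ x) →
     ∃ λ u → ∀ {x} → x ∈ C → x ≤ u) →
  ∃ λ x → ∀ y → x ≤ y → y ≈ x

module _ (R : CommutativeRing c ℓ) where
  open CommutativeRing R

  record Ideal p : Set (c ⊔ ℓ ⊔ suc p) where
    field
      member : Pred Carrier p
      resp   : ∀ {x y} → x ≈ y → x ∈ member → y ∈ member
      0∈     : 0# ∈ member
      +∈     : ∀ {x y} → x ∈ member → y ∈ member → x + y ∈ member
      *∈     : ∀ r {x} → x ∈ member → r * x ∈ member

  Regular : Carrier → Set (c ⊔ ℓ)
  Regular r = ∀ x → r * x ≈ 0# → x ≈ 0#

module _ {R : CommutativeRing c ℓ} where
  open CommutativeRing R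
  open RingProperties ring using (-1*x≈-x)

  infix 4 _∈ᴵ_ _≐ᴵ_

  _∈ᴵ_ : Carrier → Ideal R p → Set p
  x ∈ᴵ I = x ∈ Ideal.member I

  _≐ᴵ_ : Ideal R a → Ideal R b → Set (c ⊔ a ⊔ b)
  I ≐ᴵ J = Ideal.member I ≐ Ideal.member J

  IsUnitIdeal : Ideal R p → Set (c ⊔ p)
  IsUnitIdeal I = ∀ x → x ∈ᴵ I

  -∈ : (I : Ideal R p) → ∀ {x} → x ∈ᴵ I → (- x) ∈ᴵ I
  -∈ I {x} x∈I = Ideal.resp I (-1*x≈-x x) (Ideal.*∈ I (- 1#) x∈I)

  data Generated (X : Pred Carrier p) : Pred Carrier (c ⊔ ℓ ⊔ p) where
    gen      : ∀ {x} → x ∈ X → x ∈ Generated X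
    gen-resp : ∀ {x y} → x ≈ y → x ∈ Generated X → y ∈ Generated X
    gen-0    : 0# ∈ Generated X
    gen-+    : ∀ {x y} → x ∈ Generated X → y ∈ Generated X → x + y ∈ Generated X
    gen-*    : ∀ r {x} → x ∈ Generated X → r * x ∈ Generated X

  generated : Pred Carrier p → Ideal R (c ⊔ ℓ ⊔ p)
  generated X = record
    { member = Generated X
    ; resp   = gen-resp
    ; 0∈     = gen-0
    ; +∈     = gen-+
    ; *∈     = gen-*
    }

  principal : Carrier → Ideal R (c ⊔ ℓ)
  principal g = record
    { member = λ x → ∃ λ r → x ≈ r * g
    ; resp   = λ { x≈y (r , x≈rg) → r , trans (sym x≈y) x≈rg }
    ; 0∈     = 0# , sym (zeroˡ g)
    ; +∈     = λ { (r , x≈rg) (t , y≈tg) →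
                   r + t , trans (+-cong x≈rg y≈tg) (sym (distribʳ g r t)) }
    ; *∈     = λ { t (r , x≈rg) →
                   t * r , trans (*-congˡ x≈rg) (sym (*-assoc t r g)) }
    }

module _ {A : CommutativeRing a ℓa} {B : CommutativeRing b ℓb} where
  private
    module A = CommutativeRing A
    module B = CommutativeRing B

  extend : RingHomomorphism A.rawRing B.rawRing →
           Ideal A p → Ideal B (a ⊔ b ⊔ ℓb ⊔ p)
  extend φ I = generated (λ y → ∃ λ x → x ∈ᴵ I × y B.≈ ⟦ x ⟧)
    where open RingHomomorphism φ

module _ (R : CommutativeRing c ℓ) where
  open CommutativeRing R

  record IsPID : Set (suc (c ⊔ ℓ)) where
    field
      nontrivial     : ¬ 1# ≈ 0#
      noZeroDivisors : ∀ x y → x * y ≈ 0# → x ≈ 0# ⊎ y ≈ 0#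
      isPrincipal    : (I : Ideal R (c ⊔ ℓ)) → ∃ λ g → I ≐ᴵ principal {R = R} g

  record IsField : Set (c ⊔ ℓ) where
    field
      nontrivial : ¬ 1# ≈ 0#
      inverse    : ∀ x → ¬ x ≈ 0# → ∃ λ y → x * y ≈ 1#

-- Polynomials are lists of coefficients, constant term first, two lists being
-- identified when they agree up to trailing zeros.

module Polynomial (A : CommutativeRing a ℓa) where
  private
    module A = CommutativeRing A

  open A using (Carrier; 0#; 1#)
  open RingProperties A.ring using (-0#≈0#)
  open SemiringSolver A.commutativeSemiring

  infixl 6 _+_
  infixl 7 _*_ _·_
  infix  8 -_
  infix  4 _≈_

  Poly : Set a
  Poly = List Carrier

  coeff : Poly → ℕ → Carrier
  coeff []      _         = 0#
  coeff (x ∷ _) zero      = x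
  coeff (_ ∷ f) (ℕ.suc k) = coeff f k

  record _≈_ (f g : Poly) : Set ℓa where
    constructor mk≈
    field
      at : ∀ k → coeff f k A.≈ coeff g k

  open _≈_ public

  _+_ : Poly → Poly → Poly
  []      + g       = g
  (x ∷ f) + []      = x ∷ f
  (x ∷ f) + (y ∷ g) = x A.+ y ∷ f + g

  -_ : Poly → Poly
  - []      = []
  - (x ∷ f) = A.- x ∷ - f

  _·_ : Carrier → Poly → Poly
  x · []      = []
  x · (y ∷ f) = x A.* y ∷ x · f

  _*_ : Poly → Poly → Poly
  []      * g = []
  (x ∷ f) * g = x · g + (0# ∷ f * g)

  coeff-+ : ∀ f g k → coeff (f + g) k A.≈ coeff f k A.+ coeff g k
  coeff-+ []      g       k         = A.sym (A.+-identityˡ _)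
  coeff-+ (x ∷ f) []      k         = A.sym (A.+-identityʳ _)
  coeff-+ (x ∷ f) (y ∷ g) zero      = A.refl
  coeff-+ (x ∷ f) (y ∷ g) (ℕ.suc k) = coeff-+ f g k

  coeff-neg : ∀ f k → coeff (- f) k A.≈ A.- coeff f k
  coeff-neg []      k         = A.sym -0#≈0#
  coeff-neg (x ∷ f) zero      = A.refl
  coeff-neg (x ∷ f) (ℕ.suc k) = coeff-neg f k

  coeff-· : ∀ x f k → coeff (x · f) k A.≈ x A.* coeff f k
  coeff-· x []      k         = A.sym (A.zeroʳ x)
  coeff-· x (y ∷ f) zero      = A.refl
  coeff-· x (y ∷ f) (ℕ.suc k) = coeff-· x f k

  private
    ≈-refl : ∀ {f} → f ≈ f
    ≈-refl = mk≈ λ _ → A.refl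

    ≈-sym : ∀ {f g} → f ≈ g → g ≈ f
    ≈-sym f≈g = mk≈ λ k → A.sym (at f≈g k)

    ≈-trans : ∀ {f g h} → f ≈ g → g ≈ h → f ≈ h
    ≈-trans f≈g g≈h = mk≈ λ k → A.trans (at f≈g k) (at g≈h k)

    +-cong : ∀ {f g h k} → f ≈ g → h ≈ k → f + h ≈ g + k
    +-cong {f} {g} {h} {k} f≈g h≈k = mk≈ λ i → A.trans (coeff-+ f h i)
      (A.trans (A.+-cong (at f≈g i) (at h≈k i)) (A.sym (coeff-+ g k i)))

    +-assoc : ∀ f g h → (f + g) + h ≈ f + (g + h)
    +-assoc f g h = mk≈ λ k → begin
      coeff ((f + g) + h) k                      ≈⟨ coeff-+ (f + g) h k ⟩
      coeff (f + g) k A.+ coeff h k              ≈⟨ A.+-congʳ (coeff-+ f g k) ⟩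
      (coeff f k A.+ coeff g k) A.+ coeff h k    ≈⟨ A.+-assoc _ _ _ ⟩
      coeff f k A.+ (coeff g k A.+ coeff h k)    ≈⟨ A.+-congˡ (coeff-+ g h k) ⟨
      coeff f k A.+ coeff (g + h) k              ≈⟨ coeff-+ f (g + h) k ⟨
      coeff (f + (g + h)) k                      ∎
      where open SetoidReasoning A.setoid

    +-comm : ∀ f g → f + g ≈ g + f
    +-comm f g = mk≈ λ k → A.trans (coeff-+ f g k)
      (A.trans (A.+-comm _ _) (A.sym (coeff-+ g f k)))

    +-identityʳ : ∀ f → f + [] ≈ f
    +-identityʳ f = ≈-trans (+-comm f []) ≈-refl

    neg-cong : ∀ {f g} → f ≈ g → - f ≈ - g
    neg-cong {f} {g} f≈g = mk≈ λ k → A.trans (coeff-neg f k)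
      (A.trans (A.-‿cong (at f≈g k)) (A.sym (coeff-neg g k)))

    neg-inverseˡ : ∀ f → (- f) + f ≈ []
    neg-inverseˡ f = mk≈ λ k → A.trans (coeff-+ (- f) f k)
      (A.trans (A.+-congʳ (coeff-neg f k)) (A.-‿inverseˡ _))

    ∷-cong : ∀ {x y f g} → x A.≈ y → f ≈ g → x ∷ f ≈ y ∷ g
    ∷-cong x≈y f≈g = mk≈ λ where
      zero      → x≈y
      (ℕ.suc k) → at f≈g k

    0∷[] : 0# ∷ [] ≈ []
    0∷[] = mk≈ λ where
      zero      → A.refl
      (ℕ.suc k) → A.refl

    ·-cong : ∀ {x y f g} → x A.≈ y → f ≈ g → x · f ≈ y · g
    ·-cong {x} {y} {f} {g} x≈y f≈g = mk≈ λ k → A.trans (coeff-· x f k)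
      (A.trans (A.*-cong x≈y (at f≈g k)) (A.sym (coeff-· y g k)))

    ·-zero : ∀ f → 0# · f ≈ []
    ·-zero f = mk≈ λ k → A.trans (coeff-· 0# f k) (A.zeroˡ _)

    ·-distrib-+ : ∀ x f g → x · (f + g) ≈ x · f + x · g
    ·-distrib-+ x f g = mk≈ λ k → begin
      coeff (x · (f + g)) k                        ≈⟨ coeff-· x (f + g) k ⟩
      x A.* coeff (f + g) k                        ≈⟨ A.*-congˡ (coeff-+ f g k) ⟩
      x A.* (coeff f k A.+ coeff g k)              ≈⟨ A.distribˡ _ _ _ ⟩
      x A.* coeff f k A.+ x A.* coeff g k
        ≈⟨ A.+-cong (coeff-· x f k) (coeff-· x g k) ⟨
      coeff (x · f) k A.+ coeff (x · g) k          ≈⟨ coeff-+ (x · f) (x · g) k ⟨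
      coeff (x · f + x · g) k                      ∎
      where open SetoidReasoning A.setoid

    ·-assoc : ∀ x y f → (x A.* y) · f ≈ x · (y · f)
    ·-assoc x y f = mk≈ λ k → begin
      coeff ((x A.* y) · f) k     ≈⟨ coeff-· (x A.* y) f k ⟩
      (x A.* y) A.* coeff f k     ≈⟨ A.*-assoc _ _ _ ⟩
      x A.* (y A.* coeff f k)     ≈⟨ A.*-congˡ (coeff-· y f k) ⟨
      x A.* coeff (y · f) k       ≈⟨ coeff-· x (y · f) k ⟨
      coeff (x · (y · f)) k       ∎
      where open SetoidReasoning A.setoid

    +-interchange : ∀ f g h k → (f + g) + (h + k) ≈ (f + h) + (g + k)
    +-interchange f g h k = mk≈ λ i → begin
      coeff ((f + g) + (h + k)) i
        ≈⟨ expand f g h k i ⟩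
      (coeff f i A.+ coeff g i) A.+ (coeff h i A.+ coeff k i)
        ≈⟨ solve 4 (λ w x y z → (w :+ x) :+ (y :+ z) := (w :+ y) :+ (x :+ z))
             A.refl _ _ _ _ ⟩
      (coeff f i A.+ coeff h i) A.+ (coeff g i A.+ coeff k i)
        ≈⟨ expand f h g k i ⟨
      coeff ((f + h) + (g + k)) i ∎
      where
      open SetoidReasoning A.setoid
      expand : ∀ f g h k i → coeff ((f + g) + (h + k)) i A.≈
        (coeff f i A.+ coeff g i) A.+ (coeff h i A.+ coeff k i)
      expand f g h k i = A.trans (coeff-+ (f + g) (h + k) i)
        (A.+-cong (coeff-+ f g i) (coeff-+ h k i))

    *-congˡ : ∀ f {g h} → g ≈ h → f * g ≈ f * h
    *-congˡ []      g≈h = ≈-refl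
    *-congˡ (x ∷ f) g≈h = +-cong (·-cong A.refl g≈h) (∷-cong A.refl (*-congˡ f g≈h))

    *-zeroʳ : ∀ f → f * [] ≈ []
    *-zeroʳ []      = ≈-refl
    *-zeroʳ (x ∷ f) = ≈-trans (∷-cong A.refl (*-zeroʳ f)) 0∷[]

    *-distribˡ : ∀ f g h → f * (g + h) ≈ f * g + f * h
    *-distribˡ []      g h = ≈-refl
    *-distribˡ (x ∷ f) g h = ≈-trans
      (+-cong (·-distrib-+ x g h)
              (∷-cong (A.sym (A.+-identityˡ 0#)) (*-distribˡ f g h)))
      (+-interchange (x · g) (x · h) (0# ∷ f * g) (0# ∷ f * h))

    +-swap : ∀ f g h → f + (g + h) ≈ g + (f + h)
    +-swap f g h = ≈-trans (≈-sym (+-assoc f g h))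
      (≈-trans (+-cong (+-comm f g) ≈-refl) (+-assoc g f h))

    *-∷ : ∀ f y g → f * (y ∷ g) ≈ y · f + (0# ∷ f * g)
    *-∷ []      y g = ≈-sym 0∷[]
    *-∷ (x ∷ f) y g = ∷-cong (A.+-congʳ (A.*-comm x y))
      (≈-trans (+-cong ≈-refl (*-∷ f y g)) (+-swap (x · g) (y · f) (0# ∷ f * g)))

    *-comm : ∀ f g → f * g ≈ g * f
    *-comm []      g = ≈-sym (*-zeroʳ g)
    *-comm (x ∷ f) g = ≈-trans (+-cong ≈-refl (∷-cong A.refl (*-comm f g)))
      (≈-sym (*-∷ g x f))

    *-cong : ∀ {f g h k} → f ≈ g → h ≈ k → f * h ≈ g * k
    *-cong {f} {g} {h} {k} f≈g h≈k = ≈-trans (*-congˡ f h≈k)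
      (≈-trans (*-comm f k) (≈-trans (*-congˡ k f≈g) (*-comm k g)))

    *-distribʳ : ∀ h f g → (f + g) * h ≈ f * h + g * h
    *-distribʳ h f g = ≈-trans (*-comm (f + g) h)
      (≈-trans (*-distribˡ h f g) (+-cong (*-comm h f) (*-comm h g)))

    ·-*-assoc : ∀ x f g → (x · f) * g ≈ x · (f * g)
    ·-*-assoc x []      g = ≈-refl
    ·-*-assoc x (y ∷ f) g = ≈-trans
      (+-cong (·-assoc x y g) (∷-cong (A.sym (A.zeroʳ x)) (·-*-assoc x f g)))
      (≈-sym (·-distrib-+ x (y · g) (0# ∷ f * g)))

    *-assoc : ∀ f g h → (f * g) * h ≈ f * (g * h)
    *-assoc []      g h = ≈-refl
    *-assoc (x ∷ f) g h = ≈-trans (*-distribʳ h (x · g) (0# ∷ f * g))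
      (+-cong (·-*-assoc x g h)
        (≈-trans (+-cong (·-zero h) ≈-refl) (∷-cong A.refl (*-assoc f g h))))

    *-identityˡ : ∀ f → (1# ∷ []) * f ≈ f
    *-identityˡ f = ≈-trans (+-cong (mk≈ λ k →
      A.trans (coeff-· 1# f k) (A.*-identityˡ _)) 0∷[]) (+-identityʳ f)

  polynomialRing : CommutativeRing a ℓa
  polynomialRing = record
    { Carrier = Poly
    ; _≈_ = _≈_
    ; _+_ = _+_
    ; _*_ = _*_
    ; -_ = -_
    ; 0# = []
    ; 1# = 1# ∷ []
    ; isCommutativeRing = record
      { isRing = record
        { +-isAbelianGroup = record
          { isGroup = record
            { isMonoid = record
              { isSemigroup = record
                { isMagma = record
                  { isEquivalence = record
                    { refl = ≈-refl ; sym = ≈-sym ; trans = ≈-trans }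
                  ; ∙-cong = +-cong
                  }
                ; assoc = +-assoc
                }
              ; identity = (λ f → ≈-refl) , +-identityʳ
              }
            ; inverse = neg-inverseˡ
                      , λ f → ≈-trans (+-comm f (- f)) (neg-inverseˡ f)
            ; ⁻¹-cong = neg-cong
            }
          ; comm = +-comm
          }
        ; *-cong = *-cong
        ; *-assoc = *-assoc
        ; *-identity = *-identityˡ
                     , λ f → ≈-trans (*-comm f (1# ∷ [])) (*-identityˡ f)
        ; distrib = *-distribˡ , *-distribʳ
        }
      ; *-comm = *-comm
      }
    }

_[x₁⋯x_] : CommutativeRing a ℓa → ℕ → CommutativeRing a ℓa
A [x₁⋯x zero    ] = A
A [x₁⋯x ℕ.suc k ] = Polynomial.polynomialRing (A [x₁⋯x k ])

_≅_ : CommutativeRing a ℓa → CommutativeRing b ℓb → Set (a ⊔ b ⊔ ℓa ⊔ ℓb)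
A ≅ B = ∃ λ (f : A.Carrier → B.Carrier) → IsRingIsomorphism A.rawRing B.rawRing f
  where
  module A = CommutativeRing A
  module B = CommutativeRing B

IsPolynomialRingOverPIDOrField :
  ∀ a ℓa → CommutativeRing c ℓ → Set (c ⊔ ℓ ⊔ suc (a ⊔ ℓa))
IsPolynomialRingOverPIDOrField a ℓa R =
  ∃₂ λ (A : CommutativeRing a ℓa) k → (IsPID A ⊎ IsField A) × R ≅ (A [x₁⋯x k ])

module _ {R : CommutativeRing c ℓ} (M : Module R m ℓm) where
  open CommutativeRing R
  open Module M
  open RawMonoidDefinitions +ᴹ-rawMonoid using (sum)

  linearCombination : ∀ {k} → (Fin k → Carrier) → (Fin k → Carrierᴹ) → Carrierᴹ
  linearCombination r v = sum (λ i → r i *ₗ v i)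

  FinitelyGenerated : Set (c ⊔ m ⊔ ℓm)
  FinitelyGenerated = ∃₂ λ k (g : Fin k → Carrierᴹ) →
    ∀ x → ∃ λ r → x ≈ᴹ linearCombination r g

  record IsBasis {I : Set a} (v : I → Carrierᴹ) : Set (a ⊔ c ⊔ ℓ ⊔ m ⊔ ℓm) where
    field
      spanning    : ∀ x → ∃₂ λ k (i : Fin k → I) → ∃ λ r →
                    x ≈ᴹ linearCombination r (v ∘ i)
      independent : ∀ {k} (i : Fin k → I) → Injective _≡_ _≡_ i → ∀ r →
                    linearCombination r (v ∘ i) ≈ᴹ 0ᴹ → ∀ j → r j ≈ 0#

  Free : Set (c ⊔ ℓ ⊔ suc m ⊔ ℓm)
  Free = ∃₂ λ (I : Set m) (v : I → Carrierᴹ) → IsBasis v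

-- Lifting along surjections.  The test modules are confined to the universe
-- levels a, ℓa, b, ℓb; for the unrestricted notion, quantify over these levels.

Projective : ∀ a ℓa b ℓb {R : CommutativeRing c ℓ} → Module R m ℓm →
             Set (c ⊔ ℓ ⊔ m ⊔ ℓm ⊔ suc (a ⊔ ℓa ⊔ b ⊔ ℓb))
Projective a ℓa b ℓb {R} P =
  (M : Module R a ℓa) (N : Module R b ℓb) →
  let module M = Module M
      module N = Module N
  in (q : M.Carrierᴹ → N.Carrierᴹ) → IsModuleHomomorphism M.rawModule N.rawModule q →
     Surjective M._≈ᴹ_ N._≈ᴹ_ q →
     (f : P.Carrierᴹ → N.Carrierᴹ) → IsModuleHomomorphism P.rawModule N.rawModule f →
     ∃ λ (g : P.Carrierᴹ → M.Carrierᴹ) →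
       IsModuleHomomorphism P.rawModule M.rawModule g × (∀ x → q (g x) N.≈ᴹ f x)
  where module P = Module P

module _ {A : CommutativeRing a ℓa} {B : CommutativeRing b ℓb} where
  private
    module A = CommutativeRing A
    module B = CommutativeRing B

  asModule : RingHomomorphism A.rawRing B.rawRing → Module A b ℓb
  asModule φ = record
    { Carrierᴹ = B.Carrier
    ; _≈ᴹ_ = B._≈_
    ; _+ᴹ_ = B._+_
    ; _*ₗ_ = λ r x → ⟦ r ⟧ B.* x
    ; _*ᵣ_ = λ x r → ⟦ r ⟧ B.* x
    ; 0ᴹ = B.0#
    ; -ᴹ_ = B.-_
    ; isModule = IsModuleFromLeft.isModule {commutativeRing = A} (record
      { isLeftModule = record
        { isLeftSemimodule = record
          { +ᴹ-isCommutativeMonoid = B.+-isCommutativeMonoid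
          ; isPreleftSemimodule = record
            { *ₗ-cong = λ r≈t x≈y → B.*-cong (⟦⟧-cong r≈t) x≈y
            ; *ₗ-zeroˡ = λ x → B.trans (B.*-congʳ 0#-homo) (B.zeroˡ x)
            ; *ₗ-distribʳ = λ x r t →
                B.trans (B.*-congʳ (+-homo r t)) (B.distribʳ x _ _)
            ; *ₗ-identityˡ = λ x → B.trans (B.*-congʳ 1#-homo) (B.*-identityˡ x)
            ; *ₗ-assoc = λ r t x →
                B.trans (B.*-congʳ (*-homo r t)) (B.*-assoc _ _ x)
            ; *ₗ-zeroʳ = λ r → B.zeroʳ _
            ; *ₗ-distribˡ = λ r x y → B.distribˡ _ x y
            }
          }
        ; -ᴹ‿cong = B.-‿cong
        ; -ᴹ‿inverse = B.-‿inverse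
        }
      })
    }
    where open RingHomomorphism φ

record MultiplicativeSubset (R : CommutativeRing c ℓ) s : Set (c ⊔ ℓ ⊔ suc s) where
  open CommutativeRing R
  field
    member : Pred Carrier s
    1∈     : 1# ∈ member
    *∈     : ∀ {x y} → x ∈ member → y ∈ member → x * y ∈ member

module Localization (R : CommutativeRing c ℓ) (S : MultiplicativeSubset R s) where
  private
    module R = CommutativeRing R
    module S = MultiplicativeSubset S

  open RingProperties R.ring using (-‿distribˡ-*; -‿distribʳ-*)
  open SemiringSolver R.commutativeSemiring

  infixl 6 _+_
  infixl 7 _*_
  infix  8 -_
  infix  4 _≈_

  record Fraction : Set (c ⊔ s) where
    constructor _/_⟨_⟩
    field
      num   : R.Carrier
      den   : R.Carrier
      den∈S : den ∈ S.member

  open Fraction public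

  record _≈_ (x y : Fraction) : Set (c ⊔ ℓ ⊔ s) where
    constructor mk≈
    field
      factor   : R.Carrier
      factor∈S : factor ∈ S.member
      cross-eq : factor R.* (num x R.* den y) R.≈ factor R.* (num y R.* den x)

  _+_ : Fraction → Fraction → Fraction
  x + y = (num x R.* den y R.+ num y R.* den x) / (den x R.* den y)
            ⟨ S.*∈ (den∈S x) (den∈S y) ⟩

  _*_ : Fraction → Fraction → Fraction
  x * y = (num x R.* num y) / (den x R.* den y) ⟨ S.*∈ (den∈S x) (den∈S y) ⟩

  -_ : Fraction → Fraction
  - x = (R.- num x) / den x ⟨ den∈S x ⟩

  fromR : R.Carrier → Fraction
  fromR r = r / R.1# ⟨ S.1∈ ⟩

  private
    open SetoidReasoning R.setoid

    cross : ∀ {x y} → num x R.* den y R.≈ num y R.* den x → x ≈ y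
    cross eq = mk≈ R.1# S.1∈ (R.*-congˡ eq)

    ≈-trans : ∀ {x y z} → x ≈ y → y ≈ z → x ≈ z
    ≈-trans {x} {y} {z} (mk≈ t t∈ p) (mk≈ u u∈ q) =
      mk≈ (t R.* u R.* den y) (S.*∈ (S.*∈ t∈ u∈) (den∈S y)) (begin
        (t R.* u R.* den y) R.* (num x R.* den z)
          ≈⟨ solve 5 (λ t u y x z → (t :* u :* y) :* (x :* z)
                      := (u :* z) :* (t :* (x :* y))) R.refl _ _ _ _ _ ⟩
        (u R.* den z) R.* (t R.* (num x R.* den y))
          ≈⟨ R.*-congˡ p ⟩
        (u R.* den z) R.* (t R.* (num y R.* den x))
          ≈⟨ solve 5 (λ t u y x z → (u :* z) :* (t :* (y :* x))
                      := (t :* x) :* (u :* (y :* z))) R.refl _ _ _ _ _ ⟩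
        (t R.* den x) R.* (u R.* (num y R.* den z))
          ≈⟨ R.*-congˡ q ⟩
        (t R.* den x) R.* (u R.* (num z R.* den y))
          ≈⟨ solve 5 (λ t u y x z → (t :* x) :* (u :* (z :* y))
                      := (t :* u :* y) :* (z :* x)) R.refl _ _ _ _ _ ⟩
        (t R.* u R.* den y) R.* (num z R.* den x) ∎)

    +-cong : ∀ {x y z w} → x ≈ y → z ≈ w → x + z ≈ y + w
    +-cong {x} {y} {z} {w} (mk≈ t t∈ p) (mk≈ u u∈ q) =
      mk≈ (t R.* u) (S.*∈ t∈ u∈) (begin
        (t R.* u) R.* ((num x R.* den z R.+ num z R.* den x) R.* (den y R.* den w))
          ≈⟨ solve 8 (λ t u x x′ z z′ y′ w′ →
               (t :* u) :* ((x :* z′ :+ z :* x′) :* (y′ :* w′))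
               := (u :* z′ :* w′) :* (t :* (x :* y′))
                  :+ (t :* x′ :* y′) :* (u :* (z :* w′)))
             R.refl t u (num x) (den x) (num z) (den z) (den y) (den w) ⟩
        (u R.* den z R.* den w) R.* (t R.* (num x R.* den y))
          R.+ (t R.* den x R.* den y) R.* (u R.* (num z R.* den w))
          ≈⟨ R.+-cong (R.*-congˡ p) (R.*-congˡ q) ⟩
        (u R.* den z R.* den w) R.* (t R.* (num y R.* den x))
          R.+ (t R.* den x R.* den y) R.* (u R.* (num w R.* den z))
          ≈⟨ solve 8 (λ t u x′ z′ y y′ w w′ →
               (u :* z′ :* w′) :* (t :* (y :* x′))
                  :+ (t :* x′ :* y′) :* (u :* (w :* z′))
               := (t :* u) :* ((y :* w′ :+ w :* y′) :* (x′ :* z′)))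
             R.refl t u (den x) (den z) (num y) (den y) (num w) (den w) ⟩
        (t R.* u) R.* ((num y R.* den w R.+ num w R.* den y) R.* (den x R.* den z)) ∎)

    *-cong : ∀ {x y z w} → x ≈ y → z ≈ w → x * z ≈ y * w
    *-cong {x} {y} {z} {w} (mk≈ t t∈ p) (mk≈ u u∈ q) =
      mk≈ (t R.* u) (S.*∈ t∈ u∈) (begin
        (t R.* u) R.* ((num x R.* num z) R.* (den y R.* den w))
          ≈⟨ rearrange t u (num x) (num z) (den y) (den w) ⟩
        (t R.* (num x R.* den y)) R.* (u R.* (num z R.* den w))
          ≈⟨ R.*-cong p q ⟩
        (t R.* (num y R.* den x)) R.* (u R.* (num w R.* den z))
          ≈⟨ rearrange t u (num y) (num w) (den x) (den z) ⟨
        (t R.* u) R.* ((num y R.* num w) R.* (den x R.* den z)) ∎)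
      where
      rearrange : ∀ t u x z y w → (t R.* u) R.* ((x R.* z) R.* (y R.* w)) R.≈
                                  (t R.* (x R.* y)) R.* (u R.* (z R.* w))
      rearrange = solve 6 (λ t u x z y w → (t :* u) :* ((x :* z) :* (y :* w))
        := (t :* (x :* y)) :* (u :* (z :* w))) R.refl

    neg-cong : ∀ {x y} → x ≈ y → - x ≈ - y
    neg-cong {x} {y} (mk≈ t t∈ p) = mk≈ t t∈ (begin
      t R.* ((R.- num x) R.* den y)    ≈⟨ pull t (num x) (den y) ⟨
      R.- (t R.* (num x R.* den y))    ≈⟨ R.-‿cong p ⟩
      R.- (t R.* (num y R.* den x))    ≈⟨ pull t (num y) (den x) ⟩
      t R.* ((R.- num y) R.* den x)    ∎)
      where
      pull : ∀ t x y → R.- (t R.* (x R.* y)) R.≈ t R.* ((R.- x) R.* y)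
      pull t x y = R.trans (-‿distribʳ-* t _) (R.*-congˡ (-‿distribˡ-* x y))

    +-assoc : ∀ x y z → (x + y) + z ≈ x + (y + z)
    +-assoc x y z = cross (solve 6 (λ x x′ y y′ z z′ →
      ((x :* y′ :+ y :* x′) :* z′ :+ z :* (x′ :* y′)) :* (x′ :* (y′ :* z′))
      := (x :* (y′ :* z′) :+ (y :* z′ :+ z :* y′) :* x′) :* ((x′ :* y′) :* z′))
      R.refl (num x) (den x) (num y) (den y) (num z) (den z))

    +-comm : ∀ x y → x + y ≈ y + x
    +-comm x y = cross (solve 4 (λ x x′ y y′ →
      (x :* y′ :+ y :* x′) :* (y′ :* x′) := (y :* x′ :+ x :* y′) :* (x′ :* y′))
      R.refl (num x) (den x) (num y) (den y))

    +-identityˡ : ∀ x → fromR R.0# + x ≈ x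
    +-identityˡ x = cross (solve 2 (λ x x′ →
      (con 0 :* x′ :+ x :* con 1) :* x′ := x :* (con 1 :* x′))
      R.refl (num x) (den x))

    neg-inverseˡ : ∀ x → (- x) + x ≈ fromR R.0#
    neg-inverseˡ x = cross (begin
      ((R.- num x) R.* den x R.+ num x R.* den x) R.* R.1#
        ≈⟨ R.*-congʳ (R.sym (R.distribʳ (den x) (R.- num x) (num x))) ⟩
      ((R.- num x R.+ num x) R.* den x) R.* R.1#
        ≈⟨ R.*-congʳ (R.*-congʳ (R.-‿inverseˡ (num x))) ⟩
      (R.0# R.* den x) R.* R.1#
        ≈⟨ solve 1 (λ x′ → (con 0 :* x′) :* con 1 := con 0 :* (x′ :* x′))
             R.refl (den x) ⟩
      R.0# R.* (den x R.* den x) ∎)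

    *-assoc : ∀ x y z → (x * y) * z ≈ x * (y * z)
    *-assoc x y z = cross (solve 6 (λ x x′ y y′ z z′ →
      ((x :* y) :* z) :* (x′ :* (y′ :* z′)) := (x :* (y :* z)) :* ((x′ :* y′) :* z′))
      R.refl (num x) (den x) (num y) (den y) (num z) (den z))

    *-comm : ∀ x y → x * y ≈ y * x
    *-comm x y = cross (solve 4 (λ x x′ y y′ →
      (x :* y) :* (y′ :* x′) := (y :* x) :* (x′ :* y′))
      R.refl (num x) (den x) (num y) (den y))

    *-identityˡ : ∀ x → fromR R.1# * x ≈ x
    *-identityˡ x = cross (solve 2 (λ x x′ →
      (con 1 :* x) :* x′ := x :* (con 1 :* x′)) R.refl (num x) (den x))

    *-distribˡ : ∀ x y z → x * (y + z) ≈ x * y + x * z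
    *-distribˡ x y z = cross (solve 6 (λ x x′ y y′ z z′ →
      (x :* (y :* z′ :+ z :* y′)) :* ((x′ :* y′) :* (x′ :* z′))
      := ((x :* y) :* (x′ :* z′) :+ (x :* z) :* (x′ :* y′)) :* (x′ :* (y′ :* z′)))
      R.refl (num x) (den x) (num y) (den y) (num z) (den z))

    *-distribʳ : ∀ x y z → (y + z) * x ≈ y * x + z * x
    *-distribʳ x y z = cross (solve 6 (λ x x′ y y′ z z′ →
      ((y :* z′ :+ z :* y′) :* x) :* ((y′ :* x′) :* (z′ :* x′))
      := ((y :* x) :* (z′ :* x′) :+ (z :* x) :* (y′ :* x′)) :* ((y′ :* z′) :* x′))
      R.refl (num x) (den x) (num y) (den y) (num z) (den z))

  localization : CommutativeRing (c ⊔ s) (c ⊔ ℓ ⊔ s)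
  localization = record
    { Carrier = Fraction
    ; _≈_ = _≈_
    ; _+_ = _+_
    ; _*_ = _*_
    ; -_ = -_
    ; 0# = fromR R.0#
    ; 1# = fromR R.1#
    ; isCommutativeRing = record
      { isRing = record
        { +-isAbelianGroup = record
          { isGroup = record
            { isMonoid = record
              { isSemigroup = record
                { isMagma = record
                  { isEquivalence = record
                    { refl  = cross R.refl
                    ; sym   = λ { (mk≈ t t∈ p) → mk≈ t t∈ (R.sym p) }
                    ; trans = ≈-trans
                    }
                  ; ∙-cong = +-cong
                  }
                ; assoc = +-assoc
                }
              ; identity = +-identityˡ , λ x →
                  ≈-trans (+-comm x (fromR R.0#)) (+-identityˡ x)
              }
            ; inverse = neg-inverseˡ , λ x →
                ≈-trans (+-comm x (- x)) (neg-inverseˡ x)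
            ; ⁻¹-cong = neg-cong
            }
          ; comm = +-comm
          }
        ; *-cong = *-cong
        ; *-assoc = *-assoc
        ; *-identity = *-identityˡ , λ x →
            ≈-trans (*-comm x (fromR R.1#)) (*-identityˡ x)
        ; distrib = *-distribˡ , *-distribʳ
        }
      ; *-comm = *-comm
      }
    }

  localize : RingHomomorphism R.rawRing (CommutativeRing.rawRing localization)
  localize = record
    { ⟦_⟧ = fromR
    ; isRingHomomorphism = record
      { isSemiringHomomorphism = record
        { isNearSemiringHomomorphism = record
          { +-isMonoidHomomorphism = record
            { isMagmaHomomorphism = record
              { isRelHomomorphism = record { cong = λ x≈y → cross (R.*-congʳ x≈y) }
              ; homo = λ x y → cross (solve 2 (λ x y →
                  (x :+ y) :* (con 1 :* con 1)
                  := (x :* con 1 :+ y :* con 1) :* con 1) R.refl x y)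
              }
            ; ε-homo = cross R.refl
            }
          ; *-homo = λ x y → cross (R.*-congˡ (R.*-identityˡ R.1#))
          }
        ; 1#-homo = cross R.refl
        }
      ; -‿homo = λ x → cross R.refl
      }
    }

module _ (R : CommutativeRing c ℓ) where
  open CommutativeRing R
  open SemiringExp semiring using (_^_; ^-homo-*)

  record PrimeIdeal p : Set (c ⊔ ℓ ⊔ suc p) where
    field
      ideal  : Ideal R p
      proper : ¬ 1# ∈ᴵ ideal
      prime  : ∀ {x y} → (x * y) ∈ᴵ ideal → x ∈ᴵ ideal ⊎ y ∈ᴵ ideal

  Spec : Set (suc (c ⊔ ℓ))
  Spec = PrimeIdeal (c ⊔ ℓ)

  D : Carrier → Pred Spec (c ⊔ ℓ)
  D f 𝔭 = ¬ f ∈ᴵ PrimeIdeal.ideal 𝔭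

  IsStandardOpenCover : Pred Carrier a → Set (suc (c ⊔ ℓ) ⊔ a)
  IsStandardOpenCover F = (𝔭 : Spec) → ∃ λ f → f ∈ F × 𝔭 ∈ D f

  powers : Carrier → MultiplicativeSubset R ℓ
  powers f = record
    { member = λ x → ∃ λ k → x ≈ f ^ k
    ; 1∈     = 0 , refl
    ; *∈     = λ { (j , x≈) (k , y≈) →
                   j ℕ.+ k , trans (*-cong x≈ y≈) (sym (^-homo-* f j k)) }
    }

  complement : PrimeIdeal p → MultiplicativeSubset R p
  complement 𝔭 = record
    { member = λ x → ¬ x ∈ᴵ ideal
    ; 1∈     = proper
    ; *∈     = λ x∉ y∉ xy∈ → [ x∉ , y∉ ] (prime xy∈)
    }
    where open PrimeIdeal 𝔭

-- Loops and parallel edges are allowed; source and target only choose an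
-- orientation, on which neither splines nor connectedness depend.

record EdgeLabeledGraph (R : CommutativeRing c ℓ) p : Set (c ⊔ ℓ ⊔ suc p) where
  field
    #vertices     : ℕ
    #edges        : ℕ
    source target : Fin #edges → Fin #vertices
    label         : Fin #edges → Ideal R p

  Vertex Edge : Set
  Vertex = Fin #vertices
  Edge   = Fin #edges

module _ {A : CommutativeRing a ℓa} {B : CommutativeRing b ℓb} where

  extendLabels : RingHomomorphism (CommutativeRing.rawRing A) (CommutativeRing.rawRing B) →
                 EdgeLabeledGraph A p → EdgeLabeledGraph B (a ⊔ b ⊔ ℓb ⊔ p)
  extendLabels φ G = record
    { #vertices = #vertices
    ; #edges    = #edges
    ; source    = source
    ; target    = target
    ; label     = λ e → extend {A = A} {B = B} φ (label e)
    }
    where open EdgeLabeledGraph G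

module _ {R : CommutativeRing c ℓ} (G : EdgeLabeledGraph R p) where
  open CommutativeRing R
  open EdgeLabeledGraph G
  open RingProperties ring using (-0#≈0#; -‿distribˡ-*; -‿distribʳ-*)
  open AbelianGroupProperties +-abelianGroup using () renaming (⁻¹-∙-comm to -‿+-comm)
  open SemiringSolver commutativeSemiring

  record Spline : Set (c ⊔ p) where
    constructor spline
    field
      value      : Vertex → Carrier
      compatible : ∀ e → (value (source e) - value (target e)) ∈ᴵ label e

  open Spline

  private
    +-compatible : ∀ (I : Ideal R p) {x y z w} →
      (x - y) ∈ᴵ I → (z - w) ∈ᴵ I → ((x + z) - (y + w)) ∈ᴵ I
    +-compatible I {x} {y} {z} {w} u v = Ideal.resp I (begin
      (x - y) + (z - w)
        ≈⟨ solve 4 (λ x y z w → (x :+ y) :+ (z :+ w) := (x :+ z) :+ (y :+ w))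
             refl x (- y) z (- w) ⟩
      (x + z) + (- y - w)    ≈⟨ +-congˡ (-‿+-comm y w) ⟩
      (x + z) - (y + w)      ∎) (Ideal.+∈ I u v)
      where open SetoidReasoning setoid

    *-compatible : ∀ (I : Ideal R p) {x y z w} →
      (x - y) ∈ᴵ I → (z - w) ∈ᴵ I → ((x * z) - (y * w)) ∈ᴵ I
    *-compatible I {x} {y} {z} {w} u v = Ideal.resp I (begin
      z * (x - y) + y * (z - w)
        ≈⟨ solve 5 (λ x y z y′ w′ → z :* (x :+ y′) :+ y :* (z :+ w′)
                    := x :* z :+ (z :* (y :+ y′) :+ y :* w′))
             refl x y z (- y) (- w) ⟩
      x * z + (z * (y - y) + y * (- w))
        ≈⟨ +-congˡ (+-cong (trans (*-congˡ (-‿inverseʳ y)) (zeroʳ z))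
                           (sym (-‿distribʳ-* y w))) ⟩
      x * z + (0# - y * w)   ≈⟨ +-congˡ (+-identityˡ _) ⟩
      x * z - y * w          ∎) (Ideal.+∈ I (Ideal.*∈ I z u) (Ideal.*∈ I y v))
      where open SetoidReasoning setoid

    neg-compatible : ∀ (I : Ideal R p) {x y} → (x - y) ∈ᴵ I → (- x - - y) ∈ᴵ I
    neg-compatible I {x} {y} u =
      Ideal.resp I (sym (-‿+-comm x (- y))) (-∈ {R = R} I u)

    const-compatible : ∀ (I : Ideal R p) r → (r - r) ∈ᴵ I
    const-compatible I r = Ideal.resp I (sym (-‿inverseʳ r)) (Ideal.0∈ I)

  constant : Carrier → Spline
  constant r = spline (λ _ → r) (λ e → const-compatible (label e) r)

  splineRing : CommutativeRing (c ⊔ p) ℓ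
  splineRing = record
    { Carrier = Spline
    ; _≈_ = λ u v → ∀ x → value u x ≈ value v x
    ; _+_ = λ u v → spline (λ x → value u x + value v x)
              (λ e → +-compatible (label e) (compatible u e) (compatible v e))
    ; _*_ = λ u v → spline (λ x → value u x * value v x)
              (λ e → *-compatible (label e) (compatible u e) (compatible v e))
    ; -_ = λ u → spline (λ x → - value u x)
              (λ e → neg-compatible (label e) (compatible u e))
    ; 0# = constant 0#
    ; 1# = constant 1#
    ; isCommutativeRing = record
      { isRing = record
        { +-isAbelianGroup = record
          { isGroup = record
            { isMonoid = record
              { isSemigroup = record
                { isMagma = record
                  { isEquivalence = record
                    { refl  = λ _ → refl
                    ; sym   = λ u≈v x → sym (u≈v x)
                    ; trans = λ u≈v v≈w x → trans (u≈v x) (v≈w x)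
                    }
                  ; ∙-cong = λ u≈v w≈z x → +-cong (u≈v x) (w≈z x)
                  }
                ; assoc = λ u v w x → +-assoc _ _ _
                }
              ; identity = (λ u x → +-identityˡ _) , (λ u x → +-identityʳ _)
              }
            ; inverse = (λ u x → -‿inverseˡ _) , (λ u x → -‿inverseʳ _)
            ; ⁻¹-cong = λ u≈v x → -‿cong (u≈v x)
            }
          ; comm = λ u v x → +-comm _ _
          }
        ; *-cong = λ u≈v w≈z x → *-cong (u≈v x) (w≈z x)
        ; *-assoc = λ u v w x → *-assoc _ _ _
        ; *-identity = (λ u x → *-identityˡ _) , (λ u x → *-identityʳ _)
        ; distrib = (λ u v w x → distribˡ _ _ _) , (λ u v w x → distribʳ _ _ _)
        }
      ; *-comm = λ u v x → *-comm _ _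
      }
    }

  constants : RingHomomorphism rawRing (CommutativeRing.rawRing splineRing)
  constants = record
    { ⟦_⟧ = constant
    ; isRingHomomorphism = record
      { isSemiringHomomorphism = record
        { isNearSemiringHomomorphism = record
          { +-isMonoidHomomorphism = record
            { isMagmaHomomorphism = record
              { isRelHomomorphism = record { cong = λ r≈t _ → r≈t }
              ; homo = λ _ _ _ → refl
              }
            ; ε-homo = λ _ → refl
            }
          ; *-homo = λ _ _ _ → refl
          }
        ; 1#-homo = λ _ → refl
        }
      ; -‿homo = λ _ _ → refl
      }
    }

  splineModule : Module R (c ⊔ p) ℓ
  splineModule = asModule {A = R} {B = splineRing} constants

  Trivial : Edge → Set (c ⊔ p)
  Trivial e = IsUnitIdeal {R = R} (label e)

  Adjacent : Vertex → Vertex → Set (c ⊔ p)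
  Adjacent u v = ∃ λ e → ¬ Trivial e × source e ≡ u × target e ≡ v

  Connected : Vertex → Vertex → Set (c ⊔ p)
  Connected = EqClosure Adjacent

  -- A connected component is presented by one of its vertices, so the same
  -- subgraph has several presentations.  HasEdge need only look at the source of
  -- a nontrivial edge, which is Connected to the target.

  record DeterminingSubgraph : Set (c ⊔ p) where
    field
      root : Vertex

    HasVertex : Vertex → Set (c ⊔ p)
    HasVertex v = Connected root v

    HasEdge : Edge → Set (c ⊔ p)
    HasEdge e = ¬ Trivial e × HasVertex (source e)

    field
      nonempty : ∃ HasEdge

  Regular1Mono : Set (c ⊔ ℓ ⊔ suc p)
  Regular1Mono = (H : DeterminingSubgraph) → let open DeterminingSubgraph H in
    ∃ λ (I : Ideal R p) →
      (∀ e → HasEdge e → label e ≐ᴵ I) ×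
      (∃ λ g → Regular R g × I ≐ᴵ principal {R = R} g)

module _ {R : CommutativeRing c ℓ} (G : EdgeLabeledGraph R p) where
  open CommutativeRing R

  localizeGraph : (S : MultiplicativeSubset R s) →
                  EdgeLabeledGraph (Localization.localization R S) (c ⊔ ℓ ⊔ p ⊔ s)
  localizeGraph S = extendLabels {A = R} {B = localization} localize G
    where open Localization R S

  LocallyRegular1Mono : Set (suc (c ⊔ ℓ ⊔ p))
  LocallyRegular1Mono =
    (∃ λ (F : Pred Carrier (c ⊔ ℓ)) → IsStandardOpenCover R F ×
       (∀ f → f ∈ F → Regular1Mono (localizeGraph (powers R f))))
    ⊎
    ((𝔭 : Spec R) → Regular1Mono (localizeGraph (complement R 𝔭)))

{-# OPTIONS --safe #-}
module Submission where

-- Let M_k be the module of splines vanishing at the first k vertices.  Evaluation at the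
-- next vertex maps M_k onto an ideal J_k with kernel M_{k+1}.  At a prime, J_k is
-- generated by a regular element: by a generator of the label of the component of that
-- vertex if the component contains an earlier vertex, and by 1 otherwise.  Hence J_k is invertible,
-- the filtration splits, and the spline module is the direct sum of the J_k.  A PID, and
-- a polynomial ring over a PID or a field, is a GCD domain; there invertible ideals are
-- principal, so freeness needs no appeal to the Quillen–Suslin theorem.

open import Defs
open import Level using (Level; _⊔_; 0ℓ; Lift; lift; lower) renaming (suc to lsuc)
open import Algebra.Bundles using (CommutativeMonoid; CommutativeRing)
import Algebra.Definitions.RawMagma as RawMagmaDefinitions
open import Algebra.Module.Bundles using (Module)
import Algebra.Module.Morphism.Construct.Identity as Identity
open import Algebra.Module.Morphism.Structures using (IsModuleHomomorphism)
open import Algebra.Morphism.Structures using (IsRingIsomorphism)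
import Algebra.Properties.AbelianGroup as AbelianGroupProperties
import Algebra.Properties.CommutativeSemigroup as CommutativeSemigroupProperties
import Algebra.Properties.CommutativeSemigroup.Divisibility as CommutativeDivisibility
import Algebra.Properties.Group as GroupProperties
import Algebra.Properties.Ring as RingProperties
import Algebra.Properties.Semiring.Divisibility as SemiringDivisibility
import Algebra.Properties.Semiring.Exp as SemiringExp
import Algebra.Solver.Ring.NaturalCoefficients.Default as SemiringSolver
open import Axiom.ExcludedMiddle using (ExcludedMiddle)
open import Data.Fin.Base using (Fin; zero; suc; toℕ; fromℕ<)
open import Data.Fin.Properties using (_≟_; toℕ-fromℕ<; toℕ-injective; toℕ<n; suc-injective)
open import Data.List.Base using ([]; _∷_; length)
open import Data.Nat.Base as ℕ using (ℕ; zero; z≤n; s≤s)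
import Data.Nat.Properties as ℕ
open import Data.Product.Base using (∃; ∃₂; _×_; _,_; proj₁; proj₂)
open import Data.Sum.Base using (_⊎_; inj₁; inj₂; [_,_]′)
open import Function.Base using (_∘_; id)
open import Function.Bundles using (_⇔_; mk⇔; Equivalence)
open import Function.Definitions using (Injective; Surjective)
open import Relation.Binary.Bundles using (Poset)
open import Relation.Binary.Construct.Closure.ReflexiveTransitive using (ε; _◅_; _◅◅_)
open import Relation.Binary.Construct.Closure.Symmetric using (SymClosure; fwd; bwd)
open import Relation.Binary.Core using (Rel)
open import Relation.Binary.Definitions using (tri<; tri≈; tri>)
open import Relation.Binary.PropositionalEquality.Core as ≡ using (_≡_)
import Relation.Binary.Reasoning.Setoid as SetoidReasoning
open import Relation.Nullary using (¬_; Dec; yes; no; contradiction)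
open import Relation.Nullary.Decidable using (True; toWitness; fromWitness; decidable-stable)
open import Relation.Unary using (Pred; _∈_)

private
  variable
    c ℓ α ℓα β ℓβ μ ℓμ ι ρ ς : Level

-- `R` need not be Noetherian, so the finite generation of the spline module does not automatically
-- pass to M_k. Yet it is needed at each level: it is what lets the denominators that occur at a
-- prime be replaced by a single `t`. The way out is to alternate: finite generation of M_k splits
-- M_k → J_k, and the resulting projection of M_k onto M_{k+1} carries generators to generators.
-- Localized modules never appear. A global claim is stated for a parameter `r`, with the wanted
-- claim at r = 1, in such a way that the good `r` form an ideal. Each prime then has only to miss
-- one good `r`, and a local generator with cleared denominators provides it. Since a membership
-- proof may be a record of maps, this argument also patches maps. GCD domains are defined by
-- principal colon ideals because this is what freeness consumes: an invertible J equals (a) : ((a)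
-- : J), two colons in a row. The same definition passes to polynomial rings by Gauss's lemma,
-- without any gcd being chosen.

record Coordinates {R : CommutativeRing c ℓ} (M : Module R μ ℓμ) (N : ℕ) :
                   Set (c ⊔ ℓ ⊔ μ ⊔ ℓμ) where
  open CommutativeRing R
  open Module M
  field
    at          : Fin N → Carrierᴹ → Carrier
    at-cong     : ∀ v {f g} → f ≈ᴹ g → at v f ≈ at v g
    at-+        : ∀ v f g → at v (f +ᴹ g) ≈ at v f + at v g
    at-*        : ∀ v r f → at v (r *ₗ f) ≈ r * at v f
    at-faithful : ∀ {f} → (∀ v → at v f ≈ 0#) → f ≈ᴹ 0ᴹ

  VanishesBelow : ℕ → Pred Carrierᴹ ℓ
  VanishesBelow k f = ∀ v → toℕ v ℕ.< k → at v f ≈ 0#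

  -- After inverting S, the κ-th coordinates of the elements vanishing below κ form an
  -- ideal generated by a regular element.
  LocalGenerator : MultiplicativeSubset R ς → Fin N → Set _
  LocalGenerator S κ = ∃ λ g → VanishesBelow (toℕ κ) g ×
    (∀ f → VanishesBelow (toℕ κ) f →
      ∃₂ λ t r → t ∈ member × t * at κ f ≈ r * at κ g) ×
    (∀ x → x * at κ g ≈ 0# → ∃ λ t → t ∈ member × t * x ≈ 0#)
    where open MultiplicativeSubset S

-- Once local generators are found, splines enter only through this embedding into a power of `R`.
splineCoordinates : {R : CommutativeRing c ℓ} (G : EdgeLabeledGraph R ι) →
                    Coordinates (splineModule G) (EdgeLabeledGraph.#vertices G)
splineCoordinates {R = R} G = record
  { at          = λ v f → Spline.value f v
  ; at-cong     = λ v f≈g → f≈g v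
  ; at-+        = λ _ _ _ → refl
  ; at-*        = λ _ _ _ → refl
  ; at-faithful = λ f≈0 → f≈0
  }
  where open CommutativeRing R

-- Existence of primes

module _ (em : ∀ ℓ → ExcludedMiddle ℓ) (zorn : ∀ a ℓ₁ ℓ₂ b → ZornsLemma a ℓ₁ ℓ₂ b)
         (R : CommutativeRing c ℓ) where
  open CommutativeRing R
  open SemiringSolver commutativeSemiring

  -- Excluded middle provides propositional resizing, which keeps the union of a
  -- chain of ideals at the level of the ideals themselves.
  Small : Set α → Set (c ⊔ ℓ)
  Small {α} P = Lift (c ⊔ ℓ) (True (em α {P}))

  shrink : {P : Set α} → P → Small P
  shrink p = lift (fromWitness p)

  unshrink : {P : Set α} → Small P → P
  unshrink p = toWitness (lower p)

  module _ (I : Ideal R ι) where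

    ProperIdealOver : Set (lsuc (c ⊔ ℓ) ⊔ ι)
    ProperIdealOver = ∃ λ (J : Ideal R (c ⊔ ℓ)) →
      (∀ {x} → x ∈ᴵ I → x ∈ᴵ J) × ¬ 1# ∈ᴵ J

    properIdealsOver : Poset _ _ _
    properIdealsOver = record
      { Carrier = ProperIdealOver
      ; _≈_ = λ J K → proj₁ J ≐ᴵ proj₁ K
      ; _≤_ = λ J K → ∀ {x} → x ∈ᴵ proj₁ J → x ∈ᴵ proj₁ K
      ; isPartialOrder = record
        { isPreorder = record
          { isEquivalence = record
            { refl  = (λ z → z) , (λ z → z)
            ; sym   = λ { (f , g) → g , f }
            ; trans = λ { (f , g) (h , k) → (λ z → h (f z)) , (λ z → g (k z)) }
            }
          ; reflexive = λ e → proj₁ e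
          ; trans     = λ f g z → g (f z)
          }
        ; antisym = λ f g → f , g
        }
      }

    open Poset properIdealsOver using () renaming (_≤_ to _⊑_)

    -- `I` itself is thrown in so that the empty chain is bounded as well.
    chainUnion : (C : Pred ProperIdealOver 0ℓ) →
                 (∀ {J K} → J ∈ C → K ∈ C → J ⊑ K ⊎ K ⊑ J) → Ideal R (c ⊔ ℓ)
    chainUnion C total = record
      { member = λ x → Small (x ∈ᴵ I ⊎ ∃ λ J → J ∈ C × x ∈ᴵ proj₁ J)
      ; resp   = λ e m → shrink (resp′ e (unshrink m))
      ; 0∈     = shrink (inj₁ (Ideal.0∈ I))
      ; +∈     = λ m n → shrink (+∈′ (unshrink m) (unshrink n))
      ; *∈     = λ r m → shrink (*∈′ r (unshrink m))
      }
      where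
      U : Pred Carrier _
      U x = x ∈ᴵ I ⊎ ∃ λ J → J ∈ C × x ∈ᴵ proj₁ J

      resp′ : ∀ {x y} → x ≈ y → U x → U y
      resp′ e (inj₁ m)             = inj₁ (Ideal.resp I e m)
      resp′ e (inj₂ (J , J∈C , m)) = inj₂ (J , J∈C , Ideal.resp (proj₁ J) e m)

      +∈′ : ∀ {x y} → U x → U y → U (x + y)
      +∈′ (inj₁ m) (inj₁ n) = inj₁ (Ideal.+∈ I m n)
      +∈′ (inj₁ m) (inj₂ (J , J∈C , n)) =
        inj₂ (J , J∈C , Ideal.+∈ (proj₁ J) (proj₁ (proj₂ J) m) n)
      +∈′ (inj₂ (J , J∈C , m)) (inj₁ n) =
        inj₂ (J , J∈C , Ideal.+∈ (proj₁ J) m (proj₁ (proj₂ J) n))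
      +∈′ (inj₂ (J , J∈C , m)) (inj₂ (K , K∈C , n)) with total {J} {K} J∈C K∈C
      ... | inj₁ J⊑K = inj₂ (K , K∈C , Ideal.+∈ (proj₁ K) (J⊑K m) n)
      ... | inj₂ K⊑J = inj₂ (J , J∈C , Ideal.+∈ (proj₁ J) m (K⊑J n))

      *∈′ : ∀ r {x} → U x → U (r * x)
      *∈′ r (inj₁ m)             = inj₁ (Ideal.*∈ I r m)
      *∈′ r (inj₂ (J , J∈C , m)) = inj₂ (J , J∈C , Ideal.*∈ (proj₁ J) r m)

    adjoin : Ideal R α → Carrier → Ideal R (c ⊔ ℓ ⊔ α)
    adjoin J a = record
      { member = λ x → ∃ λ m → ∃ λ r → m ∈ᴵ J × x ≈ m + r * a
      ; resp   = λ { e (m , r , m∈ , x≈) → m , r , m∈ , trans (sym e) x≈ }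
      ; 0∈     = 0# , 0# , Ideal.0∈ J , solve 1 (λ a → con 0 := con 0 :+ con 0 :* a) refl a
      ; +∈     = λ { (m , r , m∈ , x≈) (n , s , n∈ , y≈) →
          m + n , r + s , Ideal.+∈ J m∈ n∈ , trans (+-cong x≈ y≈)
            (solve 5 (λ m r n s a → (m :+ r :* a) :+ (n :+ s :* a)
                                    := (m :+ n) :+ (r :+ s) :* a) refl m r n s a) }
      ; *∈     = λ { t (m , r , m∈ , x≈) → t * m , t * r , Ideal.*∈ J t m∈ ,
          trans (*-congˡ x≈)
            (solve 4 (λ t m r a → t :* (m :+ r :* a) := t :* m :+ (t :* r) :* a)
              refl t m r a) }
      }

    chains-bounded : ¬ 1# ∈ᴵ I → (C : Pred ProperIdealOver 0ℓ) →
                     (∀ {J K} → J ∈ C → K ∈ C → J ⊑ K ⊎ K ⊑ J) →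
                     ∃ λ K → ∀ {J} → J ∈ C → J ⊑ K
    chains-bounded 1∉I C total =
      (chainUnion C total , (λ m → shrink (inj₁ m)) , λ m → 1∉U (unshrink m))
      , λ {J} J∈C m → shrink (inj₂ (J , J∈C , m))
      where
      1∉U : ¬ (1# ∈ᴵ I ⊎ ∃ λ J → J ∈ C × 1# ∈ᴵ proj₁ J)
      1∉U (inj₁ m)           = 1∉I m
      1∉U (inj₂ (J , _ , m)) = proj₂ (proj₂ J) m

    prime-over : ¬ 1# ∈ᴵ I → ∃ λ (𝔭 : Spec R) → ∀ {x} → x ∈ᴵ I → x ∈ᴵ PrimeIdeal.ideal 𝔭
    prime-over 1∉I with zorn _ _ _ 0ℓ properIdealsOver (chains-bounded 1∉I)
    ... | (𝔪 , I⊆𝔪 , 1∉𝔪) , maximal = record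
      { ideal = 𝔪 ; proper = 1∉𝔪 ; prime = prime } , I⊆𝔪
      where
      1∈adjoin : ∀ {x} → ¬ x ∈ᴵ 𝔪 → 1# ∈ᴵ adjoin 𝔪 x
      1∈adjoin {x} x∉𝔪 = decidable-stable (em _) λ 1∉ →
        x∉𝔪 (proj₁ (maximal (adjoin 𝔪 x , (λ m → old (I⊆𝔪 m)) , 1∉) old)
          (0# , 1# , Ideal.0∈ 𝔪 , solve 1 (λ x → x := con 0 :+ con 1 :* x) refl x))
        where
        old : ∀ {m} → m ∈ᴵ 𝔪 → m ∈ᴵ adjoin 𝔪 x
        old {m} m∈ = m , 0# , m∈ , solve 2 (λ m x → m := m :+ con 0 :* x) refl m x

      prime : ∀ {x y} → (x * y) ∈ᴵ 𝔪 → x ∈ᴵ 𝔪 ⊎ y ∈ᴵ 𝔪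
      prime {x} {y} xy∈ with em _ {x ∈ᴵ 𝔪}
      ... | yes x∈ = inj₁ x∈
      ... | no  x∉ with 1∈adjoin x∉
      ...   | m , r , m∈ , 1≈ = inj₂ (Ideal.resp 𝔪
        (trans (solve 4 (λ y m r x → y :* m :+ r :* (x :* y) := (m :+ r :* x) :* y)
                 refl y m r x)
               (trans (*-congʳ (sym 1≈)) (*-identityˡ y)))
        (Ideal.+∈ 𝔪 (Ideal.*∈ 𝔪 y m∈) (Ideal.*∈ 𝔪 r xy∈)))

    -- The only passage from local to global: a prime over `I` would contain the member that it is
    -- required to miss. Excluded middle strips the double negation from any type, so membership of
    -- 1 may yield data.
    1∈-if-in-no-prime : (∀ (𝔭 : Spec R) → ∃ λ x → x ∈ᴵ I × 𝔭 ∈ D R x) → 1# ∈ᴵ I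
    1∈-if-in-no-prime h = decidable-stable (em _) λ 1∉I →
      let (𝔭 , I⊆𝔭) = prime-over 1∉I
          (_ , x∈I , x∉𝔭) = h 𝔭
      in x∉𝔭 (I⊆𝔭 x∈I)

-- GCD domains

module Divisibility (R : CommutativeRing c ℓ) where
  open CommutativeRing R
  open SemiringDivisibility semiring public
    using (_∣_; _,_; 1∣_; _∣0; 0∣x⇒x≈0; x∣y∧y≉0⇒x≉0)
    renaming (∣ʳ-trans to ∣-trans; ∣ʳ-refl to ∣-refl; ∣ʳ-respʳ-≈ to ∣-respʳ
             ; ∣ʳ-respˡ-≈ to ∣-respˡ; x∣ʳy⇒x∣ʳzy to x∣y⇒x∣zy)
  open RawMagmaDefinitions *-rawMagma using (module _∣ʳ_)
  open _∣ʳ_ public using (quotient; equality)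
  open CommutativeDivisibility *-commutativeSemigroup public using (x∣y⇒zx∣zy; x∣xy)
  open RingProperties ring using (-‿distribˡ-*)

  x∣y⇒x∣yz : ∀ {x y} z → x ∣ y → x ∣ y * z
  x∣y⇒x∣yz z x∣y = ∣-respʳ (*-comm z _) (x∣y⇒x∣zy z x∣y)

  ∣-+ : ∀ {x y z} → x ∣ y → x ∣ z → x ∣ y + z
  ∣-+ {x} (p , px≈y) (q , qx≈z) = p + q , trans (distribʳ x p q) (+-cong px≈y qx≈z)

  ∣-+-cancelˡ : ∀ {x y z} → x ∣ y → x ∣ y + z → x ∣ z
  ∣-+-cancelˡ {x} {y} {z} (p , px≈y) (q , qx≈y+z) = q - p , (begin
    (q - p) * x            ≈⟨ distribʳ x q (- p) ⟩
    q * x + - p * x        ≈⟨ +-cong qx≈y+z (trans (sym (-‿distribˡ-* p x)) (-‿cong px≈y)) ⟩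
    (y + z) - y            ≈⟨ +-congʳ (+-comm y z) ⟩
    (z + y) - y            ≈⟨ +-assoc z y (- y) ⟩
    z + (y - y)            ≈⟨ +-congˡ (-‿inverseʳ y) ⟩
    z + 0#                 ≈⟨ +-identityʳ z ⟩
    z                      ∎)
    where open SetoidReasoning setoid

NoZeroDivisors : CommutativeRing c ℓ → Set (c ⊔ ℓ)
NoZeroDivisors R = ∀ x y → x * y ≈ 0# → x ≈ 0# ⊎ y ≈ 0#
  where open CommutativeRing R

-- A domain is a GCD domain if and only if all its ideals (a) : (b) are principal.

record IsGCDDomain (R : CommutativeRing c ℓ) : Set (c ⊔ ℓ) where
  open CommutativeRing R
  open Divisibility R
  field
    noZeroDivisors : NoZeroDivisors R
    colon          : ∀ a b → ∃ λ k → ∀ x → a ∣ x * b ⇔ k ∣ x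

PID⇒GCDDomain : (R : CommutativeRing c ℓ) → IsPID R → IsGCDDomain R
PID⇒GCDDomain R pid = record
  { noZeroDivisors = noZeroDivisors
  ; colon = λ a b → let (k , ⊆k , k⊆) = isPrincipal (ideal a b) in k , λ x →
      mk⇔ (λ d → let (r , e) = ⊆k d in r , sym e) (λ { (r , e) → k⊆ (r , sym e) })
  }
  where
  open IsPID pid
  open CommutativeRing R
  open Divisibility R

  ideal : ∀ a b → Ideal R _
  ideal a b = record
    { member = λ x → a ∣ x * b
    ; resp   = λ e → ∣-respʳ (*-congʳ e)
    ; 0∈     = ∣-respʳ (sym (zeroˡ b)) (a ∣0)
    ; +∈     = λ m n → ∣-respʳ (sym (distribʳ b _ _)) (∣-+ m n)
    ; *∈     = λ r m → ∣-respʳ (sym (*-assoc r _ b)) (x∣y⇒x∣zy r m)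
    }

GCDDomain-resp-≅ : (A : CommutativeRing α ℓα) (B : CommutativeRing β ℓβ) →
                   A ≅ B → IsGCDDomain B → IsGCDDomain A
GCDDomain-resp-≅ A B (f , iso) gcd = record
  { noZeroDivisors = λ x y xy≈0 → [ inj₁ ∘ f-zero , inj₂ ∘ f-zero ]′
      (noZeroDivisors (f x) (f y)
        (B.trans (B.sym (*-homo x y)) (B.trans (⟦⟧-cong xy≈0) 0#-homo)))
  ; colon = λ a b → let (k , h) = colon (f a) (f b) in f⁻¹ k , λ x → mk⇔
      (λ d → f-reflects-∣ (DB.∣-respˡ (B.sym (f-f⁻¹ k))
        (Equivalence.to (h (f x)) (DB.∣-respʳ (*-homo x b) (f-∣ d)))))
      (λ d → f-reflects-∣ (DB.∣-respʳ (B.sym (*-homo x b))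
        (Equivalence.from (h (f x)) (DB.∣-respˡ (f-f⁻¹ k) (f-∣ d)))))
  }
  where
  module A = CommutativeRing A
  module B = CommutativeRing B
  module DA = Divisibility A
  module DB = Divisibility B
  open IsGCDDomain gcd
  open IsRingIsomorphism iso

  f⁻¹ : B.Carrier → A.Carrier
  f⁻¹ y = proj₁ (surjective y)

  f-f⁻¹ : ∀ y → f (f⁻¹ y) B.≈ y
  f-f⁻¹ y = proj₂ (surjective y) A.refl

  f-zero : ∀ {x} → f x B.≈ B.0# → x A.≈ A.0#
  f-zero e = injective (B.trans e (B.sym 0#-homo))

  f-∣ : ∀ {x y} → x DA.∣ y → f x DB.∣ f y
  f-∣ {x} (p DA., e) = f p DB., B.trans (B.sym (*-homo p x)) (⟦⟧-cong e)

  f-reflects-∣ : ∀ {x y} → f x DB.∣ f y → x DA.∣ y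
  f-reflects-∣ {x} (p DB., e) = f⁻¹ p DA.,
    injective (B.trans (*-homo (f⁻¹ p) x) (B.trans (B.*-congʳ (f-f⁻¹ p)) e))

module _ (em : ∀ ℓ → ExcludedMiddle ℓ) where

  field⇒GCDDomain : (R : CommutativeRing c ℓ) → IsField R → IsGCDDomain R
  field⇒GCDDomain R isField = record
    { noZeroDivisors = nzd
    ; colon          = colon
    }
    where
    open CommutativeRing R
    open Divisibility R
    open IsField isField
    open SetoidReasoning setoid

    cancel : ∀ {x y} → ¬ x ≈ 0# → x * y ≈ 0# → y ≈ 0#
    cancel {x} {y} x≉0 xy≈0 = let (z , xz≈1) = inverse x x≉0 in begin
      y            ≈⟨ *-identityˡ y ⟨
      1# * y       ≈⟨ *-congʳ (trans (*-comm z x) xz≈1) ⟨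
      (z * x) * y  ≈⟨ *-assoc z x y ⟩
      z * (x * y)  ≈⟨ *-congˡ xy≈0 ⟩
      z * 0#       ≈⟨ zeroʳ z ⟩
      0#           ∎

    nzd : ∀ x y → x * y ≈ 0# → x ≈ 0# ⊎ y ≈ 0#
    nzd x y xy≈0 with em _ {x ≈ 0#}
    ... | yes x≈0 = inj₁ x≈0
    ... | no  x≉0 = inj₂ (cancel x≉0 xy≈0)

    -- A nonzero `a` is a unit and divides everything; (0) : (b) is the whole field for b = 0 and
    -- zero otherwise.
    colon : ∀ a b → ∃ λ k → ∀ x → a ∣ x * b ⇔ k ∣ x
    colon a b with em _ {a ≈ 0#} | em _ {b ≈ 0#}
    ... | no a≉0  | _      = let (z , az≈1) = inverse a a≉0 in 1# , λ x →
      mk⇔ (λ _ → 1∣ x)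
          (λ _ → ∣-trans (z , trans (*-comm z a) az≈1) (1∣ (x * b)))
    ... | yes a≈0 | yes b≈0 = 1# , λ x → mk⇔ (λ _ → 1∣ x)
      (λ _ → ∣-respʳ (sym (trans (*-congˡ b≈0) (zeroʳ x))) (a ∣0))
    ... | yes a≈0 | no b≉0 = 0# , λ x → mk⇔
      (λ d → ∣-respʳ (sym (cancel b≉0 (trans (*-comm b x) (0∣x⇒x≈0 (∣-respˡ a≈0 d))))) ∣-refl)
      (λ d → ∣-respʳ (sym (trans (*-congʳ (0∣x⇒x≈0 d)) (zeroˡ b))) (a ∣0))

module Domain {R : CommutativeRing c ℓ} (noZeroDivisors : NoZeroDivisors R) where
  open CommutativeRing R
  open Divisibility R
  open RingProperties ring using (x[y-z]≈xy-xz; x∙y⁻¹≈ε⇒x≈y; x≈y⇒x∙y⁻¹≈ε)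
  open SemiringSolver commutativeSemiring

  *-cancelˡ : ∀ {x y z} → ¬ x ≈ 0# → x * y ≈ x * z → y ≈ z
  *-cancelˡ {x} {y} {z} x≉0 xy≈xz
    with noZeroDivisors x (y - z) (trans (x[y-z]≈xy-xz x y z) (x≈y⇒x∙y⁻¹≈ε xy≈xz))
  ... | inj₁ x≈0   = contradiction x≈0 x≉0
  ... | inj₂ y-z≈0 = x∙y⁻¹≈ε⇒x≈y _ _ y-z≈0

  *-nonzero : ∀ {x y} → ¬ x ≈ 0# → ¬ y ≈ 0# → ¬ x * y ≈ 0#
  *-nonzero x≉0 y≉0 xy≈0 = [ x≉0 , y≉0 ]′ (noZeroDivisors _ _ xy≈0)

  ∣-cancelˡ : ∀ {x y z} → ¬ x ≈ 0# → x * y ∣ x * z → y ∣ z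
  ∣-cancelˡ {x} {y} x≉0 (p , e) = p , *-cancelˡ x≉0
    (trans (solve 3 (λ x p y → x :* (p :* y) := p :* (x :* y)) refl x p y) e)

module GCDDomain {R : CommutativeRing c ℓ} (isGCDDomain : IsGCDDomain R) where
  open CommutativeRing R hiding (zero)
  open Divisibility R
  open IsGCDDomain isGCDDomain public
  open Domain {R = R} noZeroDivisors public
  open SemiringSolver commutativeSemiring

  -- If (a) : (b₁, b₂, ...) = (d), then y d lies in (a) : (b₀) exactly when y lies in (a) : (d b₀) =
  -- (k), so the intersection is (k d).
  colons : ∀ a {n} (b : Fin n → Carrier) → ∃ λ k → ∀ x → (∀ i → a ∣ x * b i) ⇔ k ∣ x
  colons a {zero}    b = 1# , λ x → mk⇔ (λ _ → 1∣ x) (λ _ ())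
  colons a {ℕ.suc n} b with colons a {n} (b ∘ suc)
  ... | d , d-colon with colon a (d * b zero)
  ...   | k , k-colon = k * d , λ x → mk⇔ (to x) (from x)
    where
    to : ∀ x → (∀ i → a ∣ x * b i) → k * d ∣ x
    to x h with Equivalence.to (d-colon x) (h ∘ suc)
    ... | y , yd≈x with Equivalence.to (k-colon y)
          (∣-respʳ (trans (*-congʳ (sym yd≈x)) (*-assoc y d _)) (h zero))
    ...   | z , zk≈y = z , trans (sym (*-assoc z k d)) (trans (*-congʳ zk≈y) yd≈x)

    from : ∀ x → k * d ∣ x → ∀ i → a ∣ x * b i
    from x (z , e) zero = ∣-respʳ
      (trans (solve 4 (λ z k d b → (z :* k) :* (d :* b) := (z :* (k :* d)) :* b)
               refl z k d (b zero)) (*-congʳ e))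
      (Equivalence.from (k-colon (z * k)) (z , refl))
    from x (z , e) (suc i) = Equivalence.from (d-colon x)
      (z * k , trans (*-assoc z k d) e) i

-- Polynomials over GCD domains

module PolynomialCoefficients (A : CommutativeRing α ℓα) where
  open CommutativeRing A hiding (zero)
  open Polynomial A public using (Poly; coeff; coeff-+; polynomialRing; mk≈; at)
  open Polynomial A using (coeff-·; _·_)
  open Divisibility A
  open SetoidReasoning setoid
  module P = CommutativeRing polynomialRing

  opaque
    -- Opaque, as products with `x ∷ []` would otherwise reduce to list expressions in which `P.*`
    -- is no longer visible.
    const : Carrier → Poly
    const x = x ∷ []

  tail : Poly → Poly
  tail []      = []
  tail (_ ∷ f) = f

  opaque
    unfolding const

    coeff-const-* : ∀ x f k → coeff (const x P.* f) k ≈ x * coeff f k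
    coeff-const-* x f k = begin
      coeff (x · f P.+ (0# ∷ [])) k            ≈⟨ coeff-+ (x · f) (0# ∷ []) k ⟩
      coeff (x · f) k + coeff (0# ∷ []) k      ≈⟨ +-cong (coeff-· x f k) (0∷[]-zero k) ⟩
      x * coeff f k + 0#                       ≈⟨ +-identityʳ _ ⟩
      x * coeff f k                            ∎
      where
      0∷[]-zero : ∀ k → coeff (0# ∷ []) k ≈ 0#
      0∷[]-zero zero      = refl
      0∷[]-zero (ℕ.suc k) = refl

    const-* : ∀ x y → const x P.* const y P.≈ const (x * y)
    const-* x y = mk≈ λ where
      zero      → coeff-const-* x (const y) 0
      (ℕ.suc k) → trans (coeff-const-* x (const y) (ℕ.suc k)) (zeroʳ x)

    coeff-const : ∀ x → coeff (const x) 0 ≈ x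
    coeff-const x = refl

  coeff-*-zero : ∀ f g → coeff (f P.* g) 0 ≈ coeff f 0 * coeff g 0
  coeff-*-zero []      g = sym (zeroˡ _)
  coeff-*-zero (x ∷ f) g = begin
    coeff (x · g P.+ (0# ∷ f P.* g)) 0  ≈⟨ coeff-+ (x · g) (0# ∷ f P.* g) 0 ⟩
    coeff (x · g) 0 + 0#                ≈⟨ +-identityʳ _ ⟩
    coeff (x · g) 0                     ≈⟨ coeff-· x g 0 ⟩
    x * coeff g 0                       ∎

  -- Splits `f` as f₀ + X · `tail f`. This and its mirror image drive the inductions on degree,
  -- which peel off constant terms because lists start with them.
  coeff-*-sucˡ : ∀ f g k →
    coeff (f P.* g) (ℕ.suc k) ≈ coeff f 0 * coeff g (ℕ.suc k) + coeff (tail f P.* g) k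
  coeff-*-sucˡ []      g k = sym (trans (+-identityʳ _) (zeroˡ _))
  coeff-*-sucˡ (x ∷ f) g k = trans (coeff-+ (x · g) (0# ∷ f P.* g) (ℕ.suc k))
    (+-congʳ (coeff-· x g (ℕ.suc k)))

  coeff-*-sucʳ : ∀ f g k →
    coeff (f P.* g) (ℕ.suc k) ≈ coeff g 0 * coeff f (ℕ.suc k) + coeff (f P.* tail g) k
  coeff-*-sucʳ f g k = trans (at (P.*-comm f g) (ℕ.suc k))
    (trans (coeff-*-sucˡ g f k) (+-congˡ (at (P.*-comm (tail g) f) k)))

  -- Phrased by coefficients, since trailing zeros keep the length of a list from being invariant
  -- under `P.≈`.
  DegreeBelow : ℕ → Poly → Set ℓα
  DegreeBelow n f = ∀ k → n ℕ.≤ k → coeff f k ≈ 0#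

  degreeBelow-length : ∀ f → DegreeBelow (length f) f
  degreeBelow-length []      k         _         = refl
  degreeBelow-length (x ∷ f) (ℕ.suc k) (s≤s n≤k) = degreeBelow-length f k n≤k

  degreeBelow-tail : ∀ {n} f → DegreeBelow (ℕ.suc n) f → DegreeBelow n (tail f)
  degreeBelow-tail []      h k n≤k = refl
  degreeBelow-tail (x ∷ f) h k n≤k = h (ℕ.suc k) (s≤s n≤k)

  coeff-tail : ∀ f k → coeff (tail f) k ≡ coeff f (ℕ.suc k)
  coeff-tail []      k = ≡.refl
  coeff-tail (x ∷ f) k = ≡.refl

  degreeBelow-const-* : ∀ {n} x f → DegreeBelow n f → DegreeBelow n (const x P.* f)
  degreeBelow-const-* x f h k n≤k =
    trans (coeff-const-* x f k) (trans (*-congˡ (h k n≤k)) (zeroʳ x))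

  divide-coeffs : ∀ x f → (∀ k → x ∣ coeff f k) → ∃ λ g → f P.≈ const x P.* g
  divide-coeffs x f h = let (g , e) = quotients f h in
    g , mk≈ λ k → trans (e k) (sym (coeff-const-* x g k))
    where
    quotients : ∀ f → (∀ k → x ∣ coeff f k) → ∃ λ g → ∀ k → coeff f k ≈ x * coeff g k
    quotients []      h = [] , λ k → sym (zeroʳ x)
    quotients (y ∷ f) h with h 0 | quotients f (h ∘ ℕ.suc)
    ... | z , zx≈y | g , e = z ∷ g , λ where
      zero      → trans (sym zx≈y) (*-comm z x)
      (ℕ.suc k) → e k

  opaque
    monomial : ℕ → Carrier → Poly
    monomial zero      x = const x
    monomial (ℕ.suc j) x = 0# ∷ monomial j x

    coeff-monomial-* : ∀ j x f k → coeff (monomial j x P.* f) (j ℕ.+ k) ≈ x * coeff f k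
    coeff-monomial-* zero      x f k = coeff-const-* x f k
    coeff-monomial-* (ℕ.suc j) x f k = begin
      coeff (monomial (ℕ.suc j) x P.* f) (ℕ.suc (j ℕ.+ k))
        ≈⟨ coeff-*-sucˡ (monomial (ℕ.suc j) x) f (j ℕ.+ k) ⟩
      0# * _ + coeff (monomial j x P.* f) (j ℕ.+ k)
        ≈⟨ +-cong (zeroˡ _) (coeff-monomial-* j x f k) ⟩
      0# + x * coeff f k
        ≈⟨ +-identityˡ _ ⟩
      x * coeff f k ∎

-- Identities for pseudo-division and for cross-multiplied fractions

module LinearDivisibility (R : CommutativeRing α ℓα) where
  open CommutativeRing R
  open Divisibility R
  open SemiringSolver commutativeSemiring

  ∣-combine : ∀ {f g u v x y} r s → f ∣ (x * u) * g → f ∣ (y * v) * g →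
              f ∣ ((x * y) * (r * u + s * v)) * g
  ∣-combine {f} {g} {u} {v} {x} {y} r s f∣xug f∣yvg = ∣-respʳ
    (solve 7 (λ r s x y u v g →
      (r :* y) :* ((x :* u) :* g) :+ (s :* x) :* ((y :* v) :* g)
      := ((x :* y) :* (r :* u :+ s :* v)) :* g) refl r s x y u v g)
    (∣-+ (x∣y⇒x∣zy (r * y) f∣xug) (x∣y⇒x∣zy (s * x) f∣yvg))

  -- Undoes one step of pseudo-division, in which `u` was replaced by `l * u + e * h`.
  ∣-drop-multiple : ∀ {x l u e h} → h ∣ x * (l * u + e * h) → h ∣ (x * l) * u
  ∣-drop-multiple {x} {l} {u} {e} {h} h∣ = ∣-+-cancelˡ (x∣y⇒x∣zy (x * e) ∣-refl)
    (∣-respʳ (solve 5 (λ x l u e h →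
      x :* (l :* u :+ e :* h) := (x :* e) :* h :+ (x :* l) :* u) refl x l u e h) h∣)

module CrossMultiplication {R : CommutativeRing α ℓα} (noZeroDivisors : NoZeroDivisors R) where
  open CommutativeRing R
  open Domain {R = R} noZeroDivisors
  open SemiringSolver commutativeSemiring
  open SetoidReasoning setoid

  -- In fractions the hypotheses say p g / f = m / x, u = w p and z = u g / f; hence z = w m / x.
  cancel-f : ∀ {x f g m p u w z} → ¬ f ≈ 0# → m * f ≈ (x * p) * g → w * p ≈ u →
             z * f ≈ u * g → x * z ≈ w * m
  cancel-f {x} {f} {g} {m} {p} {u} {w} {z} f≉0 mf≈xpg wp≈u zf≈ug = *-cancelˡ f≉0 (begin
    f * (x * z)        ≈⟨ solve 3 (λ f x z → f :* (x :* z) := x :* (z :* f)) refl f x z ⟩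
    x * (z * f)        ≈⟨ *-congˡ (trans zf≈ug (*-congʳ (sym wp≈u))) ⟩
    x * ((w * p) * g)  ≈⟨ solve 4 (λ x w p g → x :* ((w :* p) :* g) := w :* ((x :* p) :* g))
                            refl x w p g ⟩
    w * ((x * p) * g)  ≈⟨ *-congˡ mf≈xpg ⟨
    w * (m * f)        ≈⟨ solve 3 (λ w m f → w :* (m :* f) := f :* (w :* m)) refl w m f ⟩
    f * (w * m)        ∎)

  -- In fractions, n = e m / x and u g / f = v e p g / f = v e m / x = v n.
  cancel-x : ∀ {x e f g m n p u v} → ¬ x ≈ 0# → m * f ≈ (x * p) * g → e * m ≈ x * n →
             v * (e * p) ≈ u → (v * n) * f ≈ u * g
  cancel-x {x} {e} {f} {g} {m} {n} {p} {u} {v} x≉0 mf≈xpg em≈xn vep≈u = *-cancelˡ x≉0 (begin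
    x * ((v * n) * f)        ≈⟨ solve 4 (λ x v n f → x :* ((v :* n) :* f) := v :* ((x :* n) :* f))
                                  refl x v n f ⟩
    v * ((x * n) * f)        ≈⟨ *-congˡ (*-congʳ em≈xn) ⟨
    v * ((e * m) * f)        ≈⟨ solve 4 (λ v e m f → v :* ((e :* m) :* f) := (v :* e) :* (m :* f))
                                  refl v e m f ⟩
    (v * e) * (m * f)        ≈⟨ *-congˡ mf≈xpg ⟩
    (v * e) * ((x * p) * g)  ≈⟨ solve 5 (λ v e x p g → (v :* e) :* ((x :* p) :* g)
                                  := x :* ((v :* (e :* p)) :* g)) refl v e x p g ⟩
    x * ((v * (e * p)) * g)  ≈⟨ *-congˡ (*-congʳ vep≈u) ⟩
    x * (u * g)              ∎)

module _ (em : ∀ ℓ → ExcludedMiddle ℓ)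
         {A : CommutativeRing α ℓα} (isGCDDomain : IsGCDDomain A) where
  open CommutativeRing A hiding (zero)
  open PolynomialCoefficients A
  open Divisibility A
  open GCDDomain isGCDDomain
  open RingProperties ring using (-‿distribˡ-*)
  open SemiringSolver commutativeSemiring

  -- For nonzero `x`, `k` is x / gcd(x, c(f)) with c(f) the content of `f`. Contents are handled
  -- through this colon ideal. Coefficients past the end of the list impose no condition.
  colon-coeffs : ∀ x f → ∃ λ k → ∀ y → (∀ i → x ∣ y * coeff f i) ⇔ k ∣ y
  colon-coeffs x f with colons x {length f} (λ i → coeff f (toℕ i))
  ... | k , h = k , λ y → mk⇔ (λ d → Equivalence.to (h y) (d ∘ toℕ)) (from y)
    where
    from : ∀ y → k ∣ y → ∀ i → x ∣ y * coeff f i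
    from y k∣y i with i ℕ.<? length f
    ... | yes i<l = ≡.subst (λ j → x ∣ y * coeff f j) (toℕ-fromℕ< i<l)
                      (Equivalence.from (h y) k∣y (fromℕ< i<l))
    ... | no  i≮l = ∣-respʳ (sym (trans (*-congˡ (degreeBelow-length f i (ℕ.≮⇒≥ i≮l)))
                                        (zeroʳ y))) (x ∣0)

  nonzero-coeff : ∀ f → ¬ f P.≈ P.0# → ∃ λ k → ¬ coeff f k ≈ 0#
  nonzero-coeff f f≉0 = decidable-stable (em _) λ ¬∃ →
    f≉0 (mk≈ λ k → decidable-stable (em _) λ fk≉0 → ¬∃ (k , fk≉0))

  const-nonzero : ∀ {x} → ¬ x ≈ 0# → ¬ const x P.≈ P.0#
  const-nonzero {x} x≉0 e = x≉0 (trans (sym (coeff-const x)) (at e 0))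

  private
    noZeroDivisors-head : ∀ {f} → ¬ coeff f 0 ≈ 0# → ∀ g → f P.* g P.≈ P.0# → g P.≈ P.0#
    noZeroDivisors-head {f} f₀≉0 []      fg≈0 = P.refl
    noZeroDivisors-head {f} f₀≉0 (y ∷ g) fg≈0 =
      mk≈ λ { zero → y≈0 ; (ℕ.suc k) → at g≈0 k }
      where
      open SetoidReasoning setoid

      y≈0 : y ≈ 0#
      y≈0 = [ (λ e → contradiction e f₀≉0) , id ]′
        (noZeroDivisors _ y (trans (sym (coeff-*-zero f (y ∷ g))) (at fg≈0 0)))

      g≈0 : g P.≈ P.0#
      g≈0 = noZeroDivisors-head {f} f₀≉0 g (mk≈ λ k → begin
        coeff (f P.* g) k                          ≈⟨ +-identityˡ _ ⟨
        0# + coeff (f P.* g) k                     ≈⟨ +-congʳ (trans (*-congʳ y≈0) (zeroˡ _)) ⟨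
        y * coeff f (ℕ.suc k) + coeff (f P.* g) k  ≈⟨ coeff-*-sucʳ f (y ∷ g) k ⟨
        coeff (f P.* (y ∷ g)) (ℕ.suc k)            ≈⟨ at fg≈0 (ℕ.suc k) ⟩
        0#                                         ∎)

  -- Works from the lowest coefficients: zero constant terms of `f` are dropped, and then
  -- `noZeroDivisors-head` makes the coefficients of `g` vanish one by one.
  noZeroDivisors-poly : ∀ f g → f P.* g P.≈ P.0# → f P.≈ P.0# ⊎ g P.≈ P.0#
  noZeroDivisors-poly []      g fg≈0 = inj₁ P.refl
  noZeroDivisors-poly (x ∷ f) g fg≈0 with em _ {x ≈ 0#}
  ... | no  x≉0 = inj₂ (noZeroDivisors-head {x ∷ f} x≉0 g fg≈0)
  ... | yes x≈0 with noZeroDivisors-poly f g (mk≈ λ k → trans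
                       (sym (trans (coeff-*-sucˡ (x ∷ f) g k)
                         (trans (+-congʳ (trans (*-congʳ x≈0) (zeroˡ _))) (+-identityˡ _))))
                       (at fg≈0 (ℕ.suc k)))
  ...   | inj₂ g≈0 = inj₂ g≈0
  ...   | inj₁ f≈0 = inj₁ (mk≈ λ where
    zero      → x≈0
    (ℕ.suc k) → at f≈0 k)

  -- Gauss's lemma without contents: over a GCD domain it says that c(f) c(g) divides c(fg). The
  -- divisor `x` is quantified inside because the induction on the degree of `g` passes to a divisor
  -- of it.
  GaussLemma : ℕ → ℕ → Set _
  GaussLemma i j = ∀ f g x → DegreeBelow i f → DegreeBelow j g → ¬ x ≈ 0# →
    (∀ k → x ∣ coeff (f P.* g) k) → ∀ m n → x ∣ coeff f m * coeff g n

  -- Write (x) : (f₀) = (t) and x = s t.  Then t divides g₀.  As x divides t f₀, it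
  -- divides (t · tail f) g, so s divides f by induction on deg f and primitivity of g;
  -- and t divides (f / s) (tail g), which allows induction on deg g.
  module GaussStep {i j} (IHˡ : GaussLemma i (ℕ.suc j)) (IHʳ : GaussLemma (ℕ.suc i) j)
    (f g : Poly) (f-deg : DegreeBelow (ℕ.suc i) f) (g-deg : DegreeBelow (ℕ.suc j) g)
    {x : Carrier} (x≉0 : ¬ x ≈ 0#) (x∣fg : ∀ k → x ∣ coeff (f P.* g) k)
    (g-primitive : ∀ y → (∀ n → x ∣ y * coeff g n) → x ∣ y) where

    f₀ g₀ t s : Carrier
    f₀ = coeff f 0
    g₀ = coeff g 0
    t  = proj₁ (colon x f₀)

    t-colon : ∀ y → x ∣ y * f₀ ⇔ t ∣ y
    t-colon = proj₂ (colon x f₀)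

    t∣x : t ∣ x
    t∣x = Equivalence.to (t-colon x) (x∣xy x f₀)

    s = quotient t∣x

    st≈x : s * t ≈ x
    st≈x = equality t∣x

    t≉0 : ¬ t ≈ 0#
    t≉0 t≈0 = x≉0 (trans (sym st≈x) (trans (*-congˡ t≈0) (zeroʳ s)))

    s≉0 : ¬ s ≈ 0#
    s≉0 s≈0 = x≉0 (trans (sym st≈x) (trans (*-congʳ s≈0) (zeroˡ t)))

    t∣g₀ : t ∣ g₀
    t∣g₀ = Equivalence.to (t-colon g₀)
      (∣-respʳ (trans (coeff-*-zero f g) (*-comm f₀ g₀)) (x∣fg 0))

    x∣ty⇒s∣y : ∀ {y} → x ∣ t * y → s ∣ y
    x∣ty⇒s∣y h = ∣-cancelˡ t≉0 (∣-respˡ (trans (sym st≈x) (*-comm s t)) h)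

    x∣tf₀ : x ∣ t * f₀
    x∣tf₀ = Equivalence.from (t-colon t) ∣-refl

    x∣t[tail] : ∀ k → x ∣ coeff ((const t P.* tail f) P.* g) k
    x∣t[tail] k = ∣-respʳ (sym (trans (at (P.*-assoc (const t) (tail f) g) k)
                                      (coeff-const-* t (tail f P.* g) k)))
      (∣-+-cancelˡ (∣-respʳ (*-assoc t f₀ _) (x∣y⇒x∣yz (coeff g (ℕ.suc k)) x∣tf₀))
        (∣-respʳ (trans (*-congˡ (coeff-*-sucˡ f g k)) (distribˡ t _ _))
          (x∣y⇒x∣zy t (x∣fg (ℕ.suc k)))))

    s∣f : ∀ k → s ∣ coeff f k
    s∣f zero      = x∣ty⇒s∣y x∣tf₀
    s∣f (ℕ.suc k) = x∣ty⇒s∣y (g-primitive _ λ n →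
      ∣-respʳ (*-congʳ (trans (coeff-const-* t (tail f) k)
                              (*-congˡ (reflexive (coeff-tail f k)))))
        (IHˡ (const t P.* tail f) g x
          (degreeBelow-const-* t (tail f) (degreeBelow-tail f f-deg))
          g-deg x≉0 x∣t[tail] k n))

    f′ : Poly
    f′ = proj₁ (divide-coeffs s f s∣f)

    f≈sf′ : f P.≈ const s P.* f′
    f≈sf′ = proj₂ (divide-coeffs s f s∣f)

    fₖ≈sf′ₖ : ∀ k → coeff f k ≈ s * coeff f′ k
    fₖ≈sf′ₖ k = trans (at f≈sf′ k) (coeff-const-* s f′ k)

    f′-deg : DegreeBelow (ℕ.suc i) f′
    f′-deg k i<k = *-cancelˡ s≉0
      (trans (sym (fₖ≈sf′ₖ k)) (trans (f-deg k i<k) (sym (zeroʳ s))))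

    t∣f′g : ∀ k → t ∣ coeff (f′ P.* g) k
    t∣f′g k = ∣-cancelˡ s≉0 (∣-respˡ (sym st≈x) (∣-respʳ
      (trans (at (P.trans (P.*-congʳ f≈sf′) (P.*-assoc (const s) f′ g)) k)
             (coeff-const-* s (f′ P.* g) k))
      (x∣fg k)))

    t∣f′[tail] : ∀ k → t ∣ coeff (f′ P.* tail g) k
    t∣f′[tail] k = ∣-+-cancelˡ (x∣y⇒x∣yz (coeff f′ (ℕ.suc k)) t∣g₀)
      (∣-respʳ (coeff-*-sucʳ f′ g k) (t∣f′g (ℕ.suc k)))

    t∣f′gₙ : ∀ m n → t ∣ coeff f′ m * coeff g n
    t∣f′gₙ m zero      = x∣y⇒x∣zy _ t∣g₀
    t∣f′gₙ m (ℕ.suc n) = ∣-respʳ (*-congˡ (reflexive (coeff-tail g n)))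
      (IHʳ f′ (tail g) t f′-deg (degreeBelow-tail g g-deg) t≉0 t∣f′[tail] m n)

    x∣f : ∀ m → x ∣ coeff f m
    x∣f m = g-primitive _ λ n → ∣-respˡ st≈x (∣-respʳ
      (trans (sym (*-assoc s _ _)) (*-congʳ (sym (fₖ≈sf′ₖ m))))
      (x∣y⇒zx∣zy s (t∣f′gₙ m n)))

  -- Makes `g` primitive. With q = gcd(x, c(g)) and x = q k, `g` is q g′ and `k` divides f g′, while
  -- g′ is primitive relative to `k`. So `k` divides `f`, and x = q k divides each product.
  gauss-step : ∀ {i j} → GaussLemma i (ℕ.suc j) → GaussLemma (ℕ.suc i) j →
               GaussLemma (ℕ.suc i) (ℕ.suc j)
  gauss-step {i} {j} IHˡ IHʳ f g x f-deg g-deg x≉0 x∣fg m n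
    with colon-coeffs x g
  ... | k , k-colon with Equivalence.to (k-colon x) (λ n → x∣xy x _)
  ...   | k∣x@(q , qk≈x) = Equivalence.from (k-colon _) (k∣f m) n
    where
    k≉0 : ¬ k ≈ 0#
    k≉0 = x∣y∧y≉0⇒x≉0 k∣x x≉0

    q≉0 : ¬ q ≈ 0#
    q≉0 q≈0 = x≉0 (trans (sym qk≈x) (trans (*-congʳ q≈0) (zeroˡ k)))

    q∣g : ∀ n → q ∣ coeff g n
    q∣g n = ∣-cancelˡ k≉0 (∣-respˡ (trans (sym qk≈x) (*-comm q k))
      (Equivalence.from (k-colon k) ∣-refl n))

    g′ : Poly
    g′ = proj₁ (divide-coeffs q g q∣g)

    g≈qg′ : g P.≈ const q P.* g′
    g≈qg′ = proj₂ (divide-coeffs q g q∣g)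

    gₙ≈qg′ₙ : ∀ n → coeff g n ≈ q * coeff g′ n
    gₙ≈qg′ₙ n = trans (at g≈qg′ n) (coeff-const-* q g′ n)

    g′-deg : DegreeBelow (ℕ.suc j) g′
    g′-deg n j<n = *-cancelˡ q≉0
      (trans (sym (gₙ≈qg′ₙ n)) (trans (g-deg n j<n) (sym (zeroʳ q))))

    k∣fg′ : ∀ n → k ∣ coeff (f P.* g′) n
    k∣fg′ n = ∣-cancelˡ q≉0 (∣-respˡ (sym qk≈x) (∣-respʳ
      (trans (at (P.trans (P.*-cong (P.refl {f}) g≈qg′) (swap f (const q) g′)) n)
             (coeff-const-* q (f P.* g′) n))
      (x∣fg n)))
      where
      swap : ∀ f h g → f P.* (h P.* g) P.≈ h P.* (f P.* g)
      swap f h g = P.trans (P.sym (P.*-assoc f h g))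
        (P.trans (P.*-congʳ (P.*-comm f h)) (P.*-assoc h f g))

    g-primitive : ∀ y → (∀ n → k ∣ y * coeff g′ n) → k ∣ y
    g-primitive y h = Equivalence.to (k-colon y) λ n → ∣-respˡ qk≈x (∣-respʳ
      (trans (solve 3 (λ q y z → q :* (y :* z) := y :* (q :* z)) refl q y (coeff g′ n))
             (*-congˡ (sym (gₙ≈qg′ₙ n))))
      (x∣y⇒zx∣zy q (h n)))

    k∣f : ∀ m → k ∣ coeff f m
    k∣f = GaussStep.x∣f IHˡ IHʳ f g′ f-deg g′-deg k≉0 k∣fg′ g-primitive

  gauss′ : ∀ i j → GaussLemma i j
  gauss′ zero j f g x f-deg g-deg x≉0 x∣fg m n =
    ∣-respʳ (sym (trans (*-congʳ (f-deg m z≤n)) (zeroˡ _))) (x ∣0)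
  gauss′ (ℕ.suc i) zero f g x f-deg g-deg x≉0 x∣fg m n =
    ∣-respʳ (sym (trans (*-congˡ (g-deg n z≤n)) (zeroʳ _))) (x ∣0)
  gauss′ (ℕ.suc i) (ℕ.suc j) = gauss-step (gauss′ i (ℕ.suc j)) (gauss′ (ℕ.suc i) j)

  gauss : ∀ f g {x} → ¬ x ≈ 0# → (∀ k → x ∣ coeff (f P.* g) k) →
          ∀ m n → x ∣ coeff f m * coeff g n
  gauss f g {x} = gauss′ (length f) (length g) f g x
    (degreeBelow-length f) (degreeBelow-length g)

  -- Primitive parts and pseudo-division

  private
    module DP = Divisibility polynomialRing
    module PC = CrossMultiplication {R = polynomialRing} noZeroDivisors-poly
    module LP = LinearDivisibility polynomialRing
    module PD = Domain {R = polynomialRing} noZeroDivisors-poly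

  -- `d` is the content of `h`, found as h_j / k for a nonzero coefficient h_j and (k) = (h_j) :
  -- (all coefficients). The last clause makes y d a gcd of the products y h_n; `y` will be a
  -- coefficient of a cofactor of `h`.
  primitivePart : ∀ h → ¬ h P.≈ P.0# → ∃₂ λ d g → ¬ d ≈ 0# × h P.≈ const d P.* g ×
                  (∀ {x} y → ¬ x ≈ 0# → (∀ n → x ∣ y * coeff h n) → x ∣ y * d)
  primitivePart h h≉0 with nonzero-coeff h h≉0
  ... | j , hⱼ≉0 with colon-coeffs (coeff h j) h
  ...   | k , k-colon with Equivalence.to (k-colon (coeff h j)) (λ n → x∣xy (coeff h j) _)
  ...     | k∣hⱼ@(d , dk≈hⱼ) = d , proj₁ quotients , d≉0 , proj₂ quotients , content
    where
    k≉0 : ¬ k ≈ 0#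
    k≉0 = x∣y∧y≉0⇒x≉0 k∣hⱼ hⱼ≉0

    d≉0 : ¬ d ≈ 0#
    d≉0 d≈0 = hⱼ≉0 (trans (sym dk≈hⱼ) (trans (*-congʳ d≈0) (zeroˡ k)))

    quotients : ∃ λ g → h P.≈ const d P.* g
    quotients = divide-coeffs d h λ n →
      ∣-cancelˡ k≉0 (∣-respˡ (trans (sym dk≈hⱼ) (*-comm d k))
        (Equivalence.from (k-colon k) ∣-refl n))

    content : ∀ {x} y → ¬ x ≈ 0# → (∀ n → x ∣ y * coeff h n) → x ∣ y * d
    content {x} y x≉0 x∣yh with x∣yh j
    -- Here s = y h_j / x. With r = y h_n / x one has r h_j = s h_n, so h_j divides every s h_n, and
    -- `k` divides `s`.
    ... | s , sx≈yhⱼ with Equivalence.to (k-colon s) hⱼ∣sh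
      where
      hⱼ∣sh : ∀ n → coeff h j ∣ s * coeff h n
      hⱼ∣sh n with x∣yh n
      ... | r , rx≈yhₙ = r , *-cancelˡ x≉0 (begin
        x * (r * coeff h j)          ≈⟨ solve 3 (λ x r a → x :* (r :* a) := (r :* x) :* a)
                                          refl x r (coeff h j) ⟩
        (r * x) * coeff h j          ≈⟨ *-congʳ rx≈yhₙ ⟩
        (y * coeff h n) * coeff h j  ≈⟨ solve 3 (λ y b a → (y :* b) :* a := (y :* a) :* b)
                                          refl y (coeff h n) (coeff h j) ⟩
        (y * coeff h j) * coeff h n  ≈⟨ *-congʳ sx≈yhⱼ ⟨
        (s * x) * coeff h n          ≈⟨ solve 3 (λ s x b → (s :* x) :* b := x :* (s :* b))
                                          refl s x (coeff h n) ⟩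
        x * (s * coeff h n)          ∎)
        where open SetoidReasoning setoid
    ... | s′ , s′k≈s = s′ , *-cancelˡ k≉0 (begin
      k * (s′ * x)     ≈⟨ solve 3 (λ k s x → k :* (s :* x) := (s :* k) :* x) refl k s′ x ⟩
      (s′ * k) * x     ≈⟨ *-congʳ s′k≈s ⟩
      s * x            ≈⟨ sx≈yhⱼ ⟩
      y * coeff h j    ≈⟨ *-congˡ dk≈hⱼ ⟨
      y * (d * k)      ≈⟨ solve 3 (λ y d k → y :* (d :* k) := k :* (y :* d)) refl y d k ⟩
      k * (y * d)      ∎)
      where open SetoidReasoning setoid

  -- Divisibility over the field of fractions descends to primitive polynomials. If q h = x u, then
  -- by Gauss's lemma `x` divides every q_m h_n, hence every q_m d. So d q = x q′, and q′ is the
  -- cofactor of `g` in `u`.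
  primitivePart-∣ : ∀ {h d g} → h P.≈ const d P.* g →
    (∀ {x} y → ¬ x ≈ 0# → (∀ n → x ∣ y * coeff h n) → x ∣ y * d) →
    ∀ {x u} → ¬ x ≈ 0# → h DP.∣ const x P.* u → g DP.∣ u
  primitivePart-∣ {h} {d} {g} h≈dg content {x} {u} x≉0 (q DP., qh≈xu)
    with divide-coeffs x (const d P.* q) (λ m →
      ∣-respʳ (trans (*-comm _ d) (sym (coeff-const-* d q m)))
        (content (coeff q m) x≉0 (gauss q h x≉0
          (λ k → ∣-respʳ (sym (trans (at qh≈xu k) (coeff-const-* x u k))) (x∣xy x _)) m)))
  ... | q′ , dq≈xq′ = q′ DP., PD.*-cancelˡ (const-nonzero x≉0) (begin
    const x P.* (q′ P.* g)        ≈⟨ P.*-assoc (const x) q′ g ⟨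
    (const x P.* q′) P.* g        ≈⟨ P.*-congʳ dq≈xq′ ⟨
    (const d P.* q) P.* g         ≈⟨ P.*-congʳ (P.*-comm (const d) q) ⟩
    (q P.* const d) P.* g         ≈⟨ P.*-assoc q (const d) g ⟩
    q P.* (const d P.* g)         ≈⟨ P.*-cong (P.refl {q}) h≈dg ⟨
    q P.* h                       ≈⟨ qh≈xu ⟩
    const x P.* u                 ∎)
    where open SetoidReasoning P.setoid

  -- The ideal (f) : (g) after inverting the nonzero constants.
  Saturation : (f g u : Poly) → Set _
  Saturation f g u = ∃ λ x → ¬ x ≈ 0# × f DP.∣ (const x P.* u) P.* g

  saturation-combine : ∀ {f g u v} r s → Saturation f g u → Saturation f g v →
                       Saturation f g (r P.* u P.+ s P.* v)
  saturation-combine {f} {g} {u} {v} r s (x , x≉0 , f∣xug) (y , y≉0 , f∣yvg) =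
    x * y , *-nonzero x≉0 y≉0 , DP.∣-respʳ
      (P.*-cong (P.*-cong (const-* x y) (P.refl {r P.* u P.+ s P.* v})) (P.refl {g}))
      (LP.∣-combine {f} {g} {u} {v} {const x} {const y} r s f∣xug f∣yvg)

  -- The reduction step l u - v X^j h of pseudo-division. In degree j + n both products have
  -- coefficient l v and cancel; beyond that both vanish.
  cancel-leading : ∀ {n} h → DegreeBelow (ℕ.suc n) h → ∀ j u → DegreeBelow (ℕ.suc (j ℕ.+ n)) u →
    DegreeBelow (j ℕ.+ n)
      (const (coeff h n) P.* u P.+ monomial j (- coeff u (j ℕ.+ n)) P.* h)
  cancel-leading {n} h h-deg j u u-deg k j+n≤k =
    ≡.subst (λ k → coeff (const l P.* u P.+ e P.* h) k ≈ 0#) (ℕ.m+[n∸m]≡n j≤k)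
      (trans (coeff-+ (const l P.* u) (e P.* h) _)
        (trans (+-cong (coeff-const-* l u _) (coeff-monomial-* j (- v) h i))
               (vanish i (ℕ.m+n≤o⇒m≤o∸n n (≡.subst (ℕ._≤ k) (ℕ.+-comm j n) j+n≤k)))))
    where
    l v : Carrier
    l = coeff h n
    v = coeff u (j ℕ.+ n)
    e : Poly
    e = monomial j (- v)
    i : ℕ
    i = k ℕ.∸ j
    j≤k : j ℕ.≤ k
    j≤k = ℕ.≤-trans (ℕ.m≤m+n j n) j+n≤k
    vanish : ∀ i → n ℕ.≤ i → l * coeff u (j ℕ.+ i) + - v * coeff h i ≈ 0#
    vanish i n≤i with ℕ.m≤n⇒m<n∨m≡n n≤i
    ... | inj₁ n<i = trans
      (+-cong (trans (*-congˡ (u-deg (j ℕ.+ i)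
                (≡.subst (ℕ._≤ j ℕ.+ i) (ℕ.+-suc j n) (ℕ.+-monoʳ-≤ j n<i)))) (zeroʳ l))
              (trans (*-congˡ (h-deg i n<i)) (zeroʳ (- v))))
      (+-identityˡ 0#)
    ... | inj₂ ≡.refl = trans (+-cong (*-comm l v) (sym (-‿distribˡ-* v l)))
      (-‿inverseʳ (v * l))

  -- Over a field of fractions, a nonzero member of least degree generates an ideal of polynomials.
  -- Remainders stay in the saturation, so `minimal` kills the last one; the leading coefficients
  -- multiplied in on the way are collected in `x`.
  pseudoDivision : ∀ {f g h n} → ¬ coeff h n ≈ 0# → DegreeBelow (ℕ.suc n) h →
    Saturation f g h → (∀ u → Saturation f g u → DegreeBelow n u → u P.≈ P.0#) →
    ∀ m u → DegreeBelow m u → Saturation f g u →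
    ∃ λ x → ¬ x ≈ 0# × h DP.∣ const x P.* u
  pseudoDivision {f} {g} {h} {n} hₙ≉0 h-deg h∈ minimal = go
    where
    below : ∀ u → u P.≈ P.0# → ∃ λ x → ¬ x ≈ 0# × h DP.∣ const x P.* u
    below u u≈0 = coeff h n , hₙ≉0 , DP.∣-respʳ
      (P.sym (P.trans (P.*-cong (P.refl {const (coeff h n)}) u≈0) (P.zeroʳ (const (coeff h n)))))
      (h DP.∣0)

    reduce : ∀ j u → DegreeBelow (ℕ.suc (j ℕ.+ n)) u → Saturation f g u →
             (∀ u → DegreeBelow (j ℕ.+ n) u → Saturation f g u →
               ∃ λ x → ¬ x ≈ 0# × h DP.∣ const x P.* u) →
             ∃ λ x → ¬ x ≈ 0# × h DP.∣ const x P.* u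
    reduce j u u-deg u∈ rec = let
      l = coeff h n
      e = monomial j (- coeff u (j ℕ.+ n))
      (x , x≉0 , h∣) = rec (const l P.* u P.+ e P.* h) (cancel-leading h h-deg j u u-deg)
        (saturation-combine {f} {g} {u} {h} (const l) e u∈ h∈)
      in x * l , *-nonzero x≉0 hₙ≉0 ,
         DP.∣-respʳ (P.*-cong (const-* x l) (P.refl {u}))
           (LP.∣-drop-multiple {const x} {const l} {u} {e} {h} h∣)

    go : ∀ m u → DegreeBelow m u → Saturation f g u →
         ∃ λ x → ¬ x ≈ 0# × h DP.∣ const x P.* u
    go zero      u u-deg u∈ = below u (mk≈ λ k → u-deg k z≤n)
    go (ℕ.suc m) u u-deg u∈ with n ℕ.≤? m
    ... | no  n≰m = below u (minimal u u∈ λ k n≤k → u-deg k (ℕ.≤-trans (ℕ.≰⇒> n≰m) n≤k))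
    ... | yes n≤m = reduce (m ℕ.∸ n) u
      (≡.subst (λ m → DegreeBelow (ℕ.suc m) u) (≡.sym j+n≡m) u-deg) u∈
      λ u u-deg → go m u (≡.subst (λ m → DegreeBelow m u) j+n≡m u-deg)
      where
      j+n≡m : m ℕ.∸ n ℕ.+ n ≡ m
      j+n≡m = ℕ.m∸n+n≡m n≤m

  -- Applied to the existence of a nonzero member of the saturation of degree below a bound, this
  -- finds the least degree: it is `n`, as the bound is strict.
  threshold : ∀ {p} (Q : ℕ → Set p) → ¬ Q 0 → ∀ n → Q n → ∃ λ n → ¬ Q n × Q (ℕ.suc n)
  threshold Q ¬Q0 zero      q = contradiction q ¬Q0
  threshold Q ¬Q0 (ℕ.suc n) q with em _ {Q n}
  ... | yes q′ = threshold Q ¬Q0 n q′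
  ... | no ¬q′ = n , ¬q′ , q

  -- Colon ideals of polynomials

  module _ (f g : Poly) (f≉0 : ¬ f P.≈ P.0#) where

    private
      multiple∈saturation : ∃ λ x → ¬ x ≈ 0# × (∀ u → f DP.∣ u P.* g →
                            f DP.∣ (const x P.* u) P.* g)
      -- A nonzero constant is needed, and `IsGCDDomain` has no field saying 1 ≠ 0, so one is taken
      -- from the coefficients of `f`.
      multiple∈saturation = let (i , fᵢ≉0) = nonzero-coeff f f≉0 ; x = coeff f i in
        x , fᵢ≉0 , λ u f∣ug → DP.∣-respʳ (P.sym (P.*-assoc (const x) u g))
          (DP.x∣y⇒x∣zy (const x) f∣ug)

      ∣⇒∈saturation : ∀ u → f DP.∣ u P.* g → Saturation f g u
      ∣⇒∈saturation u f∣ug = let (x , x≉0 , h) = multiple∈saturation in x , x≉0 , h u f∣ug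

    -- h has least degree in the saturation, and p is its primitive part.
    module _ {n h} (h∈ : Saturation f g h) (hₙ≉0 : ¬ coeff h n ≈ 0#)
      (h-deg : DegreeBelow (ℕ.suc n) h)
      (minimal : ∀ u → Saturation f g u → DegreeBelow n u → u P.≈ P.0#)
      {d p} (d≉0 : ¬ d ≈ 0#) (h≈dp : h P.≈ const d P.* p)
      (content : ∀ {x} y → ¬ x ≈ 0# → (∀ n → x ∣ y * coeff h n) → x ∣ y * d) where

      private
        p∣ : ∀ u → f DP.∣ u P.* g → p DP.∣ u
        p∣ u f∣ug = let
          (y , y≉0 , h∣yu) = pseudoDivision {f} {g} {h} hₙ≉0 h-deg h∈ minimal
            (length u) u (degreeBelow-length u) (∣⇒∈saturation u f∣ug)
          in primitivePart-∣ {h} {d} {p} h≈dp content y≉0 h∣yu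

        x : Carrier
        x = proj₁ h∈ * d

        x≉0 : ¬ x ≈ 0#
        x≉0 = *-nonzero (proj₁ (proj₂ h∈)) d≉0

        yh≈xp : ∀ {y} → const y P.* h P.≈ const (y * d) P.* p
        yh≈xp {y} = P.trans (P.*-cong (P.refl {const y}) h≈dp)
          (P.trans (P.sym (P.*-assoc (const y) (const d) p))
                   (P.*-cong (const-* y d) (P.refl {p})))

        f∣xpg : f DP.∣ (const x P.* p) P.* g
        f∣xpg = DP.∣-respʳ (P.*-cong (yh≈xp {proj₁ h∈}) (P.refl {g})) (proj₂ (proj₂ h∈))

        m : Poly
        m = DP.quotient f∣xpg

        mf≈xpg : m P.* f P.≈ (const x P.* p) P.* g
        mf≈xpg = DP.equality f∣xpg

        e : Carrier
        e = proj₁ (colon-coeffs x m)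

        e-colon : ∀ y → (∀ i → x ∣ y * coeff m i) ⇔ e ∣ y
        e-colon = proj₂ (colon-coeffs x m)

        to : ∀ u → f DP.∣ u P.* g → const e P.* p DP.∣ u
        to u f∣ug = w′ DP., P.trans (P.sym (P.*-assoc w′ (const e) p))
          (P.trans (P.*-cong (P.trans (P.*-comm w′ (const e)) (P.sym w≈ew′)) (P.refl {p})) wp≈u)
          where
          z w : Poly
          z = DP.quotient f∣ug
          w = DP.quotient (p∣ u f∣ug)
          wp≈u : w P.* p P.≈ u
          wp≈u = DP.equality (p∣ u f∣ug)
          xz≈wm : const x P.* z P.≈ w P.* m
          xz≈wm = PC.cancel-f {const x} {f} {g} {m} {p} {u} {w} {z}
            f≉0 mf≈xpg wp≈u (DP.equality f∣ug)
          x∣wm : ∀ k → x ∣ coeff (w P.* m) k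
          x∣wm k = ∣-respʳ (trans (sym (coeff-const-* x z k)) (at xz≈wm k)) (x∣xy x _)
          quotients : ∃ λ w′ → w P.≈ const e P.* w′
          quotients = divide-coeffs e w λ k →
            Equivalence.to (e-colon (coeff w k)) (gauss w m x≉0 x∣wm k)
          w′ : Poly
          w′ = proj₁ quotients
          w≈ew′ : w P.≈ const e P.* w′
          w≈ew′ = proj₂ quotients

        from : ∀ u → const e P.* p DP.∣ u → f DP.∣ u P.* g
        from u ep∣u = let
          v = DP.quotient ep∣u
          (n , em≈xn) = divide-coeffs x (const e P.* m) λ k →
            ∣-respʳ (sym (coeff-const-* e m k)) (Equivalence.from (e-colon e) ∣-refl k)
          in v P.* n DP., PC.cancel-x {const x} {const e} {f} {g} {m} {n} {p} {u} {v}
               (const-nonzero x≉0) mf≈xpg em≈xn (DP.equality ep∣u)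

      -- Every `u` with f ∣ u g is w p, by `p∣`. As p g / f = m / x, the condition on `u` becomes
      -- that `x` divides all coefficients of w m. By Gauss's lemma it then divides every w_k m_i,
      -- so the generator `e` of (x) : (coefficients of m) divides `w`. Hence (f) : (g) = (e p).
      colon-primitive : ∃ λ k → ∀ u → f DP.∣ u P.* g ⇔ k DP.∣ u
      colon-primitive = const e P.* p , λ u → mk⇔ (to u) (from u)

    private
      HasDegreeBelow : ℕ → Set _
      HasDegreeBelow n = ∃ λ u → Saturation f g u × ¬ u P.≈ P.0# × DegreeBelow n u

      f∈ : HasDegreeBelow (length f)
      f∈ = f , ∣⇒∈saturation f (DP.x∣xy f g) , f≉0 , degreeBelow-length f

    poly-colon-nonzero : ∃ λ k → ∀ u → f DP.∣ u P.* g ⇔ k DP.∣ u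
    poly-colon-nonzero = let
      (n , none , h , h∈ , h≉0 , h-deg) = threshold HasDegreeBelow
        (λ { (u , _ , u≉0 , u-deg) → u≉0 (mk≈ λ k → u-deg k z≤n) }) (length f) f∈
      (d , p , d≉0 , h≈dp , content) = primitivePart h h≉0
      in colon-primitive h∈
           (λ hₙ≈0 → none (h , h∈ , h≉0 , λ k n≤k → [ h-deg k , (λ { ≡.refl → hₙ≈0 }) ]′
             (ℕ.m≤n⇒m<n∨m≡n n≤k)))
           h-deg
           (λ u u∈ u-deg → decidable-stable (em _) λ u≉0 → none (u , u∈ , u≉0 , u-deg))
           {d} {p} d≉0 h≈dp content

  poly-colon : ∀ f g → ∃ λ k → ∀ u → f DP.∣ u P.* g ⇔ k DP.∣ u
  poly-colon f g with em _ {f P.≈ P.0#} | em _ {g P.≈ P.0#}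
  ... | no f≉0  | _ = poly-colon-nonzero f g f≉0
  ... | yes f≈0 | yes g≈0 = P.1# , λ u → mk⇔ (λ _ → DP.1∣ u)
    (λ _ → DP.∣-respʳ (P.sym (P.trans (P.*-cong (P.refl {u}) g≈0) (P.zeroʳ u))) (f DP.∣0))
  ... | yes f≈0 | no g≉0 = P.0# , λ u → mk⇔
    (λ d → [ (λ u≈0 → DP.∣-respʳ (P.sym u≈0) DP.∣-refl) , (λ g≈0 → contradiction g≈0 g≉0) ]′
      (noZeroDivisors-poly u g (DP.0∣x⇒x≈0 (DP.∣-respˡ f≈0 d))))
    (λ d → DP.∣-respʳ
      (P.sym (P.trans (P.*-cong (DP.0∣x⇒x≈0 d) (P.refl {g})) (P.zeroˡ g))) (f DP.∣0))

  polynomialRing-isGCDDomain : IsGCDDomain polynomialRing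
  polynomialRing-isGCDDomain = record
    { noZeroDivisors = noZeroDivisors-poly
    ; colon          = poly-colon
    }

[x₁⋯x]-isGCDDomain : (∀ ℓ → ExcludedMiddle ℓ) → (A : CommutativeRing α ℓα) → IsGCDDomain A →
                     ∀ k → IsGCDDomain (A [x₁⋯x k ])
[x₁⋯x]-isGCDDomain em A gcd zero      = gcd
[x₁⋯x]-isGCDDomain em A gcd (ℕ.suc k) =
  polynomialRing-isGCDDomain em ([x₁⋯x]-isGCDDomain em A gcd k)

-- Local structure of splines

module _ {R : CommutativeRing c ℓ} (S : MultiplicativeSubset R ς) where
  open CommutativeRing R hiding (zero)
  open MultiplicativeSubset S using (1∈; *∈) renaming (member to S̲)
  open SemiringSolver commutativeSemiring
  private
    module L = Localization R S
    module Loc = CommutativeRing L.localization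

  open L using (num; den; fromR; mk≈; den∈S)

  _∈ᴱ_ : L.Fraction → Ideal R ι → Set (c ⊔ ℓ ⊔ ς ⊔ ι)
  _∈ᴱ_ y I = _∈ᴵ_ {R = L.localization} y (extend {A = R} {B = L.localization} L.localize I)

  ∈-extend⇒ : (I : Ideal R ι) → ∀ {y} → y ∈ᴱ I → ∃ λ t → t ∈ S̲ × (t * num y) ∈ᴵ I
  ∈-extend⇒ I (gen {y} (x , x∈ , mk≈ t t∈ e)) = t , t∈ , Ideal.resp I
    (trans (solve 3 (λ t x d → (t :* d) :* x := t :* (x :* d)) refl t x (den y))
      (trans (sym e) (*-congˡ (*-identityʳ (num y)))))
    (Ideal.*∈ I (t * den y) x∈)
  ∈-extend⇒ I (gen-resp {x} {y} (mk≈ t t∈ e) x∈) = let (u , u∈ , h) = ∈-extend⇒ I x∈ in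
    (u * t) * den x , *∈ (*∈ u∈ t∈) (den∈S x) , Ideal.resp I
      (trans (solve 4 (λ t d u x → (t :* d) :* (u :* x) := u :* (t :* (x :* d)))
               refl t (den y) u (num x))
        (trans (*-congˡ e)
          (solve 4 (λ u t y d → u :* (t :* (y :* d)) := ((u :* t) :* d) :* y)
            refl u t (num y) (den x))))
      (Ideal.*∈ I (t * den y) h)
  ∈-extend⇒ I gen-0 = 1# , 1∈ , Ideal.resp I (sym (zeroʳ 1#)) (Ideal.0∈ I)
  ∈-extend⇒ I (gen-+ {x} {y} x∈ y∈) with ∈-extend⇒ I x∈ | ∈-extend⇒ I y∈
  ... | t , t∈ , h | u , u∈ , k = t * u , *∈ t∈ u∈ , Ideal.resp I
    (solve 6 (λ t u x d y e → (u :* e) :* (t :* x) :+ (t :* d) :* (u :* y)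
                              := (t :* u) :* (x :* e :+ y :* d))
      refl t u (num x) (den x) (num y) (den y))
    (Ideal.+∈ I (Ideal.*∈ I (u * den y) h) (Ideal.*∈ I (t * den x) k))
  ∈-extend⇒ I (gen-* r {x} x∈) = let (t , t∈ , h) = ∈-extend⇒ I x∈ in
    t , t∈ , Ideal.resp I
      (solve 3 (λ r t x → r :* (t :* x) := t :* (r :* x)) refl (num r) t (num x))
      (Ideal.*∈ I (num r) h)

  ∈⇒fromR∈ : (I : Ideal R ι) → ∀ {x} → x ∈ᴵ I → fromR x ∈ᴱ I
  ∈⇒fromR∈ I {x} x∈ = gen (x , x∈ , Loc.refl)

  common-multiplier : ∀ {n} (I : Fin n → Ideal R ι) (x : Fin n → Carrier) →
    (∀ i → ∃ λ t → t ∈ S̲ × (t * x i) ∈ᴵ I i) → ∃ λ t → t ∈ S̲ × ∀ i → (t * x i) ∈ᴵ I i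
  common-multiplier {n = zero}    I x h = 1# , 1∈ , λ ()
  common-multiplier {n = ℕ.suc n} I x h
    with h zero | common-multiplier (I ∘ suc) (x ∘ suc) (h ∘ suc)
  ... | t , t∈ , h₀ | u , u∈ , hₛ = t * u , *∈ t∈ u∈ , λ where
    zero    → Ideal.resp (I zero)
      (solve 3 (λ u t x → u :* (t :* x) := (t :* u) :* x) refl u t (x zero))
      (Ideal.*∈ (I zero) u h₀)
    (suc i) → Ideal.resp (I (suc i)) (sym (*-assoc t u _)) (Ideal.*∈ (I (suc i)) t (hₛ i))

module _ (em : ∀ ℓ → ExcludedMiddle ℓ) {R : CommutativeRing c ℓ} (G : EdgeLabeledGraph R ι)
         (S : MultiplicativeSubset R ς) where
  open CommutativeRing R hiding (zero)
  open EdgeLabeledGraph G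
  open Spline
  open Coordinates (splineCoordinates G) using (LocalGenerator)
  open MultiplicativeSubset S using (1∈; *∈) renaming (member to S̲)
  open RingProperties ring using (x[y-z]≈xy-xz; [y-z]x≈yx-zx; -0#≈0#)
  open SemiringSolver commutativeSemiring
  private
    module L = Localization R S
    module Loc = CommutativeRing L.localization
    Gₛ = localizeGraph G S

  open L using (num; den; fromR; mk≈; den∈S)

  -- A function on the vertices that is a spline after localization becomes one over `R` when
  -- multiplied by a single element of S, since there are finitely many edges.
  clear-denominators : (σ : Vertex → Carrier) →
    (∀ e → ∃ λ t → t ∈ S̲ × (t * (σ (source e) - σ (target e))) ∈ᴵ label e) →
    ∃ λ t → t ∈ S̲ × ∃ λ (f : Spline G) → ∀ v → value f v ≈ t * σ v
  clear-denominators σ h =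
    let (t , t∈ , k) = common-multiplier S label (λ e → σ (source e) - σ (target e)) h
    in t , t∈
       , spline (λ v → t * σ v) (λ e → Ideal.resp (label e) (x[y-z]≈xy-xz t _ _) (k e))
       , λ v → refl

  trivial-edge : ∀ {e} → Trivial Gₛ e → ∀ x → ∃ λ t → t ∈ S̲ × (t * x) ∈ᴵ label e
  trivial-edge {e} triv x = ∈-extend⇒ S (label e) (triv (fromR x))

  zero-edge : ∀ e {x} → x ≈ 0# → ∃ λ t → t ∈ S̲ × (t * x) ∈ᴵ label e
  zero-edge e x≈0 = 1# , 1∈ , Ideal.resp (label e)
    (sym (trans (*-congˡ x≈0) (zeroʳ 1#))) (Ideal.0∈ (label e))

  indicator : ∀ {q} {P : Set q} → Dec P → Carrier
  indicator (yes _) = 1#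
  indicator (no _)  = 0#

  indicator-yes : ∀ {q} {P : Set q} (d : Dec P) → P → indicator d ≈ 1#
  indicator-yes (yes _) p = refl
  indicator-yes (no ¬p) p = contradiction p ¬p

  indicator-no : ∀ {q} {P : Set q} (d : Dec P) → ¬ P → indicator d ≈ 0#
  indicator-no (yes p) ¬p = contradiction p ¬p
  indicator-no (no _)  ¬p = refl

  indicator-⇔ : ∀ {q r} {P : Set q} {Q : Set r} (d : Dec P) (e : Dec Q) →
                (P → Q) → (Q → P) → indicator d ≈ indicator e
  indicator-⇔ d (yes q) P⇒Q Q⇒P = indicator-yes d (Q⇒P q)
  indicator-⇔ d (no ¬q) P⇒Q Q⇒P = indicator-no d (¬q ∘ P⇒Q)

  module _ (κ : Vertex) where

    -- The indicator of the component of `κ` is a spline after localization, since nontrivial edges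
    -- do not leave the component. Cleared of denominators, its value at `κ` is an element of S, a
    -- unit locally.
    generator-isolated : (∀ j → toℕ j ℕ.< toℕ κ → ¬ Connected Gₛ κ j) → LocalGenerator S κ
    generator-isolated isolated =
      let (t , t∈ , g , g≈tσ) = clear-denominators σ edge
          gκ≈t : value g κ ≈ t
          gκ≈t = trans (g≈tσ κ) (trans (*-congˡ (indicator-yes (em _) ε)) (*-identityʳ t))
      in g
       , (λ j j<κ → trans (g≈tσ j)
           (trans (*-congˡ (indicator-no (em _) (isolated j j<κ))) (zeroʳ t)))
       , (λ f _ → t , value f κ , t∈ , trans (*-comm t _) (*-congˡ (sym gκ≈t)))
       , λ x xg≈0 → t , t∈ , trans (*-comm t x) (trans (*-congˡ (sym gκ≈t)) xg≈0)
      where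
      σ : Vertex → Carrier
      σ v = indicator (em _ {Connected Gₛ κ v})

      edge : ∀ e → ∃ λ t → t ∈ S̲ × (t * (σ (source e) - σ (target e))) ∈ᴵ label e
      edge e with em _ {Trivial Gₛ e}
      ... | yes triv  = trivial-edge triv _
      ... | no  ¬triv = zero-edge e (trans
        (+-congʳ (indicator-⇔ (em _) (em _)
          (λ conn → conn ◅◅ fwd (e , ¬triv , ≡.refl , ≡.refl) ◅ ε)
          (λ conn → conn ◅◅ bwd (e , ¬triv , ≡.refl , ≡.refl) ◅ ε)))
        (-‿inverseʳ _))

    module _ (mono : Regular1Mono Gₛ) {j} (j<κ : toℕ j ℕ.< toℕ κ) (κ∼j : Connected Gₛ κ j) where

      private
        -- A determining subgraph needs an edge, and the path to `j` is nonempty as j ≠ κ. If its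
        -- first edge is traversed backwards, the source is the far end, reached from `κ` by that
        -- same edge.
        incident-edge : ∀ {j} → toℕ j ℕ.< toℕ κ → Connected Gₛ κ j →
          ∃ λ e → ¬ Trivial Gₛ e × Connected Gₛ κ (source e)
        incident-edge j<κ ε = contradiction j<κ (ℕ.<-irrefl ≡.refl)
        incident-edge j<κ (fwd (e , ¬triv , ≡.refl , _) ◅ _) = e , ¬triv , ε
        incident-edge j<κ (bwd (e , ¬triv , s≡ , t≡) ◅ _) =
          e , ¬triv , bwd (e , ¬triv , ≡.refl , t≡) ◅ ε

        H : DeterminingSubgraph Gₛ
        H = record { root = κ ; nonempty = incident-edge j<κ κ∼j }

        open DeterminingSubgraph H using (HasEdge)

        I = proj₁ (mono H)
        label≐I = proj₁ (proj₂ (mono H))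
        γ = proj₁ (proj₂ (proj₂ (mono H)))
        γ-regular = proj₁ (proj₂ (proj₂ (proj₂ (mono H))))
        I≐γ = proj₂ (proj₂ (proj₂ (proj₂ (mono H))))

        -- The denominator of `γ` is a unit in the localization, so the numerator generates the same
        -- ideal and is equally regular there.
        g₀ : Carrier
        g₀ = num γ

        g₀∈label : ∀ e → HasEdge e → ∃ λ t → t ∈ S̲ × (t * g₀) ∈ᴵ label e
        g₀∈label e e∈H = ∈-extend⇒ S (label e)
          (proj₂ (label≐I e e∈H) (proj₂ I≐γ (Loc.1# , Loc.sym (Loc.*-identityˡ γ))))

        label⊆g₀ : ∀ e → HasEdge e → ∀ {x} → x ∈ᴵ label e →
                   ∃₂ λ t r → t ∈ S̲ × t * x ≈ r * g₀
        label⊆g₀ e e∈H {x} x∈ with proj₁ I≐γ (proj₁ (label≐I e e∈H) (∈⇒fromR∈ S (label e) x∈))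
        ... | ρ , mk≈ t t∈ eq = t * (den ρ * den γ) , t * num ρ
          , *∈ t∈ (*∈ (den∈S ρ) (den∈S γ))
          , trans (trans (solve 3 (λ t d x → (t :* d) :* x := t :* (x :* d)) refl t _ x) eq)
              (solve 3 (λ t n g → t :* ((n :* g) :* con 1) := (t :* n) :* g)
                refl t (num ρ) g₀)

        g₀-regular : ∀ x → x * g₀ ≈ 0# → ∃ λ t → t ∈ S̲ × t * x ≈ 0#
        g₀-regular x xg₀≈0 with γ-regular (fromR x) (mk≈ 1# 1∈ (*-congˡ
          (trans (*-congʳ (trans (*-comm g₀ x) xg₀≈0))
            (solve 1 (λ d → con 0 :* con 1 := con 0 :* (d :* con 1)) refl (den γ)))))
        ... | mk≈ t t∈ eq = t , t∈ , trans (*-congˡ (sym (*-identityʳ x)))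
          (trans eq (solve 1 (λ t → t :* (con 0 :* con 1) := con 0) refl t))

        δ : Vertex → Carrier
        δ v = indicator (v ≟ κ)

        σ : Vertex → Carrier
        σ v = δ v * g₀

        near-edge : ∀ e → HasEdge e →
          ∃ λ t → t ∈ S̲ × (t * (σ (source e) - σ (target e))) ∈ᴵ label e
        near-edge e e∈H = let (t , t∈ , tg₀∈) = g₀∈label e e∈H in t , t∈ , Ideal.resp (label e)
          (trans (solve 3 (λ d t g → d :* (t :* g) := t :* (d :* g)) refl _ t g₀)
            (*-congˡ ([y-z]x≈yx-zx g₀ (δ (source e)) (δ (target e)))))
          (Ideal.*∈ (label e) (δ (source e) - δ (target e)) tg₀∈)

        edge : ∀ e → ∃ λ t → t ∈ S̲ × (t * (σ (source e) - σ (target e))) ∈ᴵ label e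
        edge e with em _ {Trivial Gₛ e}
        ... | yes triv  = trivial-edge triv _
        ... | no  ¬triv with em _ {source e ≡ κ} | em _ {target e ≡ κ}
        ...   | yes s≡κ | _       =
          near-edge e (¬triv , ≡.subst (Connected Gₛ κ) (≡.sym s≡κ) ε)
        ...   | no  s≢κ | yes t≡κ = near-edge e (¬triv , bwd (e , ¬triv , ≡.refl , t≡κ) ◅ ε)
        ...   | no  s≢κ | no  t≢κ = zero-edge e (trans
          (+-cong (vanish s≢κ) (-‿cong (vanish t≢κ))) (-‿inverseʳ 0#))
          where
          vanish : ∀ {v} → ¬ v ≡ κ → σ v ≈ 0#
          vanish v≢κ = trans (*-congʳ (indicator-no (_ ≟ κ) v≢κ)) (zeroˡ g₀)

        telescope : ∀ x y z → (x - y) + (y - z) ≈ x - z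
        telescope x y z = trans
          (solve 4 (λ x y y′ z′ → (x :+ y′) :+ (y :+ z′) := (x :+ z′) :+ (y :+ y′))
            refl x y (- y) (- z))
          (trans (+-congˡ (-‿inverseʳ y)) (+-identityʳ (x - z)))

        step : ∀ (f : Spline G) {u v} → Connected Gₛ κ u → SymClosure (Adjacent Gₛ) u v →
               ∃₂ λ t r → t ∈ S̲ × t * (value f u - value f v) ≈ r * g₀
        step f κ∼u (fwd (e , ¬triv , ≡.refl , ≡.refl)) =
          label⊆g₀ e (¬triv , κ∼u) (compatible f e)
        step f {u} {v} κ∼u a@(bwd (e , ¬triv , ≡.refl , ≡.refl)) =
          label⊆g₀ e (¬triv , κ∼u ◅◅ a ◅ ε)
            (Ideal.resp (label e) negate (-∈ {R = R} (label e) (compatible f e)))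
          where
          open RingProperties ring using (⁻¹-anti-homo‿-)
          negate : - (value f v - value f u) ≈ value f u - value f v
          negate = ⁻¹-anti-homo‿- (value f v) (value f u)

        along-path : ∀ (f : Spline G) {u v} → Connected Gₛ κ u → Connected Gₛ u v →
                     ∃₂ λ t r → t ∈ S̲ × t * (value f u - value f v) ≈ r * g₀
        along-path f κ∼u ε = 1# , 0# , 1∈ ,
          trans (*-congˡ (-‿inverseʳ _)) (trans (zeroʳ 1#) (sym (zeroˡ g₀)))
        along-path f {u} {v} κ∼u (_◅_ {j = w} a path)
          with step f κ∼u a | along-path f (κ∼u ◅◅ a ◅ ε) path
        ... | t , r , t∈ , h | t′ , r′ , t′∈ , h′ = t * t′ , t′ * r + t * r′ , *∈ t∈ t′∈ , (begin
          (t * t′) * (value f u - value f v)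
            ≈⟨ *-congˡ (telescope (value f u) (value f w) (value f v)) ⟨
          (t * t′) * ((value f u - value f w) + (value f w - value f v))
            ≈⟨ solve 4 (λ t t′ x y → (t :* t′) :* (x :+ y) := t′ :* (t :* x) :+ t :* (t′ :* y))
                 refl t t′ _ _ ⟩
          t′ * (t * (value f u - value f w)) + t * (t′ * (value f w - value f v))
            ≈⟨ +-cong (*-congˡ h) (*-congˡ h′) ⟩
          t′ * (r * g₀) + t * (r′ * g₀)
            ≈⟨ solve 5 (λ t t′ r r′ g → t′ :* (r :* g) :+ t :* (r′ :* g)
                 := (t′ :* r :+ t :* r′) :* g) refl t t′ r r′ g₀ ⟩
          (t′ * r + t * r′) * g₀ ∎)
          where open SetoidReasoning setoid

      -- The function with value `g₀` at `κ` and 0 elsewhere is locally a spline: nontrivial edges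
      -- at `κ` belong to `H` and have label (γ). Conversely, adding up differences along the path
      -- from `κ` to `j` makes f(κ) - f(j) locally a multiple of `g₀`, and f(j) = 0.
      generator-connected : LocalGenerator S κ
      generator-connected =
        let (τ , τ∈ , g , g≈τσ) = clear-denominators σ edge
            gκ≈τg₀ : value g κ ≈ τ * g₀
            gκ≈τg₀ = trans (g≈τσ κ) (*-congˡ
              (trans (*-congʳ (indicator-yes (κ ≟ κ) ≡.refl)) (*-identityˡ g₀)))
        in g
         , (λ v v<κ → trans (g≈τσ v) (trans (*-congˡ (trans
             (*-congʳ (indicator-no (v ≟ κ) λ v≡κ → ℕ.<-irrefl (≡.cong toℕ v≡κ) v<κ))
             (zeroˡ g₀))) (zeroʳ τ)))
         , (λ f f<κ → let (t , r , t∈ , h) = along-path f ε κ∼j in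
             τ * t , r , *∈ τ∈ t∈ , trans (*-assoc τ t _) (trans
               (*-congˡ (trans (*-congˡ (sym (trans (+-congˡ (trans (-‿cong (f<κ j j<κ)) -0#≈0#))
                                                    (+-identityʳ _)))) h))
               (trans (solve 3 (λ τ r g → τ :* (r :* g) := r :* (τ :* g)) refl τ r g₀)
                 (*-congˡ (sym gκ≈τg₀)))))
         , λ x xg≈0 →
             let (t , t∈ , h) = g₀-regular (x * τ)
                   (trans (*-assoc x τ g₀) (trans (*-congˡ (sym gκ≈τg₀)) xg≈0))
             in t * τ , *∈ t∈ τ∈ , trans
                  (solve 3 (λ t τ x → (t :* τ) :* x := t :* (x :* τ)) refl t τ x) h

  localGenerator : Regular1Mono Gₛ → ∀ κ → LocalGenerator S κ
  localGenerator mono κ with em _ {∃ λ j → toℕ j ℕ.< toℕ κ × Connected Gₛ κ j}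
  ... | yes (j , j<κ , κ∼j) = generator-connected κ mono j<κ κ∼j
  ... | no  isolated        = generator-isolated κ λ j j<κ κ∼j → isolated (j , j<κ , κ∼j)

-- Splitting the filtration

module CoordinateModule {R : CommutativeRing c ℓ} {M : Module R μ ℓμ} {N : ℕ}
                        (coordinates : Coordinates M N) where
  open CommutativeRing R hiding (zero)
  open Coordinates coordinates
  open RingProperties ring using (-0#≈0#; +-inverseˡ-unique)
  private module M = Module M

  at-0 : ∀ v → at v M.0ᴹ ≈ 0#
  at-0 v = trans (at-cong v (M.≈ᴹ-sym (M.*ₗ-zeroˡ M.0ᴹ)))
    (trans (at-* v 0# M.0ᴹ) (zeroˡ _))

  at-neg : ∀ v f → at v (M.-ᴹ f) ≈ - at v f
  at-neg v f = +-inverseˡ-unique _ _ (trans (sym (at-+ v _ f))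
    (trans (at-cong v (M.-ᴹ‿inverseˡ f)) (at-0 v)))

  vanishes-+ : ∀ {k f g} → VanishesBelow k f → VanishesBelow k g → VanishesBelow k (f M.+ᴹ g)
  vanishes-+ f<k g<k v v<k =
    trans (at-+ v _ _) (trans (+-cong (f<k v v<k) (g<k v v<k)) (+-identityˡ 0#))

  vanishes-* : ∀ {k} r {f} → VanishesBelow k f → VanishesBelow k (r M.*ₗ f)
  vanishes-* r f<k v v<k = trans (at-* v r _) (trans (*-congˡ (f<k v v<k)) (zeroʳ r))

  vanishes-neg : ∀ {k f} → VanishesBelow k f → VanishesBelow k (M.-ᴹ f)
  vanishes-neg f<k v v<k = trans (at-neg v _) (trans (-‿cong (f<k v v<k)) -0#≈0#)

  vanishes-suc : ∀ (κ : Fin N) {f} → VanishesBelow (toℕ κ) f → at κ f ≈ 0# →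
                 VanishesBelow (ℕ.suc (toℕ κ)) f
  vanishes-suc κ f<κ fκ≈0 v (s≤s v≤κ) with ℕ.m≤n⇒m<n∨m≡n v≤κ
  ... | inj₁ v<κ = f<κ v v<κ
  ... | inj₂ v≡κ with toℕ-injective v≡κ
  ...   | ≡.refl = fκ≈0

  vanishes-pred : ∀ {k f} → VanishesBelow (ℕ.suc k) f → VanishesBelow k f
  vanishes-pred f<k v v<k = f<k v (ℕ.m<n⇒m<1+n v<k)

  vanishes-0 : ∀ {k} → VanishesBelow k M.0ᴹ
  vanishes-0 v _ = at-0 v

  vanishes-resp : ∀ {k f g} → f M.≈ᴹ g → VanishesBelow k f → VanishesBelow k g
  vanishes-resp f≈g f<k v v<k = trans (sym (at-cong v f≈g)) (f<k v v<k)

  -- Closure rules instead of coefficient tuples, so that linear statements are proved by induction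
  -- without manipulating sums.
  data Span {n} (u : Fin n → M.Carrierᴹ) : Pred M.Carrierᴹ (c ⊔ μ ⊔ ℓμ) where
    span-gen  : ∀ i → u i ∈ Span u
    span-resp : ∀ {f g} → f M.≈ᴹ g → f ∈ Span u → g ∈ Span u
    span-0    : M.0ᴹ ∈ Span u
    span-+    : ∀ {f g} → f ∈ Span u → g ∈ Span u → f M.+ᴹ g ∈ Span u
    span-*    : ∀ r {f} → f ∈ Span u → r M.*ₗ f ∈ Span u

  GeneratedBelow : ℕ → Set _
  GeneratedBelow k = ∃₂ λ n (u : Fin n → M.Carrierᴹ) →
    (∀ i → VanishesBelow k (u i)) × (∀ f → VanishesBelow k f → f ∈ Span u)

  span-mono : ∀ {n n′} {u : Fin n → M.Carrierᴹ} {u′ : Fin n′ → M.Carrierᴹ} →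
              (∀ i → u i ∈ Span u′) → ∀ {f} → f ∈ Span u → f ∈ Span u′
  span-mono h (span-gen i)     = h i
  span-mono h (span-resp e s)  = span-resp e (span-mono h s)
  span-mono h span-0           = span-0
  span-mono h (span-+ s t)     = span-+ (span-mono h s) (span-mono h t)
  span-mono h (span-* r s)     = span-* r (span-mono h s)

  linearCombination-∈-span : ∀ {n} r (u : Fin n → M.Carrierᴹ) →
                             linearCombination M r u ∈ Span u
  linearCombination-∈-span {zero}    r u = span-0
  linearCombination-∈-span {ℕ.suc n} r u = span-+ (span-* (r zero) (span-gen zero))
    (span-mono (span-gen ∘ suc) (linearCombination-∈-span (r ∘ suc) (u ∘ suc)))

  generatedBelow-0 : FinitelyGenerated M → GeneratedBelow 0
  generatedBelow-0 (n , u , h) = n , u , (λ i v ()) , λ f _ → let (r , e) = h f in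
    span-resp (M.≈ᴹ-sym e) (linearCombination-∈-span r u)

  -- Linearity of a total function on the elements vanishing below `k`, which avoids forming that
  -- submodule. Equality of κ-th coordinates as `_≋_` makes the restricted map factor through
  -- evaluation at κ.
  record IsLinearOn (k : ℕ) (_≋_ : Rel M.Carrierᴹ ρ) (X : Module R α ℓα)
                    (φ : M.Carrierᴹ → Module.Carrierᴹ X) : Set (c ⊔ ℓ ⊔ μ ⊔ ρ ⊔ ℓα) where
    private module X = Module X
    field
      cong   : ∀ {f g} → VanishesBelow k f → VanishesBelow k g → f ≋ g → φ f X.≈ᴹ φ g
      +-homo : ∀ {f g} → VanishesBelow k f → VanishesBelow k g →
               φ (f M.+ᴹ g) X.≈ᴹ φ f X.+ᴹ φ g
      *-homo : ∀ r {f} → VanishesBelow k f → φ (r M.*ₗ f) X.≈ᴹ r X.*ₗ φ f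

  module _ {k : ℕ} {_≋_ : Rel M.Carrierᴹ ρ} (X : Module R α ℓα) where
    private module X = Module X
    open CommutativeSemigroupProperties
      (CommutativeMonoid.commutativeSemigroup X.+ᴹ-commutativeMonoid) using (interchange)
    open IsLinearOn

    linear-0 : IsLinearOn k _≋_ X (λ _ → X.0ᴹ)
    linear-0 = record
      { cong   = λ _ _ _ → X.≈ᴹ-refl
      ; +-homo = λ _ _ → X.≈ᴹ-sym (X.+ᴹ-identityˡ X.0ᴹ)
      ; *-homo = λ r _ → X.≈ᴹ-sym (X.*ₗ-zeroʳ r)
      }

    linear-+ : ∀ {φ ψ} → IsLinearOn k _≋_ X φ → IsLinearOn k _≋_ X ψ →
               IsLinearOn k _≋_ X (λ f → φ f X.+ᴹ ψ f)
    linear-+ φ ψ = record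
      { cong   = λ f<k g<k e → X.+ᴹ-cong (cong φ f<k g<k e) (cong ψ f<k g<k e)
      ; +-homo = λ f<k g<k → X.≈ᴹ-trans (X.+ᴹ-cong (+-homo φ f<k g<k) (+-homo ψ f<k g<k))
          (interchange _ _ _ _)
      ; *-homo = λ r f<k → X.≈ᴹ-trans (X.+ᴹ-cong (*-homo φ r f<k) (*-homo ψ r f<k))
          (X.≈ᴹ-sym (X.*ₗ-distribˡ r _ _))
      }

    linear-* : ∀ t {φ} → IsLinearOn k _≋_ X φ → IsLinearOn k _≋_ X (λ f → t X.*ₗ φ f)
    linear-* t φ = record
      { cong   = λ f<k g<k e → X.*ₗ-cong refl (cong φ f<k g<k e)
      ; +-homo = λ f<k g<k → X.≈ᴹ-trans (X.*ₗ-cong refl (+-homo φ f<k g<k)) (X.*ₗ-distribˡ t _ _)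
      ; *-homo = λ r f<k → X.≈ᴹ-trans (X.*ₗ-cong refl (*-homo φ r f<k))
          (Module.*ₗ-comm X t r _)
      }

module _ (em : ∀ ℓ → ExcludedMiddle ℓ) (zorn : ∀ a ℓ₁ ℓ₂ b → ZornsLemma a ℓ₁ ℓ₂ b)
         {R : CommutativeRing c ℓ} {M : Module R μ ℓμ} {N : ℕ} (coordinates : Coordinates M N)
         (localGenerators : ∀ (𝔭 : Spec R) κ →
            Coordinates.LocalGenerator coordinates (complement R 𝔭) κ) where
  open CommutativeRing R hiding (zero)
  open Coordinates coordinates
  open CoordinateModule coordinates
  open RingProperties ring using
    (x[y-z]≈xy-xz; [y-z]x≈yx-zx; x∙y⁻¹≈ε⇒x≈y; x≈y⇒x∙y⁻¹≈ε)
  open SemiringSolver commutativeSemiring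
  private module M = Module M

  -- At every prime, J_κ contains a locally regular element, so the annihilator of `x` has a member
  -- outside that prime.
  faithful : ∀ κ x → (∀ f → VanishesBelow (toℕ κ) f → x * at κ f ≈ 0#) → x ≈ 0#
  faithful κ x h = trans (sym (*-identityˡ x)) (1∈-if-in-no-prime em zorn R annihilator λ 𝔭 →
    let (g , g<κ , _ , regular) = localGenerators 𝔭 κ
        (t , t∉𝔭 , tx≈0) = regular x (h g g<κ)
    in t , tx≈0 , t∉𝔭)
    where
    annihilator : Ideal R ℓ
    annihilator = record
      { member = λ r → r * x ≈ 0#
      ; resp   = λ e h → trans (*-congʳ (sym e)) h
      ; 0∈     = zeroˡ x
      ; +∈     = λ h k → trans (distribʳ x _ _) (trans (+-cong h k) (+-identityˡ 0#))
      ; *∈     = λ r h → trans (*-assoc r _ x) (trans (*-congˡ h) (zeroʳ r))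
      }

  -- The local generator spread out from `𝔭` to the open set D(t): one `t` serves all `f` and all
  -- torsion. It is a product of the denominators belonging to finitely many generators of M_κ.
  record UniformGenerator (𝔭 : Spec R) (κ : Fin N) : Set (c ⊔ ℓ ⊔ μ) where
    field
      g        : M.Carrierᴹ
      g<κ      : VanishesBelow (toℕ κ) g
      t        : Carrier
      t∉𝔭      : 𝔭 ∈ D R t
      multiple : ∀ f → VanishesBelow (toℕ κ) f → ∃ λ r → t * at κ f ≈ r * at κ g
      torsion  : ∀ x → x * at κ g ≈ 0# → t * x ≈ 0#

  uniformGenerator : ∀ 𝔭 κ → GeneratedBelow (toℕ κ) → UniformGenerator 𝔭 κ
  uniformGenerator 𝔭 κ (n , u , u<κ , spans) = record
    { g = g ; g<κ = g<κ ; t = t ; t∉𝔭 = t∉𝔭 ; multiple = multiple ; torsion = torsion }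
    where
    open MultiplicativeSubset (complement R 𝔭) using (1∈; *∈)

    g = proj₁ (localGenerators 𝔭 κ)
    g<κ = proj₁ (proj₂ (localGenerators 𝔭 κ))

    common : ∀ {n} (u : Fin n → M.Carrierᴹ) → (∀ i → VanishesBelow (toℕ κ) (u i)) →
             ∃ λ t → 𝔭 ∈ D R t × ∀ i → ∃ λ r → t * at κ (u i) ≈ r * at κ g
    common {zero}    u u<κ = 1# , 1∈ , λ ()
    common {ℕ.suc n} u u<κ
      with proj₁ (proj₂ (proj₂ (localGenerators 𝔭 κ))) (u zero) (u<κ zero)
         | common (u ∘ suc) (u<κ ∘ suc)
    ... | t , r , t∉ , e | t′ , t′∉ , h = t * t′ , *∈ t∉ t′∉ , λ where
      zero    → t′ * r , trans (solve 3 (λ t t′ x → (t :* t′) :* x := t′ :* (t :* x)) refl t t′ _)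
                           (trans (*-congˡ e) (sym (*-assoc t′ r _)))
      (suc i) → let (r′ , e′) = h i in
        t * r′ , trans (*-assoc t t′ _) (trans (*-congˡ e′) (sym (*-assoc t r′ _)))

    t = proj₁ (common u u<κ)
    t∉𝔭 = proj₁ (proj₂ (common u u<κ))

    span-multiple : ∀ {f} → f ∈ Span u → ∃ λ r → t * at κ f ≈ r * at κ g
    span-multiple (span-gen i)    = proj₂ (proj₂ (common u u<κ)) i
    span-multiple (span-resp e s) = let (r , h) = span-multiple s in
      r , trans (*-congˡ (at-cong κ (M.≈ᴹ-sym e))) h
    span-multiple span-0          = 0# , trans (*-congˡ (at-0 κ)) (trans (zeroʳ t) (sym (zeroˡ _)))
    span-multiple (span-+ s s′)   = let (r , h) = span-multiple s ; (r′ , h′) = span-multiple s′ in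
      r + r′ , trans (*-congˡ (at-+ κ _ _))
        (trans (distribˡ t _ _) (trans (+-cong h h′) (sym (distribʳ _ r r′))))
    span-multiple (span-* x {f} s) = let (r , h) = span-multiple s in
      x * r , trans (*-congˡ (at-* κ x f))
        (trans (solve 3 (λ t x f → t :* (x :* f) := x :* (t :* f)) refl t x (at κ f))
               (trans (*-congˡ h) (sym (*-assoc x r _))))

    multiple : ∀ f → VanishesBelow (toℕ κ) f → ∃ λ r → t * at κ f ≈ r * at κ g
    multiple f f<κ = span-multiple (spans f f<κ)

    -- x annihilates every t f(κ), so t x annihilates the values at κ, which form a
    -- faithful ideal.
    torsion : ∀ x → x * at κ g ≈ 0# → t * x ≈ 0#
    torsion x xg≈0 = faithful κ (t * x) λ f f<κ → let (r , e) = multiple f f<κ in begin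
      (t * x) * at κ f    ≈⟨ solve 3 (λ t x f → (t :* x) :* f := x :* (t :* f)) refl t x _ ⟩
      x * (t * at κ f)    ≈⟨ *-congˡ e ⟩
      x * (r * at κ g)    ≈⟨ solve 3 (λ x r g → x :* (r :* g) := r :* (x :* g)) refl x r _ ⟩
      r * (x * at κ g)    ≈⟨ *-congˡ xg≈0 ⟩
      r * 0#                 ≈⟨ zeroʳ r ⟩
      0#                     ∎
      where open SetoidReasoning setoid

  module Coordinate {𝔭 κ} (gen : UniformGenerator 𝔭 κ) where
    open UniformGenerator gen

    -- In effect t² f(κ) / g(κ). The quotient `r` is determined only up to the annihilator of g(κ),
    -- which `t` kills, so t r is well defined. The value 0 is a default met only by elements that
    -- do not vanish below `κ`.
    coordinate : M.Carrierᴹ → Carrier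
    coordinate f with em _ {∃ λ r → t * at κ f ≈ r * at κ g}
    ... | yes (r , _) = t * r
    ... | no _        = 0#

    coordinate-≈ : ∀ f {r} → t * at κ f ≈ r * at κ g → coordinate f ≈ t * r
    coordinate-≈ f {r} tf≈rg with em _ {∃ λ r → t * at κ f ≈ r * at κ g}
    ... | no ∄           = contradiction (r , tf≈rg) ∄
    ... | yes (r′ , tf≈r′g) = x∙y⁻¹≈ε⇒x≈y _ _
      (trans (sym (x[y-z]≈xy-xz t r′ r)) (torsion (r′ - r)
        (trans ([y-z]x≈yx-zx _ r′ r) (x≈y⇒x∙y⁻¹≈ε (trans (sym tf≈r′g) tf≈rg)))))

    coordinate-value : ∀ f → VanishesBelow (toℕ κ) f →
                       coordinate f * at κ g ≈ (t * t) * at κ f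
    coordinate-value f f<κ = let (r , e) = multiple f f<κ in
      trans (*-congʳ (coordinate-≈ f e)) (trans (*-assoc t r _)
        (trans (*-congˡ (sym e)) (sym (*-assoc t t _))))

    linear-coordinate : (X : Module R α ℓα) (x : Module.Carrierᴹ X) →
      IsLinearOn (toℕ κ) (λ f g → at κ f ≈ at κ g) X (λ f → Module._*ₗ_ X (coordinate f) x)
    linear-coordinate X x = record
      { cong = λ {f} {f′} _ f′<κ e → let (r , h) = multiple f′ f′<κ in
          X.*ₗ-cong (trans (coordinate-≈ f (trans (*-congˡ e) h))
                           (sym (coordinate-≈ f′ h))) X.≈ᴹ-refl
      ; +-homo = λ {f} {f′} f<κ f′<κ →
          let (r , h) = multiple f f<κ ; (r′ , h′) = multiple f′ f′<κ in
          X.≈ᴹ-trans (X.*ₗ-cong (trans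
              (coordinate-≈ (f M.+ᴹ f′) (trans (*-congˡ (at-+ κ f f′)) (trans (distribˡ t _ _)
                (trans (+-cong h h′) (sym (distribʳ _ r r′))))))
              (trans (distribˡ t r r′)
                (+-cong (sym (coordinate-≈ f h)) (sym (coordinate-≈ f′ h′))))) X.≈ᴹ-refl)
            (X.*ₗ-distribʳ x _ _)
      ; *-homo = λ y {f} f<κ → let (r , h) = multiple f f<κ in
          X.≈ᴹ-trans (X.*ₗ-cong (trans
              (coordinate-≈ (y M.*ₗ f) {y * r} (trans (*-congˡ (at-* κ y f)) (trans
                (solve 3 (λ t y f → t :* (y :* f) := y :* (t :* f)) refl t y (at κ f))
                (trans (*-congˡ h) (sym (*-assoc y r _))))))
              (trans (solve 3 (λ t y r → t :* (y :* r) := y :* (t :* r)) refl t y r)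
                (*-congˡ (sym (coordinate-≈ f h))))) X.≈ᴹ-refl)
            (X.*ₗ-assoc y _ x)
      }
      where module X = Module X

  module _ (X : Module R α ℓα) (Y : Module R β ℓβ)
    {q : Module.Carrierᴹ X → Module.Carrierᴹ Y}
    (q-hom : IsModuleHomomorphism (Module.rawModule X) (Module.rawModule Y) q)
    (q-surj : Surjective (Module._≈ᴹ_ X) (Module._≈ᴹ_ Y) q)
    {F : M.Carrierᴹ → Module.Carrierᴹ Y}
    (F-hom : IsModuleHomomorphism M.rawModule (Module.rawModule Y) F) where
    private
      module X = Module X
      module Y = Module Y
      module q = IsModuleHomomorphism q-hom
      module F = IsModuleHomomorphism F-hom

    -- For r = 1, σ is a section of the evaluation at κ composed with it, and λ̂ lifts
    -- F along q on the image of σ.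
    record Section (κ : Fin N) (r : Carrier) : Set (c ⊔ ℓ ⊔ μ ⊔ ℓμ ⊔ α ⊔ ℓα ⊔ ℓβ) where
      field
        σ        : M.Carrierᴹ → M.Carrierᴹ
        λ̂        : M.Carrierᴹ → X.Carrierᴹ
        σ-linear : IsLinearOn (toℕ κ) (λ f g → at κ f ≈ at κ g) M σ
        λ̂-linear : IsLinearOn (toℕ κ) (λ f g → at κ f ≈ at κ g) X λ̂
        σ-below  : ∀ {f} → VanishesBelow (toℕ κ) f → VanishesBelow (toℕ κ) (σ f)
        σ-value  : ∀ {f} → VanishesBelow (toℕ κ) f → at κ (σ f) ≈ r * at κ f
        lifts    : ∀ {f} → VanishesBelow (toℕ κ) f → q (λ̂ f) Y.≈ᴹ F (σ f)

    section-resp : ∀ {κ r r′} → r ≈ r′ → Section κ r → Section κ r′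
    section-resp r≈r′ s = record
      { σ = σ ; λ̂ = λ̂ ; σ-linear = σ-linear ; λ̂-linear = λ̂-linear ; σ-below = σ-below
      ; σ-value = λ f<κ → trans (σ-value f<κ) (*-congʳ r≈r′)
      ; lifts   = lifts
      }
      where open Section s

    section-0 : ∀ {κ} → Section κ 0#
    section-0 {κ} = record
      { σ        = λ _ → M.0ᴹ
      ; λ̂        = λ _ → X.0ᴹ
      ; σ-linear = linear-0 M
      ; λ̂-linear = linear-0 X
      ; σ-below  = λ _ → vanishes-0
      ; σ-value  = λ _ → trans (at-0 κ) (sym (zeroˡ _))
      ; lifts    = λ _ → Y.≈ᴹ-trans q.0ᴹ-homo (Y.≈ᴹ-sym F.0ᴹ-homo)
      }

    section-+ : ∀ {κ r r′} → Section κ r → Section κ r′ → Section κ (r + r′)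
    section-+ {κ} s s′ = record
      { σ        = λ f → S.σ f M.+ᴹ S′.σ f
      ; λ̂        = λ f → S.λ̂ f X.+ᴹ S′.λ̂ f
      ; σ-linear = linear-+ M S.σ-linear S′.σ-linear
      ; λ̂-linear = linear-+ X S.λ̂-linear S′.λ̂-linear
      ; σ-below  = λ f<κ → vanishes-+ (S.σ-below f<κ) (S′.σ-below f<κ)
      ; σ-value  = λ f<κ → trans (at-+ κ _ _)
          (trans (+-cong (S.σ-value f<κ) (S′.σ-value f<κ)) (sym (distribʳ _ _ _)))
      ; lifts    = λ f<κ → Y.≈ᴹ-trans (q.+ᴹ-homo _ _)
          (Y.≈ᴹ-trans (Y.+ᴹ-cong (S.lifts f<κ) (S′.lifts f<κ)) (Y.≈ᴹ-sym (F.+ᴹ-homo _ _)))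
      }
      where
      module S = Section s
      module S′ = Section s′

    section-* : ∀ {κ} x {r} → Section κ r → Section κ (x * r)
    section-* {κ} x s = record
      { σ        = λ f → x M.*ₗ σ f
      ; λ̂        = λ f → x X.*ₗ λ̂ f
      ; σ-linear = linear-* M x σ-linear
      ; λ̂-linear = linear-* X x λ̂-linear
      ; σ-below  = λ f<κ → vanishes-* x (σ-below f<κ)
      ; σ-value  = λ f<κ → trans (at-* κ x _)
          (trans (*-congˡ (σ-value f<κ)) (sym (*-assoc x _ _)))
      ; lifts    = λ f<κ → Y.≈ᴹ-trans (q.*ₗ-homo x _)
          (Y.≈ᴹ-trans (Y.*ₗ-cong refl (lifts f<κ)) (Y.≈ᴹ-sym (F.*ₗ-homo x _)))
      }
      where open Section s

    -- Partial sections add and scale, so local ones are patched by an ideal argument in place of an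
    -- explicit partition of unity. The lift `λ̂` travels with `σ` and is patched by the same
    -- coefficients.
    sections : Fin N → Ideal R _
    sections κ = record
      { member = Section κ
      ; resp   = section-resp
      ; 0∈     = section-0
      ; +∈     = section-+
      ; *∈     = section-*
      }

    -- At `𝔭` the map sending f to `coordinate f` times `g` splits the evaluation up to t², which is
    -- again outside `𝔭`. Its image consists of multiples of `g`, so a single preimage of F(g) under
    -- `q` gives the lift.
    splitting : ∀ κ → GeneratedBelow (toℕ κ) → Section κ 1#
    splitting κ gens = 1∈-if-in-no-prime em zorn R (sections κ) λ 𝔭 → let
      gen = uniformGenerator 𝔭 κ gens
      open UniformGenerator gen
      open Coordinate gen
      open MultiplicativeSubset (complement R 𝔭) using (*∈)
      (x , qx≈) = q-surj (F g)
      in t * t , record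
        { σ = λ f → coordinate f M.*ₗ g
        ; λ̂ = λ f → coordinate f X.*ₗ x
        ; σ-linear = linear-coordinate M g
        ; λ̂-linear = linear-coordinate X x
        ; σ-below  = λ {f} _ → vanishes-* (coordinate f) g<κ
        ; σ-value  = λ {f} f<κ → trans (at-* κ (coordinate f) g) (coordinate-value f f<κ)
        ; lifts    = λ _ → Y.≈ᴹ-trans (q.*ₗ-homo _ x)
            (Y.≈ᴹ-trans (Y.*ₗ-cong refl (qx≈ X.≈ᴹ-refl)) (Y.≈ᴹ-sym (F.*ₗ-homo _ g)))
        } , *∈ t∉𝔭 t∉𝔭

    module Projection {κ : Fin N} (s : Section κ 1#) where
      open Section s
      open IsLinearOn
      open AbelianGroupProperties M.+ᴹ-abelianGroup
        using (ε⁻¹≈ε; xyx⁻¹≈y; ⁻¹-∙-comm; inverseʳ-unique)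
      open CommutativeSemigroupProperties
        (CommutativeMonoid.commutativeSemigroup M.+ᴹ-commutativeMonoid) using (interchange)

      *ₗ-neg : ∀ r f → r M.*ₗ (M.-ᴹ f) M.≈ᴹ M.-ᴹ (r M.*ₗ f)
      *ₗ-neg r f = inverseʳ-unique _ _ (M.≈ᴹ-trans (M.≈ᴹ-sym (M.*ₗ-distribˡ r f _))
        (M.≈ᴹ-trans (M.*ₗ-cong refl (M.-ᴹ‿inverseʳ f)) (M.*ₗ-zeroʳ r)))

      π : M.Carrierᴹ → M.Carrierᴹ
      π f = f M.+ᴹ (M.-ᴹ σ f)

      π-below : ∀ {f} → VanishesBelow (toℕ κ) f → VanishesBelow (ℕ.suc (toℕ κ)) (π f)
      π-below {f} f<κ = vanishes-suc κ (vanishes-+ f<κ (vanishes-neg (σ-below f<κ)))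
        (trans (at-+ κ f _) (trans (+-congˡ (trans (at-neg κ (σ f))
          (-‿cong (trans (σ-value f<κ) (*-identityˡ _))))) (-‿inverseʳ _)))

      σ-vanishes : ∀ {f} → VanishesBelow (ℕ.suc (toℕ κ)) f → σ f M.≈ᴹ M.0ᴹ
      σ-vanishes {f} f<sκ = M.≈ᴹ-trans
        -- `f` and 0 · f agree at `κ`, and `σ` depends on that coordinate only.
        (cong σ-linear f<κ (vanishes-* 0# f<κ)
          (trans (f<sκ κ ℕ.≤-refl) (sym (trans (at-* κ 0# f) (zeroˡ _)))))
        (M.≈ᴹ-trans (*-homo σ-linear 0# f<κ) (M.*ₗ-zeroˡ (σ f)))
        where
        f<κ : VanishesBelow (toℕ κ) f
        f<κ = vanishes-pred f<sκ

      π-fixes : ∀ {f} → VanishesBelow (ℕ.suc (toℕ κ)) f → π f M.≈ᴹ f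
      π-fixes f<sκ = M.≈ᴹ-trans
        (M.+ᴹ-congˡ (M.≈ᴹ-trans (M.-ᴹ‿cong (σ-vanishes f<sκ)) ε⁻¹≈ε)) (M.+ᴹ-identityʳ _)

      σ+π : ∀ f → σ f M.+ᴹ π f M.≈ᴹ f
      σ+π f = M.≈ᴹ-trans (M.≈ᴹ-sym (M.+ᴹ-assoc (σ f) f _)) (xyx⁻¹≈y (σ f) f)

      π-linear : IsLinearOn (toℕ κ) M._≈ᴹ_ M π
      π-linear = record
        { cong   = λ f<κ g<κ e → M.+ᴹ-cong e (M.-ᴹ‿cong (cong σ-linear f<κ g<κ (at-cong κ e)))
        ; +-homo = λ f<κ g<κ → M.≈ᴹ-trans
            (M.+ᴹ-congˡ (M.≈ᴹ-trans (M.-ᴹ‿cong (+-homo σ-linear f<κ g<κ))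
                                    (M.≈ᴹ-sym (⁻¹-∙-comm _ _))))
            (interchange _ _ _ _)
        ; *-homo = λ r f<κ → M.≈ᴹ-trans
            (M.+ᴹ-congˡ (M.≈ᴹ-trans (M.-ᴹ‿cong (*-homo σ-linear r f<κ)) (M.≈ᴹ-sym (*ₗ-neg r _))))
            (M.≈ᴹ-sym (M.*ₗ-distribˡ r _ _))
        }

      -- `π` maps M_κ onto M_{κ+1}, which it fixes, so it carries generators to generators.
      generatedBelow-suc : GeneratedBelow (toℕ κ) → GeneratedBelow (ℕ.suc (toℕ κ))
      generatedBelow-suc (n , u , u<κ , spans) = n , π ∘ u , (λ i → π-below (u<κ i)) ,
        λ f f<sκ → span-resp (π-fixes f<sκ) (proj₂ (image (spans f (vanishes-pred f<sκ))))
        where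
        image : ∀ {f} → f ∈ Span u → VanishesBelow (toℕ κ) f × π f ∈ Span (π ∘ u)
        image (span-gen i) = u<κ i , span-gen i
        image (span-resp e s) = let (f<κ , h) = image s ; g<κ = vanishes-resp e f<κ in
          g<κ , span-resp (cong π-linear f<κ g<κ e) h
        image span-0 = vanishes-0 , span-resp (M.≈ᴹ-sym (π-fixes vanishes-0)) span-0
        image (span-+ s s′) = let (f<κ , h) = image s ; (g<κ , h′) = image s′ in
          vanishes-+ f<κ g<κ ,
          span-resp (M.≈ᴹ-sym (+-homo π-linear f<κ g<κ)) (span-+ h h′)
        image (span-* r s) = let (f<κ , h) = image s in
          vanishes-* r f<κ , span-resp (M.≈ᴹ-sym (*-homo π-linear r f<κ)) (span-* r h)

    LiftBelow : ℕ → Set _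
    LiftBelow k = ∃ λ (g : M.Carrierᴹ → X.Carrierᴹ) → IsLinearOn k M._≈ᴹ_ X g ×
      (∀ f → VanishesBelow k f → q (g f) Y.≈ᴹ F f)

    -- In f = σ f + π f, `λ̂` lifts F on the first summand and the lift already built on M_{κ+1}
    -- handles the second.
    lift-step : ∀ {κ} → Section κ 1# → LiftBelow (ℕ.suc (toℕ κ)) → LiftBelow (toℕ κ)
    lift-step {κ} s (g , g-linear , qg≈F) =
      (λ f → λ̂ f X.+ᴹ g (π f)) ,
      linear-+ X
        (record
          { cong   = λ f<κ h<κ e → cong λ̂-linear f<κ h<κ (at-cong κ e)
          ; +-homo = +-homo λ̂-linear
          ; *-homo = *-homo λ̂-linear
          })
        (record
          { cong   = λ f<κ h<κ e →
              cong g-linear (π-below f<κ) (π-below h<κ) (cong π-linear f<κ h<κ e)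
          ; +-homo = λ f<κ h<κ → X.≈ᴹ-trans
              (cong g-linear (π-below (vanishes-+ f<κ h<κ))
                (vanishes-+ (π-below f<κ) (π-below h<κ)) (+-homo π-linear f<κ h<κ))
              (+-homo g-linear (π-below f<κ) (π-below h<κ))
          ; *-homo = λ r f<κ → X.≈ᴹ-trans
              (cong g-linear (π-below (vanishes-* r f<κ)) (vanishes-* r (π-below f<κ))
                (*-homo π-linear r f<κ))
              (*-homo g-linear r (π-below f<κ))
          }) ,
      λ f f<κ → Y.≈ᴹ-trans (q.+ᴹ-homo _ _)
        (Y.≈ᴹ-trans (Y.+ᴹ-cong (lifts f<κ) (qg≈F (π f) (π-below f<κ)))
          (Y.≈ᴹ-trans (Y.≈ᴹ-sym (F.+ᴹ-homo (σ f) (π f)))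
            (F.⟦⟧-cong (σ+π f))))
      where
      open Section s
      open Projection s
      open IsLinearOn

    -- The recursion passes generators forward from `k` to `N` and returns lifts backward from M_N =
    -- 0.
    lift-all : ∀ d k → k ℕ.+ d ≡ N → GeneratedBelow k → LiftBelow k
    lift-all zero k k+0≡n _ = (λ _ → X.0ᴹ) , linear-0 X , λ f f<k →
      Y.≈ᴹ-trans q.0ᴹ-homo (Y.≈ᴹ-sym (Y.≈ᴹ-trans (F.⟦⟧-cong (at-faithful λ v → f<k v
        (≡.subst (toℕ v ℕ.<_) (≡.trans (≡.sym k+0≡n) (ℕ.+-identityʳ k)) (toℕ<n v))))
        F.0ᴹ-homo))
    lift-all (ℕ.suc d) k k+sd≡n gens
      with fromℕ< {k} {N} k<n | toℕ-fromℕ< {k} {N} k<n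
      where
      k<n : k ℕ.< N
      k<n = ≡.subst (k ℕ.<_) k+sd≡n (ℕ.m<m+n k ℕ.z<s)
    ... | κ | ≡.refl = lift-step s (lift-all d (ℕ.suc (toℕ κ))
      (≡.trans (≡.sym (ℕ.+-suc (toℕ κ) d)) k+sd≡n)
      (Projection.generatedBelow-suc s gens))
      where
      s : Section κ 1#
      s = splitting κ gens

  projective : GeneratedBelow 0 → Projective α ℓα β ℓβ M
  projective gens X Y q q-hom q-surj F F-hom
    with lift-all X Y q-hom q-surj F-hom N 0 ≡.refl gens
  ... | g , g-linear , qg≈F = g , record
    { isBimoduleHomomorphism = record
      { +ᴹ-isGroupHomomorphism = record
        { isMonoidHomomorphism = record
          { isMagmaHomomorphism = record
            { isRelHomomorphism = record { cong = cong g-linear (λ _ ()) (λ _ ()) }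
            ; homo = +-homo′
            }
          ; ε-homo = g0≈0
          }
        ; ⁻¹-homo = λ f → GroupProperties.inverseˡ-unique X.+ᴹ-group _ _
            (X.≈ᴹ-trans (X.≈ᴹ-sym (+-homo′ (M.-ᴹ f) f))
              (X.≈ᴹ-trans (cong g-linear (λ _ ()) (λ _ ())
                            (M.-ᴹ‿inverseˡ f)) g0≈0))
        }
      ; *ₗ-homo = *-homo′
      ; *ᵣ-homo = λ r f → X.≈ᴹ-trans
          (cong g-linear (λ _ ()) (λ _ ()) (M.≈ᴹ-sym (M.*ₗ-*ᵣ-coincident r f)))
          (X.≈ᴹ-trans (*-homo′ r f) (X.*ₗ-*ᵣ-coincident r (g f)))
      }
    } , λ f → qg≈F f (λ _ ())
    where
    module X = Module X
    open IsLinearOn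
    +-homo′ : ∀ f h → g (f M.+ᴹ h) X.≈ᴹ g f X.+ᴹ g h
    +-homo′ f h = +-homo g-linear (λ _ ()) (λ _ ())
    *-homo′ : ∀ r f → g (r M.*ₗ f) X.≈ᴹ r X.*ₗ g f
    *-homo′ r f = *-homo g-linear r (λ _ ())
    g0≈0 : g M.0ᴹ X.≈ᴹ X.0ᴹ
    g0≈0 = X.≈ᴹ-trans (cong g-linear (λ _ ()) (λ _ ())
        (M.≈ᴹ-sym (M.*ₗ-zeroˡ M.0ᴹ)))
      (X.≈ᴹ-trans (*-homo′ 0# M.0ᴹ) (X.*ₗ-zeroˡ _))

  -- A `Section` belongs to a lifting problem. Here only its `σ` matters, so the problem is the
  -- trivial one of lifting `id` along `id`.
  generatedBelow : GeneratedBelow 0 → ∀ k → k ℕ.≤ N → GeneratedBelow k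
  generatedBelow gens zero      _   = gens
  generatedBelow gens (ℕ.suc k) k<n
    with fromℕ< k<n | toℕ-fromℕ< k<n | generatedBelow gens k (ℕ.<⇒≤ k<n)
  ... | κ | ≡.refl | gensₖ = Projection.generatedBelow-suc M M
    id-hom id-surj id-hom (splitting M M
      id-hom id-surj id-hom κ gensₖ) gensₖ
    where
    id-hom : IsModuleHomomorphism M.rawModule M.rawModule id
    id-hom = Identity.isModuleHomomorphism M.rawModule M.≈ᴹ-refl
    id-surj : Surjective M._≈ᴹ_ M._≈ᴹ_ id
    id-surj f = f , λ e → e

-- Freeness over GCD domains

module _ {R : CommutativeRing c ℓ} {M : Module R μ ℓμ} {N : ℕ}
         (coordinates : Coordinates M N) where
  open CommutativeRing R hiding (zero)
  open Coordinates coordinates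
  open CoordinateModule coordinates
  private module M = Module M

  at-linearCombination-zero : ∀ {n} (r : Fin n → Carrier) (u : Fin n → M.Carrierᴹ) v →
    (∀ i → r i * at v (u i) ≈ 0#) → at v (linearCombination M r u) ≈ 0#
  at-linearCombination-zero {zero}    r u v h = at-0 v
  at-linearCombination-zero {ℕ.suc n} r u v h = trans (at-+ v _ _)
    (trans (+-cong (trans (at-* v (r zero) (u zero)) (h zero))
                   (at-linearCombination-zero (r ∘ suc) (u ∘ suc) v (h ∘ suc)))
      (+-identityˡ 0#))

  at-linearCombination-single : ∀ {n} (r : Fin n → Carrier) (u : Fin n → M.Carrierᴹ) v j →
    (∀ i → ¬ i ≡ j → r i * at v (u i) ≈ 0#) →
    at v (linearCombination M r u) ≈ r j * at v (u j)
  at-linearCombination-single r u v zero h = trans (at-+ v _ _)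
    (trans (+-cong (at-* v (r zero) (u zero))
                   (at-linearCombination-zero (r ∘ suc) (u ∘ suc) v λ i → h (suc i) λ ()))
      (+-identityʳ _))
  at-linearCombination-single r u v (suc j) h = trans (at-+ v _ _)
    (trans (+-cong (trans (at-* v (r zero) (u zero)) (h zero λ ()))
                   (at-linearCombination-single (r ∘ suc) (u ∘ suc) v j
                     λ i i≢j → h (suc i) (i≢j ∘ suc-injective)))
      (+-identityˡ _))

  module TriangularBasis (w : Fin N → M.Carrierᴹ)
    (w-below : ∀ κ → VanishesBelow (toℕ κ) (w κ))
    (w-divides : ∀ κ f → VanishesBelow (toℕ κ) f → ∃ λ r → at κ f ≈ r * at κ (w κ))
    (w-regular : ∀ κ x → x * at κ (w κ) ≈ 0# → x ≈ 0#) where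
    open AbelianGroupProperties M.+ᴹ-abelianGroup using (xyx⁻¹≈y)

    spans : ∀ d k → k ℕ.+ d ≡ N → ∀ f → VanishesBelow k f →
            ∃₂ λ n (i : Fin n → Fin N) → ∃ λ r → f M.≈ᴹ linearCombination M r (w ∘ i)
    spans zero k k+0≡N f f<k = 0 , (λ ()) , (λ ()) , at-faithful λ v → f<k v
      (≡.subst (toℕ v ℕ.<_) (≡.trans (≡.sym k+0≡N) (ℕ.+-identityʳ k)) (toℕ<n v))
    spans (ℕ.suc d) k k+sd≡N f f<k with fromℕ< {k} {N} k<N | toℕ-fromℕ< {k} {N} k<N
      where
      k<N : k ℕ.< N
      k<N = ≡.subst (k ℕ.<_) k+sd≡N (ℕ.m<m+n k ℕ.z<s)
    ... | κ | ≡.refl = let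
      (r , fκ≈rw) = w-divides κ f f<k
      g = r M.*ₗ w κ
      rest = f M.+ᴹ (M.-ᴹ g)
      rest-below : VanishesBelow (ℕ.suc (toℕ κ)) rest
      rest-below = vanishes-suc κ
        (vanishes-+ f<k (vanishes-neg (vanishes-* r (w-below κ))))
        (trans (at-+ κ f _) (trans (+-cong fκ≈rw (trans (at-neg κ g)
          (-‿cong (at-* κ r (w κ))))) (-‿inverseʳ _)))
      (n , i , s , rest≈) = spans d (ℕ.suc (toℕ κ))
        (≡.trans (≡.sym (ℕ.+-suc (toℕ κ) d)) k+sd≡N) rest rest-below
      in ℕ.suc n , (λ { zero → κ ; (suc j) → i j }) , (λ { zero → r ; (suc j) → s j }) ,
         M.≈ᴹ-trans (M.≈ᴹ-sym (M.≈ᴹ-trans (M.≈ᴹ-sym (M.+ᴹ-assoc g f _)) (xyx⁻¹≈y g f)))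
           (M.+ᴹ-congˡ rest≈)

    -- Strong induction on the position `i j`. At that coordinate, terms of smaller position have
    -- zero coefficient by induction, and those of larger position vanish.
    independent : ∀ {n} (i : Fin n → Fin N) → Injective _≡_ _≡_ i → ∀ r →
      linearCombination M r (w ∘ i) M.≈ᴹ M.0ᴹ → ∀ j → r j ≈ 0#
    independent i i-inj r lc≈0 j = below N j (toℕ<n (i j))
      where
      below : ∀ k j → toℕ (i j) ℕ.< k → r j ≈ 0#
      below (ℕ.suc k) j (s≤s ij≤k) = w-regular (i j) (r j) (trans
        (sym (at-linearCombination-single r (w ∘ i) (i j) j others))
        (trans (at-cong (i j) lc≈0) (at-0 (i j))))
        where
        others : ∀ j′ → ¬ j′ ≡ j → r j′ * at (i j) (w (i j′)) ≈ 0#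
        others j′ j′≢j with ℕ.<-cmp (toℕ (i j′)) (toℕ (i j))
        ... | tri< lt _ _ = trans (*-congʳ (below k j′ (ℕ.<-≤-trans lt ij≤k))) (zeroˡ _)
        ... | tri≈ _ eq _ = contradiction (i-inj (toℕ-injective eq)) j′≢j
        ... | tri> _ _ gt = trans (*-congˡ (w-below (i j′) (i j) gt)) (zeroʳ _)

    free : Free M
    free = Lift μ (Fin N) , w ∘ lower , record
      { spanning    = λ f → let (n , i , r , e) = spans N 0 ≡.refl f (λ _ ()) in
          n , lift ∘ i , r , e
      ; independent = λ i i-inj r e →
          independent (lower ∘ i) (i-inj ∘ ≡.cong lift) r e
      }

module _ (em : ∀ ℓ → ExcludedMiddle ℓ) (zorn : ∀ a ℓ₁ ℓ₂ b → ZornsLemma a ℓ₁ ℓ₂ b)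
         {R : CommutativeRing c ℓ} {M : Module R μ ℓμ} {N : ℕ} (coordinates : Coordinates M N)
         (localGenerators : ∀ (𝔭 : Spec R) κ →
            Coordinates.LocalGenerator coordinates (complement R 𝔭) κ)
         (isGCDDomain : IsGCDDomain R) where
  open CommutativeRing R hiding (zero)
  open Coordinates coordinates
  open CoordinateModule coordinates
  open Divisibility R
  open GCDDomain isGCDDomain
  open SemiringSolver commutativeSemiring
  private module M = Module M

  GlobalGenerator : Fin N → Set _
  GlobalGenerator κ = ∃ λ w → VanishesBelow (toℕ κ) w ×
    (∀ f → VanishesBelow (toℕ κ) f → ∃ λ r → at κ f ≈ r * at κ w) ×
    (∀ x → x * at κ w ≈ 0# → x ≈ 0#)

  -- Let J be the ideal of κ-th coordinates and 0 ≠ a ∈ J.  Since J is invertible,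
  -- J = (a) : ((a) : J), and in a GCD domain both colon ideals are principal.
  module _ (κ : Fin N) (gens : GeneratedBelow (toℕ κ))
    {f₀ : M.Carrierᴹ} (f₀<κ : VanishesBelow (toℕ κ) f₀) (a≉0 : ¬ at κ f₀ ≈ 0#) where

    private
      a : Carrier
      a = at κ f₀

      u : Fin (proj₁ gens) → M.Carrierᴹ
      u = proj₁ (proj₂ gens)

      u<κ : ∀ i → VanishesBelow (toℕ κ) (u i)
      u<κ = proj₁ (proj₂ (proj₂ gens))

      b : Carrier
      b = proj₁ (colons a (λ i → at κ (u i)))

      b-colon : ∀ x → (∀ i → a ∣ x * at κ (u i)) ⇔ b ∣ x
      b-colon = proj₂ (colons a (λ i → at κ (u i)))

      d : Carrier
      d = proj₁ (colon a b)

      d-colon : ∀ x → a ∣ x * b ⇔ d ∣ x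
      d-colon = proj₂ (colon a b)

      a∣b* : ∀ {f} → f ∈ Span u → a ∣ b * at κ f
      a∣b* (span-gen i)     = Equivalence.from (b-colon b) ∣-refl i
      a∣b* (span-resp e s)  = ∣-respʳ (*-congˡ (at-cong κ e)) (a∣b* s)
      a∣b* span-0           = ∣-respʳ (sym (trans (*-congˡ (at-0 κ)) (zeroʳ b))) (a ∣0)
      a∣b* (span-+ s t)     = ∣-respʳ
        (sym (trans (*-congˡ (at-+ κ _ _)) (distribˡ b _ _))) (∣-+ (a∣b* s) (a∣b* t))
      a∣b* (span-* r {f} s) = ∣-respʳ
        (trans (solve 3 (λ r b f → r :* (b :* f) := b :* (r :* f)) refl r b (at κ f))
          (*-congˡ (sym (at-* κ r f))))
        (x∣y⇒x∣zy r (a∣b* s))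

      d∣ : ∀ f → VanishesBelow (toℕ κ) f → d ∣ at κ f
      d∣ f f<κ = Equivalence.to (d-colon (at κ f))
        (∣-respʳ (*-comm b _) (a∣b* (proj₂ (proj₂ (proj₂ gens)) f f<κ)))

      d≉0 : ¬ d ≈ 0#
      d≉0 = x∣y∧y≉0⇒x≉0 (d∣ f₀ f₀<κ) a≉0

      -- The elements that multiply `d` into J. Once 1 is among them J = (d), since `d∣` gives the
      -- other inclusion.
      multiples : Ideal R _
      multiples = record
        { member = λ r → ∃ λ f → VanishesBelow (toℕ κ) f × at κ f ≈ r * d
        ; resp   = λ { e (f , f<κ , h) → f , f<κ , trans h (*-congʳ e) }
        ; 0∈     = M.0ᴹ , vanishes-0 , trans (at-0 κ) (sym (zeroˡ d))
        ; +∈     = λ { (f , f<κ , h) (g , g<κ , k) → f M.+ᴹ g , vanishes-+ f<κ g<κ ,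
            trans (at-+ κ f g) (trans (+-cong h k) (sym (distribʳ d _ _))) }
        ; *∈     = λ { r (f , f<κ , h) → r M.*ₗ f , vanishes-* r f<κ ,
            trans (at-* κ r f) (trans (*-congˡ h) (sym (*-assoc r _ d))) }
        }

      module _ {𝔭 : Spec R} (gen : UniformGenerator em zorn coordinates localGenerators 𝔭 κ) where
        open UniformGenerator gen
        open SetoidReasoning setoid

        r : Carrier
        r = proj₁ (multiple f₀ f₀<κ)

        ta≈rg : t * a ≈ r * at κ g
        ta≈rg = proj₂ (multiple f₀ f₀<κ)

        t≉0 : ¬ t ≈ 0#
        t≉0 t≈0 = t∉𝔭 (Ideal.resp (PrimeIdeal.ideal 𝔭) (sym t≈0) (Ideal.0∈ (PrimeIdeal.ideal 𝔭)))

        g≉0 : ¬ at κ g ≈ 0#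
        g≉0 g≈0 = *-nonzero t≉0 a≉0 (trans ta≈rg (trans (*-congˡ g≈0) (zeroʳ r)))

        -- r = t a / g(κ) multiplies J into (a), because each t u_i(κ) is a multiple of g(κ).
        b∣r : b ∣ r
        b∣r = Equivalence.to (b-colon r) λ i → let (s , tu≈sg) = multiple (u i) (u<κ i) in
          s , *-cancelˡ g≉0 (begin
            at κ g * (s * a)         ≈⟨ solve 3 (λ g s a → g :* (s :* a) := a :* (s :* g))
                                          refl (at κ g) s a ⟩
            a * (s * at κ g)         ≈⟨ *-congˡ tu≈sg ⟨
            a * (t * at κ (u i))     ≈⟨ solve 3 (λ a t u → a :* (t :* u) := (t :* a) :* u)
                                          refl a t (at κ (u i)) ⟩
            (t * a) * at κ (u i)     ≈⟨ *-congʳ ta≈rg ⟩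
            (r * at κ g) * at κ (u i)
              ≈⟨ solve 3 (λ r g u → (r :* g) :* u := g :* (r :* u)) refl r (at κ g) (at κ (u i)) ⟩
            at κ g * (r * at κ (u i)) ∎)

        a∣rd : a ∣ r * d
        a∣rd = ∣-trans (Equivalence.from (d-colon d) ∣-refl)
          (quotient b∣r , (begin
            quotient b∣r * (d * b)   ≈⟨ solve 3 (λ q d b → q :* (d :* b) := (q :* b) :* d)
                                          refl (quotient b∣r) d b ⟩
            (quotient b∣r * b) * d   ≈⟨ *-congʳ (equality b∣r) ⟩
            r * d                    ∎))

        -- With z = r d / a, the element z g has value r d g(κ) / a = t d at `κ`.
        t∈multiples : t ∈ᴵ multiples
        t∈multiples = z M.*ₗ g , vanishes-* z g<κ , *-cancelˡ a≉0 (begin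
          a * at κ (z M.*ₗ g)   ≈⟨ *-congˡ (at-* κ z g) ⟩
          a * (z * at κ g)      ≈⟨ solve 3 (λ a z g → a :* (z :* g) := (z :* a) :* g)
                                     refl a z (at κ g) ⟩
          (z * a) * at κ g      ≈⟨ *-congʳ (equality a∣rd) ⟩
          (r * d) * at κ g      ≈⟨ solve 3 (λ r d g → (r :* d) :* g := d :* (r :* g))
                                     refl r d (at κ g) ⟩
          d * (r * at κ g)      ≈⟨ *-congˡ ta≈rg ⟨
          d * (t * a)           ≈⟨ solve 3 (λ d t a → d :* (t :* a) := a :* (t :* d)) refl d t a ⟩
          a * (t * d)           ∎)
          where
          z : Carrier
          z = quotient a∣rd

    globalGenerator-nonzero : GlobalGenerator κ
    globalGenerator-nonzero = let
      (w , w<κ , w≈1d) = 1∈-if-in-no-prime em zorn R multiples λ 𝔭 → let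
        gen = uniformGenerator em zorn coordinates localGenerators 𝔭 κ gens
        in UniformGenerator.t gen , t∈multiples gen , UniformGenerator.t∉𝔭 gen
      w≈d = trans w≈1d (*-identityˡ d)
      in w , w<κ
       , (λ f f<κ → quotient (d∣ f f<κ) ,
           trans (sym (equality (d∣ f f<κ))) (*-congˡ (sym w≈d)))
       , λ x xw≈0 → [ id , (λ d≈0 → contradiction d≈0 d≉0) ]′
           (noZeroDivisors x d (trans (*-congˡ (sym w≈d)) xw≈0))

  globalGenerator : ∀ κ → GeneratedBelow (toℕ κ) → GlobalGenerator κ
  globalGenerator κ gens
    with em _ {∃ λ f → VanishesBelow (toℕ κ) f × ¬ at κ f ≈ 0#}
  ... | yes (f₀ , f₀<κ , a≉0) = globalGenerator-nonzero κ gens f₀<κ a≉0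
  -- J = 0 is faithful only over the zero ring, which `IsGCDDomain` admits; there every element is
  -- regular.
  ... | no ∄ = M.0ᴹ , vanishes-0
    , (λ f f<κ → 0# , trans (vanishes f f<κ) (sym (zeroˡ _)))
    , λ x _ → faithful em zorn coordinates localGenerators κ x
        λ f f<κ → trans (*-congˡ (vanishes f f<κ)) (zeroʳ x)
    where
    vanishes : ∀ f → VanishesBelow (toℕ κ) f → at κ f ≈ 0#
    vanishes f f<κ = decidable-stable (em _) λ fκ≉0 → ∄ (f , f<κ , fκ≉0)

  free : GeneratedBelow 0 → Free M
  free gens = TriangularBasis.free coordinates (λ κ → proj₁ (generator κ))
    (λ κ → proj₁ (proj₂ (generator κ)))
    (λ κ → proj₁ (proj₂ (proj₂ (generator κ))))
    (λ κ → proj₂ (proj₂ (proj₂ (generator κ))))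
    where
    generator : ∀ κ → GlobalGenerator κ
    generator κ = globalGenerator κ
      (generatedBelow em zorn coordinates localGenerators gens (toℕ κ) (ℕ.<⇒≤ (toℕ<n κ)))

-- From locally regular 1-mono graphs to the theorem

module _ (em : ∀ ℓ → ExcludedMiddle ℓ) {R : CommutativeRing c ℓ} (G : EdgeLabeledGraph R ι) where
  open CommutativeRing R hiding (zero)
  open Coordinates (splineCoordinates G) using (LocalGenerator)

  localGenerator-mono : ∀ {s t} (S : MultiplicativeSubset R s) (T : MultiplicativeSubset R t) →
    (∀ {x} → MultiplicativeSubset.member S x → MultiplicativeSubset.member T x) →
    ∀ {κ} → LocalGenerator S κ → LocalGenerator T κ
  localGenerator-mono S T S⊆T (g , g<κ , generates , regular) = g , g<κ
    , (λ f f<κ → let (t , r , t∈ , e) = generates f f<κ in t , r , S⊆T t∈ , e)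
    , λ x xg≈0 → let (t , t∈ , e) = regular x xg≈0 in t , S⊆T t∈ , e

  powers⊆complement : ∀ {f} (𝔭 : Spec R) → 𝔭 ∈ D R f → ∀ {x} →
    MultiplicativeSubset.member (powers R f) x → 𝔭 ∈ D R x
  powers⊆complement {f} 𝔭 f∉𝔭 (k , x≈fᵏ) x∈𝔭 = power∉ k (Ideal.resp ideal x≈fᵏ x∈𝔭)
    where
    open PrimeIdeal 𝔭
    open SemiringExp semiring using (_^_)
    power∉ : ∀ k → ¬ (f ^ k) ∈ᴵ ideal
    power∉ zero      1∈ = proper 1∈
    power∉ (ℕ.suc k) h  = [ f∉𝔭 , power∉ k ]′ (prime h)

  -- A prime in D(f) avoids all powers of `f`, so a generator found over R_f serves at that prime;
  -- covers thus reduce to prime ideals.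
  localGenerators : LocallyRegular1Mono G → ∀ (𝔭 : Spec R) κ →
                    LocalGenerator (complement R 𝔭) κ
  localGenerators (inj₁ (F , covers , mono)) 𝔭 κ = let (f , f∈F , f∉𝔭) = covers 𝔭 in
    localGenerator-mono (powers R f) (complement R 𝔭) (powers⊆complement 𝔭 f∉𝔭)
      (localGenerator em G (powers R f) (mono f f∈F) κ)
  localGenerators (inj₂ mono) 𝔭 κ = localGenerator em G (complement R 𝔭) (mono 𝔭) κ

isGCDDomain : (∀ ℓ → ExcludedMiddle ℓ) → {R : CommutativeRing c ℓ} →
              IsPID R ⊎ IsPolynomialRingOverPIDOrField α ℓα R → IsGCDDomain R
isGCDDomain em {R} (inj₁ pid) = PID⇒GCDDomain R pid
isGCDDomain em {R} (inj₂ (A , k , base , R≅A[x])) = GCDDomain-resp-≅ R (A [x₁⋯x k ]) R≅A[x]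
  ([x₁⋯x]-isGCDDomain em A ([ PID⇒GCDDomain A , field⇒GCDDomain em A ]′ base) k)

corollary6 :
    (∀ ℓ → ExcludedMiddle ℓ) →
    (∀ a ℓ₁ ℓ₂ b → ZornsLemma a ℓ₁ ℓ₂ b) →
    ∀ {c ℓ p} (R : CommutativeRing c ℓ) (G : EdgeLabeledGraph R p) →
    FinitelyGenerated (splineModule G) →
    LocallyRegular1Mono G →
    ∀ m ℓm n ℓn a ℓa →
      Projective m ℓm n ℓn (splineModule G)
      × (IsPID R ⊎ IsPolynomialRingOverPIDOrField a ℓa R → Free (splineModule G))
corollary6 em zorn R G finite mono m ℓm n ℓn a ℓa =
  projective em zorn (splineCoordinates G) (localGenerators em G mono) gens ,
  λ h → free em zorn (splineCoordinates G) (localGenerators em G mono) (isGCDDomain em h) gens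
  where
  gens = CoordinateModule.generatedBelow-0 (splineCoordinates G) finite
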